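{- Let $(n_j,k_j)_{j\geqslant 1}$ be a sequence of pairs of integers with $n_j\geqslant k_j\geqslant 3$ for all $j$, $n_j\to\infty$ and $k_j/n_j\to 0$ as $j\to\infty$. For each $j$ let $c_j,r_j$ be the integers with $n_j=c_jk_j+r_j$ and $r_j\in\{0,\ldots,k_j-1\}$. Suppose that either (a) for every $j$, $n_j$ is even and $r_j\notin\{1,k_j-1\}$; or (b) $k_j-r_j\to\infty$ as $j\to\infty$. Then ${\rm SP}(n_j,k_j)/{\rm MMS}(n_j,k_j)\to 1$ as $j\to\infty$.
   Context: For integers $n\geqslant k\geqslant 1$, an $(n,k)$-Sperner partition system is a collection of partitions of some $n$-element set, each into exactly $k$ nonempty classes, such that no class of any partition in the collection is a subset of a class of any other partition in the collection. ${\rm SP}(n,k)$ denotes the maximum number of partitions in an $(n,k)$-Sperner partition system. For $n\geqslant k$, $c$ and $r$ denote the unique integers with $n=ck+r$ and $r\in\{0,\ldots,k-1\}$, and ${\rm MMS}(n,k)=\binom{n}{c}\big/\big(k-r+\frac{r(c+1)}{n-c}\big)$. -}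

module Defs where

open import Data.Nat as ℕ using (ℕ; zero; suc; _≤_)
open import Data.Nat.DivMod using (_/_; _%_)
open import Data.Nat.Combinatorics using (_C_)
open import Data.Integer using (+_)
open import Data.Rational as ℚ using (ℚ; 0ℚ; 1ℚ; Positive; ∣_∣; _÷_; _<_; ≢-nonZero)
open import Data.Rational.Properties using () renaming (_≟_ to _≟ℚ_)
open import Data.Fin using (Fin)
open import Data.Product using (Σ; ∃; _×_)
open import Relation.Binary.PropositionalEquality using (_≡_; _≢_)
open import Relation.Nullary using (¬_; yes; no)

⟦_⟧ : ℕ → ℚ
⟦ m ⟧ = ℚ._/_ (+ m) 1

-- total division on ℚ (x ÷' 0 = 0); only ever used with nonzero divisors here
_÷'_ : ℚ → ℚ → ℚ
p ÷' q with q ≟ℚ 0ℚ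
... | yes _ = 0ℚ
... | no q≢0 = _÷_ p q {{≢-nonZero q≢0}}

infixl 7 _÷'_

-- Partitions of the n-element set Fin n into exactly k nonempty classes.
-- A partition is given by a labelling f : Fin n → Fin k of the elements by
-- class indices; the classes are the fibres f⁻¹(a), required nonempty
-- (f surjective).

Surj : {n k : ℕ} → (Fin n → Fin k) → Set
Surj {n} {k} f = (a : Fin k) → ∃ λ (x : Fin n) → f x ≡ a

ClassSubset : {n k : ℕ} → (Fin n → Fin k) → Fin k → (Fin n → Fin k) → Fin k → Set
ClassSubset {n} f a g b = (x : Fin n) → f x ≡ a → g x ≡ b

-- An (n,k)-Sperner partition system with m members: m partitions
-- P : Fin m → (Fin n → Fin k) such that no class of P i is a subset of
-- a class of P j for i ≠ j.  (This forces the m partitions to be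
-- pairwise distinct as partitions, i.e. up to relabelling of classes.)
IsSpernerSystem : (n k m : ℕ) → (Fin m → Fin n → Fin k) → Set
IsSpernerSystem n k m P =
  ((i : Fin m) → Surj (P i)) ×
  ((i j : Fin m) → i ≢ j → (a b : Fin k) → ¬ ClassSubset (P i) a (P j) b)

IsSP : ℕ → ℕ → ℕ → Set
IsSP n k s =
  (Σ (Fin s → Fin n → Fin k) λ P → IsSpernerSystem n k s P) ×
  ((m : ℕ) (P : Fin m → Fin n → Fin k) → IsSpernerSystem n k m P → m ≤ s)

-- n = c k + r with 0 ≤ r < k  (for k ≥ 1; the value at k = 0 is an
-- irrelevant convention, never used since k ≥ 3 in the theorem)
quot : (n k : ℕ) → ℕ
quot n zero = 0
quot n (suc k) = n / suc k

rem : (n k : ℕ) → ℕ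
rem n zero = 0
rem n (suc k) = n % suc k

MMS : (n k : ℕ) → ℚ
MMS n k =
  ⟦ n C c ⟧ ÷' (⟦ k ℕ.∸ r ⟧ ℚ.+ ⟦ r ℕ.* (c ℕ.+ 1) ⟧ ÷' ⟦ n ℕ.∸ c ⟧)
  where
  c = quot n k
  r = rem n k

TendsToInfty : (ℕ → ℕ) → Set
TendsToInfty a = (M : ℕ) → ∃ λ J → (j : ℕ) → J ≤ j → M ≤ a j

TendsTo : (ℕ → ℚ) → ℚ → Set
TendsTo x L = (ε : ℚ) → Positive ε → ∃ λ J → (j : ℕ) → J ≤ j → ∣ x j ℚ.- L ∣ < ε

{-# OPTIONS --safe #-}

-- Upper bound: the classes of a Sperner partition system form an antichain, so the LYM inequality
-- applies; as x ↦ 1 / C(n,x) is convex, each partition has at least the LYM weight of k - r classes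
-- of size c and r of size c + 1.
--
-- Lower bound: split an even ground set into two halves, and let the type of a set record how many
-- points it has in each half. By a Baranyai-type theorem (insert the points one at a time, rounding a
-- fractional assignment each time) a Sperner system exists as soon as the classes can be given pairwise
-- equal or incomparable types such that the types of each partition add up to the two halves and no
-- type is used more often than there are sets of that type. For one of the sizes c, c + 1 take the
-- types near the middle and for the other the types away from it. Because shadows of such families
-- are nearly as dense as the families, only types of vanishing density are lost. An even
-- number of classes is balanced by pairing (x, s - x) with (s - x, x); an odd number of middle classes
-- needs in addition one triple, for which the unimodal weights are cut into uniform layers.

module Submission where

open import Defs
open import Data.Nat.Properties
open import Algebra.Properties.CommutativeSemigroup *-commutativeSemigroup using (x∙yz≈y∙xz)
open import Algebra.Properties.Semiring.Sum +-*-semiring using (sum; sum-syntax; sum-cong-≗; ∑-distrib-+; ∑-comm; sum-replicate-zero; *-distribˡ-sum; *-distribʳ-sum; sum-remove)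
open import Data.Bool using (Bool; true; false; not; _∧_)
open import Data.Bool.Properties using () renaming (_≟_ to _≟ᵇ_)
open import Data.Empty using (⊥)
open import Data.Fin as Fin using (Fin; zero; suc; toℕ; fromℕ<; splitAt; join; _↑ˡ_; _↑ʳ_; combine; remQuot; punchIn)
import Data.Fin.Properties as Finₚ
open import Data.Fin.Properties using () renaming (_≟_ to _≟ᶠ_)
import Data.Integer as ℤ
import Data.Integer.Properties as ℤₚ
open import Data.List using (List; []; _∷_; length; _++_; replicate; tabulate)
open import Data.List.Properties using (length-++; length-replicate; length-tabulate)
open import Data.List.Relation.Unary.All as All using (All; []; _∷_)
open import Data.List.Relation.Unary.All.Properties using (++⁺; replicate⁺; tabulate⁺)
open import Data.Nat using (ℕ; zero; suc; _≤_; _<_; z≤n; s≤s; NonZero; >-nonZero; _∸_; _+_; _*_; _^_; _!; _≤?_; _<?_; ∣_-_∣)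
open import Data.Nat.Combinatorics using (_C_; nCk+nC[k+1]≡[n+1]C[k+1]; nCk≡n!/k![n-k]!; k![n∸k]!∣n!; k>n⇒nCk≡0)
import Data.Nat.Coprimality as Coprimality
open import Data.Nat.Divisibility using (_∣_; divides)
open import Data.Nat.DivMod using (_/_; m/n*n≡m; m/n*n≤m; m*n/n≡m; /-monoˡ-≤; m≡m%n+[m/n]*n; m%n<n)
open import Data.Nat.Tactic.RingSolver using (solve-∀)
open import Data.Product using (∃; ∃₂; _×_; _,_; proj₁; proj₂)
open import Data.Rational as ℚ using (ℚ; mkℚ; 0ℚ; 1ℚ; ≢-nonZero)
import Data.Rational.Properties as ℚₚ
open import Data.Rational.Solver using (module +-*-Solver)
import Data.Rational.Unnormalised as ℚᵘ
import Data.Rational.Unnormalised.Properties as ℚᵘₚ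
open import Data.Sum using (_⊎_; inj₁; inj₂; [_,_]′)
open import Function using (_∘_; id; case_of_)
open import Relation.Binary.PropositionalEquality
open import Relation.Nullary using (Dec; yes; no; does; ¬_; contradiction)
open import Relation.Nullary.Decidable using (_×-dec_; dec-true)

-- The condition k/n → 0 enters through c → ∞: a single type holds only a share of order 1/√c of all
-- sets of its size, so cutting a level at whole types loses a vanishing fraction, and the losses
-- from floors, polynomial in c, are dwarfed by C(n, c). The construction balances the classes of
-- each size among themselves. For r = 1 or r = k - 1 a lone class would have to be split exactly in
-- half every time, and such sets have vanishing share; this is the reason for the excluded
-- remainders. For even n = ck + r, parity shows that r and k - r are not both odd and that a size
-- occurring an odd number of times is even, so that its triple can be centred. When k - r is large,
-- deleting a point of the ground set while lowering r by one hardly changes MMS; at most two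
-- deletions lead to r = 0, where Baranyai's theorem is exact, or to the even case. Limits are
-- handled by integer inequalities: a system is near-optimal of accuracy q if it has at least q / (q
-- + 1) times MMS members.

linear : ∀ l r t {L R} → l ≤ r → L + r + t ≡ R + l → L ≤ R
linear l r t {L} {R} l≤r eq =
  +-cancelʳ-≤ l L R (≤-trans (+-monoʳ-≤ L l≤r) (≤-trans (m≤m+n (L + r) t) (≤-reflexive eq)))

-- Indicators and finite sums

𝟙 : {P : Set} → Dec P → ℕ
𝟙 (yes _) = 1
𝟙 (no _) = 0

𝟙-yes : {P : Set} (d : Dec P) → P → 𝟙 d ≡ 1
𝟙-yes (yes _) p = refl
𝟙-yes (no ¬p) p = contradiction p ¬p

𝟙-no : {P : Set} (d : Dec P) → ¬ P → 𝟙 d ≡ 0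
𝟙-no (yes p) ¬p = contradiction p ¬p
𝟙-no (no _) ¬p = refl

𝟙≤1 : {P : Set} (d : Dec P) → 𝟙 d ≤ 1
𝟙≤1 (yes _) = ≤-refl
𝟙≤1 (no _) = z≤n

𝟙-mono : {P Q : Set} (d : Dec P) (e : Dec Q) → (P → Q) → 𝟙 d ≤ 𝟙 e
𝟙-mono (yes p) e f = ≤-reflexive (sym (𝟙-yes e (f p)))
𝟙-mono (no _) e f = z≤n

𝟙-cong : {P Q : Set} (d : Dec P) (e : Dec Q) → (P → Q) → (Q → P) → 𝟙 d ≡ 𝟙 e
𝟙-cong d e f g = ≤-antisym (𝟙-mono d e f) (𝟙-mono e d g)

𝟙-pos : {P : Set} (d : Dec P) → 0 < 𝟙 d → P
𝟙-pos (yes p) _ = p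

sum-mono : ∀ {n} {f g : Fin n → ℕ} → (∀ i → f i ≤ g i) → sum f ≤ sum g
sum-mono {zero} h = z≤n
sum-mono {suc n} h = +-mono-≤ (h zero) (sum-mono (h ∘ suc))

sum-mono-< : ∀ {n} {f g : Fin n → ℕ} → (∀ i → f i ≤ g i) → ∀ i → f i < g i → sum f < sum g
sum-mono-< {suc n} h zero lt = +-mono-<-≤ lt (sum-mono (h ∘ suc))
sum-mono-< {suc n} h (suc i) lt = +-mono-≤-< (h zero) (sum-mono-< (h ∘ suc) i lt)

sum-const : ∀ n c → sum {n} (λ _ → c) ≡ n * c
sum-const zero c = refl
sum-const (suc n) c = cong (c +_) (sum-const n c)

sum-zero : ∀ {n} {f : Fin n → ℕ} → (∀ i → f i ≡ 0) → sum f ≡ 0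
sum-zero {n} h = trans (sum-cong-≗ h) (sum-replicate-zero n)

term≤sum : ∀ {n} (f : Fin n → ℕ) i → f i ≤ sum f
term≤sum f zero = m≤m+n _ _
term≤sum f (suc i) = ≤-trans (term≤sum (f ∘ suc) i) (m≤n+m _ _)

sum-pos : ∀ {n} (f : Fin n → ℕ) → 0 < sum f → ∃ λ i → 0 < f i
sum-pos {suc n} f h with f zero in eq
... | suc m = zero , subst (0 <_) (sym eq) (s≤s z≤n)
... | zero with sum-pos (f ∘ suc) h
... | i , p = suc i , p

sum-squeeze : ∀ {n} {f g : Fin n → ℕ} → (∀ i → f i ≤ g i) → sum g ≤ sum f → ∀ i → f i ≡ g i
sum-squeeze {f = f} {g} h le i with f i <? g i
... | yes lt = contradiction le (<⇒≱ (sum-mono-< h i lt))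
... | no ≮ = ≤-antisym (h i) (≮⇒≥ ≮)

sum-select : ∀ {n} (a : Fin n) (f : Fin n → ℕ) → sum (λ i → 𝟙 (a ≟ᶠ i) * f i) ≡ f a
sum-select {suc n} zero f =
  trans (cong₂ _+_ (+-identityʳ (f zero)) (sum-zero {n} λ i → refl)) (+-identityʳ (f zero))
sum-select {suc n} (suc a) f =
  trans (sum-cong-≗ λ i → cong (_* f (suc i)) (𝟙-cong (suc a ≟ᶠ suc i) (a ≟ᶠ i) Finₚ.suc-injective (cong suc)))
        (sum-select a (f ∘ suc))

sum-one : ∀ {n} (a : Fin n) → sum (λ i → 𝟙 (a ≟ᶠ i)) ≡ 1
sum-one a = trans (sum-cong-≗ λ i → sym (*-identityʳ (𝟙 (a ≟ᶠ i)))) (sum-select a (λ _ → 1))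

sum-+ : ∀ m {n} (f : Fin (m + n) → ℕ) → sum f ≡ sum (f ∘ (_↑ˡ n)) + sum (f ∘ (m ↑ʳ_))
sum-+ zero f = refl
sum-+ (suc m) f = trans (cong (f zero +_) (sum-+ m (f ∘ suc))) (sym (+-assoc (f zero) _ _))

-- Integral rounding of a fractional bipartite assignment

does⇒ : {P : Set} (d : Dec P) → does d ≡ true → P
does⇒ (yes p) _ = p

χ : Bool → ℕ
χ true = 1
χ false = 0

-- The distance from `g` to the interval from `lo` to `hi`: for `lo ≤ hi` at most one of the
-- truncated differences is nonzero.
defect : ℕ → ℕ → ℕ → ℕ
defect lo hi g = (g ∸ hi) + (lo ∸ g)

defect-down : ∀ {lo hi g} → lo ≤ g → defect lo hi g ≤ defect lo hi (suc g)
defect-down {lo} {hi} {g} lo≤g =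
  +-mono-≤ (∸-monoˡ-≤ hi (n≤1+n g)) (≤-reflexive (trans (m≤n⇒m∸n≡0 lo≤g) (sym (m≤n⇒m∸n≡0 (m≤n⇒m≤1+n lo≤g)))))

defect-down-< : ∀ {lo hi g} → lo ≤ g → hi ≤ g → defect lo hi g < defect lo hi (suc g)
defect-down-< {lo} {hi} {g} lo≤g hi≤g =
  +-mono-<-≤ (∸-monoˡ-< (n<1+n g) hi≤g) (≤-reflexive (trans (m≤n⇒m∸n≡0 lo≤g) (sym (m≤n⇒m∸n≡0 (m≤n⇒m≤1+n lo≤g)))))

defect-up : ∀ {lo hi g} → suc g ≤ hi → defect lo hi (suc g) ≤ defect lo hi g
defect-up {lo} {hi} {g} g<hi =
  +-mono-≤ (≤-reflexive (trans (m≤n⇒m∸n≡0 g<hi) (sym (m≤n⇒m∸n≡0 (<⇒≤ g<hi))))) (∸-monoʳ-≤ lo (n≤1+n g))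

defect-up-< : ∀ {lo hi g} → suc g ≤ hi → suc g ≤ lo → defect lo hi (suc g) < defect lo hi g
defect-up-< {lo} {hi} {g} g<hi g<lo =
  +-mono-≤-< (≤-reflexive (trans (m≤n⇒m∸n≡0 g<hi) (sym (m≤n⇒m∸n≡0 (<⇒≤ g<hi))))) (∸-monoʳ-< (n<1+n g) g<lo)

load : ∀ {p V} → (Fin p → Fin V) → Fin V → ℕ
load σ v = sum (λ j → 𝟙 (σ j ≟ᶠ v))

update : ∀ {p V} → (Fin p → Fin V) → Fin p → Fin V → Fin p → Fin V
update σ j v i with j ≟ᶠ i
... | yes _ = v
... | no _ = σ i

load-update : ∀ {p V} (σ : Fin p → Fin V) j v u →
  load (update σ j v) u + 𝟙 (σ j ≟ᶠ u) ≡ load σ u + 𝟙 (v ≟ᶠ u)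
load-update σ j v u = begin
  load (update σ j v) u + 𝟙 (σ j ≟ᶠ u)
    ≡⟨ cong (load (update σ j v) u +_) (sum-select j (λ i → 𝟙 (σ i ≟ᶠ u))) ⟨
  load (update σ j v) u + sum (λ i → 𝟙 (j ≟ᶠ i) * 𝟙 (σ i ≟ᶠ u))
    ≡⟨ ∑-distrib-+ (λ i → 𝟙 (update σ j v i ≟ᶠ u)) (λ i → 𝟙 (j ≟ᶠ i) * 𝟙 (σ i ≟ᶠ u)) ⟨
  sum (λ i → 𝟙 (update σ j v i ≟ᶠ u) + 𝟙 (j ≟ᶠ i) * 𝟙 (σ i ≟ᶠ u))
    ≡⟨ sum-cong-≗ pointwise ⟩
  sum (λ i → 𝟙 (σ i ≟ᶠ u) + 𝟙 (j ≟ᶠ i) * 𝟙 (v ≟ᶠ u))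
    ≡⟨ ∑-distrib-+ (λ i → 𝟙 (σ i ≟ᶠ u)) (λ i → 𝟙 (j ≟ᶠ i) * 𝟙 (v ≟ᶠ u)) ⟩
  load σ u + sum (λ i → 𝟙 (j ≟ᶠ i) * 𝟙 (v ≟ᶠ u))
    ≡⟨ cong (load σ u +_) (sum-select j (λ _ → 𝟙 (v ≟ᶠ u))) ⟩
  load σ u + 𝟙 (v ≟ᶠ u) ∎
  where
  open ≡-Reasoning
  pointwise : ∀ i → 𝟙 (update σ j v i ≟ᶠ u) + 𝟙 (j ≟ᶠ i) * 𝟙 (σ i ≟ᶠ u)
                  ≡ 𝟙 (σ i ≟ᶠ u) + 𝟙 (j ≟ᶠ i) * 𝟙 (v ≟ᶠ u)
  pointwise i with j ≟ᶠ i
  ... | no _ = refl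
  ... | yes _ = trans (cong (𝟙 (v ≟ᶠ u) +_) (+-identityʳ _))
                      (trans (+-comm (𝟙 (v ≟ᶠ u)) _) (cong (𝟙 (σ i ≟ᶠ u) +_) (sym (+-identityʳ _))))

module _ {p V : ℕ} (w : Fin p → Fin V → ℕ) (L : ℕ) (rows : ∀ j → sum (w j) ≡ L) where

  column : Fin V → ℕ
  column v = sum (λ j → w j v)

  Supported : (Fin p → Fin V) → Set
  Supported σ = ∀ j → 0 < w j (σ j)

  -- The result of moving one unit along a path from a source to v; the path only
  -- visits cells of R and enters v last, so colours sitting at v have not moved.
  record Moved (σ : Fin p → Fin V) (A R : Fin V → Bool) (v : Fin V) : Set where
    field
      source : Fin V
      source∈A : A source ≡ true
      moved : Fin p → Fin V
      supported : Supported moved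
      balance : ∀ u → load moved u + 𝟙 (source ≟ᶠ u) ≡ load σ u + 𝟙 (v ≟ᶠ u)
      agree : ∀ j → σ j ≡ v ⊎ R (σ j) ≡ false → moved j ≡ σ j

  -- A row assigned to a cell of such an `R` has its whole weight inside `R`.
  Closed : (Fin p → Fin V) → (Fin V → Bool) → Set
  Closed σ R = ∀ j v → R (σ j) ≡ true → 0 < w j v → R v ≡ true

  insert : (Fin V → Bool) → Fin V → Fin V → Bool
  insert R v u with v ≟ᶠ u
  ... | yes _ = true
  ... | no _ = R u

  insert-⊇ : ∀ R v u → R u ≡ true → insert R v u ≡ true
  insert-⊇ R v u Ru with v ≟ᶠ u
  ... | yes _ = refl
  ... | no _ = Ru

  insert-false : ∀ R v u → insert R v u ≡ false → R u ≡ false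
  insert-false R v u h with v ≟ᶠ u
  ... | no _ = h

  insert-self : ∀ R v → insert R v v ≡ true
  insert-self R v with v ≟ᶠ v
  ... | yes _ = refl
  ... | no v≢v = contradiction refl v≢v

  true≢false : {b : Bool} → b ≡ true → b ≡ false → ⊥
  true≢false refl ()

  -- Augmenting-path search: while some row `j` at a reached cell `σ j` may use an unreached cell
  -- `v`, the chain of moves that ends at `σ j` is prolonged by moving `j` to `v`. `fuel` bounds the
  -- number of unreached cells.
  closure : ∀ σ A fuel R → sum (λ v → 1 ∸ χ (R v)) ≤ fuel → (∀ v → A v ≡ true → R v ≡ true) →
            (∀ v → R v ≡ true → Moved σ A R v) →
            ∃ λ R → (∀ v → A v ≡ true → R v ≡ true) × Closed σ R × (∀ v → R v ≡ true → Moved σ A R v)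
  closure σ A fuel R small A⊆R reach
    with Finₚ.any? (λ j → Finₚ.any? (λ v → (R (σ j) ≟ᵇ true) ×-dec (0 <? w j v) ×-dec (R v ≟ᵇ false)))
  ... | no none = R , A⊆R , closed , reach
    where
    closed : Closed σ R
    closed j v Rσj pos with R v in Rv
    ... | true = refl
    ... | false = contradiction (j , v , Rσj , pos , Rv) none
  ... | yes (j , v , Rσj , pos , Rv) = continue fuel small
    where
    R′ = insert R v
    fewer : sum (λ u → 1 ∸ χ (R′ u)) < sum (λ u → 1 ∸ χ (R u))
    fewer = sum-mono-< le v (subst₂ (λ b c → 1 ∸ χ b < 1 ∸ χ c) (sym (insert-self R v)) (sym Rv) (s≤s z≤n))
      where
      le : ∀ u → 1 ∸ χ (R′ u) ≤ 1 ∸ χ (R u)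
      le u with v ≟ᶠ u
      ... | yes _ = z≤n
      ... | no _ = ≤-refl
    module M = Moved (reach (σ j) Rσj)
    step : Moved σ A R′ v
    step = record
      { source = M.source
      ; source∈A = M.source∈A
      ; moved = update M.moved j v
      ; supported = supported′
      ; balance = balance′
      ; agree = agree′ }
      where
      supported′ : Supported (update M.moved j v)
      supported′ i with j ≟ᶠ i
      ... | yes refl = pos
      ... | no _ = M.supported i
      balance′ : ∀ u → load (update M.moved j v) u + 𝟙 (M.source ≟ᶠ u) ≡ load σ u + 𝟙 (v ≟ᶠ u)
      -- The intermediate cell `σ j` cancels: the earlier chain added a unit there and row `j`,
      -- which `agree` keeps at `σ j`, takes one away.
      balance′ u = +-cancelʳ-≡ (𝟙 (σ j ≟ᶠ u)) _ _ (begin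
        load (update M.moved j v) u + 𝟙 (M.source ≟ᶠ u) + 𝟙 (σ j ≟ᶠ u)
          ≡⟨ swap (load (update M.moved j v) u) (𝟙 (M.source ≟ᶠ u)) (𝟙 (σ j ≟ᶠ u)) ⟩
        load (update M.moved j v) u + 𝟙 (σ j ≟ᶠ u) + 𝟙 (M.source ≟ᶠ u)
          ≡⟨ cong (λ z → load (update M.moved j v) u + 𝟙 (z ≟ᶠ u) + 𝟙 (M.source ≟ᶠ u)) (M.agree j (inj₁ refl)) ⟨
        load (update M.moved j v) u + 𝟙 (M.moved j ≟ᶠ u) + 𝟙 (M.source ≟ᶠ u)
          ≡⟨ cong (_+ 𝟙 (M.source ≟ᶠ u)) (load-update M.moved j v u) ⟩
        load M.moved u + 𝟙 (v ≟ᶠ u) + 𝟙 (M.source ≟ᶠ u)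
          ≡⟨ swap (load M.moved u) (𝟙 (v ≟ᶠ u)) (𝟙 (M.source ≟ᶠ u)) ⟩
        load M.moved u + 𝟙 (M.source ≟ᶠ u) + 𝟙 (v ≟ᶠ u)
          ≡⟨ cong (_+ 𝟙 (v ≟ᶠ u)) (M.balance u) ⟩
        load σ u + 𝟙 (σ j ≟ᶠ u) + 𝟙 (v ≟ᶠ u)
          ≡⟨ swap (load σ u) (𝟙 (σ j ≟ᶠ u)) (𝟙 (v ≟ᶠ u)) ⟩
        load σ u + 𝟙 (v ≟ᶠ u) + 𝟙 (σ j ≟ᶠ u) ∎)
        where
        open ≡-Reasoning
        swap : ∀ x y z → x + y + z ≡ x + z + y
        swap = solve-∀
      agree′ : ∀ i → σ i ≡ v ⊎ R′ (σ i) ≡ false → update M.moved j v i ≡ σ i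
      agree′ i h with outside h
        where
        outside : σ i ≡ v ⊎ R′ (σ i) ≡ false → R (σ i) ≡ false
        outside (inj₁ σi≡v) = trans (cong R σi≡v) Rv
        outside (inj₂ R′σi) = insert-false R v (σ i) R′σi
      -- Row `j` starts inside `R`, so a row that starts outside is neither `j` nor, by `agree`,
      -- moved by the earlier chain.
      ... | Rσi with j ≟ᶠ i
      ... | yes refl = contradiction Rσi (true≢false Rσj)
      ... | no _ = M.agree i (inj₂ Rσi)
    reach′ : ∀ u → R′ u ≡ true → Moved σ A R′ u
    reach′ u R′u with v ≟ᶠ u
    ... | yes refl = step
    ... | no v≢u = record
      { source = U.source ; source∈A = U.source∈A ; moved = U.moved ; supported = U.supported ; balance = U.balance
      ; agree = λ { i (inj₁ h) → U.agree i (inj₁ h) ; i (inj₂ h) → U.agree i (inj₂ (insert-false R v (σ i) h)) } }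
      where module U = Moved (reach u R′u)
    continue : ∀ fuel → sum (λ u → 1 ∸ χ (R u)) ≤ fuel → _
    continue zero small = contradiction (<-≤-trans fewer small) λ ()
    continue (suc fuel) small =
      closure σ A fuel R′ (≤-pred (<-≤-trans fewer small)) (λ u Au → insert-⊇ R v u (A⊆R u Au)) reach′

  closureOf : ∀ σ → Supported σ → ∀ A →
    ∃ λ R → (∀ v → A v ≡ true → R v ≡ true) × Closed σ R × (∀ v → R v ≡ true → Moved σ A R v)
  closureOf σ supp A = closure σ A _ A ≤-refl (λ _ h → h) λ v Av → record
    { source = v ; source∈A = Av ; moved = σ ; supported = supp ; balance = λ u → refl ; agree = λ _ _ → refl }

  -- Each row assigned to a closed set puts all of its weight `L` there; the other rows can only
  -- increase the right-hand side.
  closed-load : ∀ σ R → Closed σ R → ∑[ v < V ] (χ (R v) * (L * load σ v)) ≤ ∑[ v < V ] (χ (R v) * column v)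
  closed-load σ R closed = begin
    ∑[ v < V ] (χ (R v) * (L * load σ v)) ≡⟨ sum-cong-≗ (λ (v : Fin V) → move (χ (R v)) L _) ⟩
    ∑[ v < V ] (load σ v * (χ (R v) * L)) ≡⟨ sum-cong-≗ (λ (v : Fin V) → *-distribʳ-sum (χ (R v) * L) (λ (j : Fin p) → 𝟙 (σ j ≟ᶠ v))) ⟩
    ∑[ v < V ] ∑[ j < p ] (𝟙 (σ j ≟ᶠ v) * (χ (R v) * L)) ≡⟨ ∑-comm (λ (v : Fin V) (j : Fin p) → 𝟙 (σ j ≟ᶠ v) * (χ (R v) * L)) ⟩
    ∑[ j < p ] ∑[ v < V ] (𝟙 (σ j ≟ᶠ v) * (χ (R v) * L)) ≡⟨ sum-cong-≗ (λ (j : Fin p) → sum-select (σ j) (λ v → χ (R v) * L)) ⟩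
    ∑[ j < p ] (χ (R (σ j)) * L) ≤⟨ sum-mono row ⟩
    ∑[ j < p ] ∑[ v < V ] (χ (R v) * w j v) ≡⟨ ∑-comm (λ (j : Fin p) (v : Fin V) → χ (R v) * w j v) ⟩
    ∑[ v < V ] ∑[ j < p ] (χ (R v) * w j v) ≡⟨ sum-cong-≗ (λ (v : Fin V) → *-distribˡ-sum (χ (R v)) (λ j → w j v)) ⟨
    ∑[ v < V ] (χ (R v) * column v) ∎
    where
    open ≤-Reasoning
    move : ∀ x y z → x * (y * z) ≡ z * (x * y)
    move = solve-∀
    row : ∀ j → χ (R (σ j)) * L ≤ ∑[ v < V ] (χ (R v) * w j v)
    row j with R (σ j) in Rσj
    ... | false = z≤n
    ... | true = ≤-reflexive (trans (+-identityʳ L) (trans (sym (rows j)) (sum-cong-≗ inside)))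
      where
      inside : ∀ v → w j v ≡ χ (R v) * w j v
      inside v with w j v in eq
      ... | zero = sym (*-zeroʳ (χ (R v)))
      ... | suc m rewrite closed j v Rσj (subst (0 <_) (sym eq) (s≤s z≤n)) = sym (+-identityʳ (suc m))

  total-load : ∀ σ → ∑[ v < V ] (L * load σ v) ≡ sum column
  total-load σ = begin
    ∑[ v < V ] (L * load σ v) ≡⟨ sum-cong-≗ (λ (v : Fin V) → *-distribˡ-sum L (λ (j : Fin p) → 𝟙 (σ j ≟ᶠ v))) ⟩
    ∑[ v < V ] ∑[ j < p ] (L * 𝟙 (σ j ≟ᶠ v)) ≡⟨ ∑-comm (λ (v : Fin V) (j : Fin p) → L * 𝟙 (σ j ≟ᶠ v)) ⟩
    ∑[ j < p ] ∑[ v < V ] (L * 𝟙 (σ j ≟ᶠ v)) ≡⟨ sum-cong-≗ (λ (j : Fin p) → *-distribˡ-sum L (λ (v : Fin V) → 𝟙 (σ j ≟ᶠ v))) ⟨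
    ∑[ j < p ] (L * ∑[ v < V ] (𝟙 (σ j ≟ᶠ v))) ≡⟨ sum-cong-≗ (λ (j : Fin p) → trans (cong (L *_) (sum-one (σ j))) (*-identityʳ L)) ⟩
    ∑[ j < p ] L ≡⟨ sum-cong-≗ rows ⟨
    ∑[ j < p ] (sum (w j)) ≡⟨ ∑-comm w ⟩
    sum column ∎
    where open ≡-Reasoning

  -- The fractional load of a cell is `column v / L`; a unit travels from a cell above it to a cell
  -- below it.
  record Shift (σ : Fin p → Fin V) (a b : Fin V) : Set where
    field
      above : column a < L * load σ a
      below : L * load σ b < column b
      shifted : Fin p → Fin V
      supported : Supported shifted
      balance : ∀ u → load shifted u + 𝟙 (a ≟ᶠ u) ≡ load σ u + 𝟙 (b ≟ᶠ u)

  -- If no cell reachable from `a` were below its fractional load, the reachable cells together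
  -- would exceed theirs, strictly because of `a`, against `closed-load`.
  shift-from : ∀ σ → Supported σ → ∀ a → column a < L * load σ a → ∃ λ b → Shift σ a b
  shift-from σ supp a above
    with closureOf σ supp (λ v → does (a ≟ᶠ v))
  ... | R , A⊆R , closed , reach
    with Finₚ.any? (λ b → (R b ≟ᵇ true) ×-dec (L * load σ b <? column b))
  ... | yes (b , Rb , below) = b , record
      { above = above ; below = below ; shifted = M.moved ; supported = M.supported
      ; balance = subst (λ z → ∀ u → load M.moved u + 𝟙 (z ≟ᶠ u) ≡ load σ u + 𝟙 (b ≟ᶠ u)) (sym (does⇒ (a ≟ᶠ M.source) M.source∈A)) M.balance }
    where
    module M = Moved (reach b Rb)
  ... | no none = contradiction (closed-load σ R closed) (<⇒≱ (sum-mono-< le a lt))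
    where
    le : ∀ v → χ (R v) * column v ≤ χ (R v) * (L * load σ v)
    le v with R v in Rv
    ... | false = z≤n
    ... | true = *-monoʳ-≤ 1 (≮⇒≥ λ below → none (v , Rv , below))
    Ra : R a ≡ true
    Ra = A⊆R a (dec-true (a ≟ᶠ a) refl)
    lt : χ (R a) * column a < χ (R a) * (L * load σ a)
    lt = subst (λ z → χ z * column a < χ z * (L * load σ a)) (sym Ra) (*-monoʳ-< 1 above)

  -- The search starts from all overloaded cells at once, so no path has to be reversed. If it
  -- missed `b`, the cells outside `R` would carry too little in total and hence the closed set `R`
  -- too much.
  shift-to : ∀ σ → Supported σ → ∀ b → L * load σ b < column b → ∃ λ a → Shift σ a b
  shift-to σ supp b below
    with closureOf σ supp (λ v → does (column v <? L * load σ v))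
  ... | R , A⊆R , closed , reach with R b in Rb
  ... | true = M.source , record
      { above = does⇒ (column M.source <? L * load σ M.source) M.source∈A ; below = below ; shifted = M.moved ; supported = M.supported ; balance = M.balance }
    where
    module M = Moved (reach b Rb)
  ... | false = contradiction (closed-load σ R closed) (<⇒≱ (+-cancelˡ-< (sum column) _ _ (begin-strict
      sum column + ∑[ v < V ] (χ (R v) * column v)
        ≡⟨ cong (_+ ∑[ v < V ] (χ (R v) * column v)) (total-load σ) ⟨
      ∑[ v < V ] (L * load σ v) + ∑[ v < V ] (χ (R v) * column v)
        ≡⟨ ∑-distrib-+ (λ v → L * load σ v) (λ v → χ (R v) * column v) ⟨
      ∑[ v < V ] (L * load σ v + χ (R v) * column v)
        <⟨ sum-mono-< le b lt ⟩
      ∑[ v < V ] (column v + χ (R v) * (L * load σ v))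
        ≡⟨ ∑-distrib-+ column (λ v → χ (R v) * (L * load σ v)) ⟩
      sum column + ∑[ v < V ] (χ (R v) * (L * load σ v)) ∎)))
    where
    open ≤-Reasoning
    le : ∀ v → L * load σ v + χ (R v) * column v ≤ column v + χ (R v) * (L * load σ v)
    le v with R v in Rv
    ... | true = ≤-reflexive (trans (+-comm (L * load σ v) (1 * column v)) (cong₂ _+_ (*-identityˡ (column v)) (sym (*-identityˡ (L * load σ v)))))
    ... | false with column v <? L * load σ v
    ... | yes above = contradiction Rv (true≢false (A⊆R v (dec-true (column v <? L * load σ v) above)))
    ... | no ≮ = +-monoˡ-≤ 0 (≮⇒≥ ≮)
    lt : L * load σ b + χ (R b) * column b < column b + χ (R b) * (L * load σ b)
    lt = subst (λ z → L * load σ b + χ z * column b < column b + χ z * (L * load σ b)) (sym Rb) (+-monoˡ-< 0 below)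

  module _ (L>0 : 0 < L) (lo hi : Fin V → ℕ) (lo-bound : ∀ v → L * lo v ≤ column v) (hi-bound : ∀ v → column v ≤ L * hi v) where

    total-defect : (Fin p → Fin V) → ℕ
    total-defect σ = ∑[ v < V ] (defect (lo v) (hi v) (load σ v))

    -- `a` lies strictly above its fractional load, so losing a unit cannot bring it below `lo a`;
    -- likewise `b` cannot rise above `hi b`. No cell gets worse, and the offending one improves.
    shift-defect : ∀ σ a b → (s : Shift σ a b) → hi a < load σ a ⊎ load σ b < lo b →
                   total-defect (Shift.shifted s) < total-defect σ
    shift-defect σ a b s bad = strict bad
      where
      open Shift s
      d : (Fin p → Fin V) → Fin V → ℕ
      d τ v = defect (lo v) (hi v) (load τ v)
      a≢b : a ≢ b
      a≢b refl = <-asym above below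
      load-a : suc (load shifted a) ≡ load σ a
      load-a = trans (+-comm 1 (load shifted a)) (trans (cong (load shifted a +_) (sym (𝟙-yes (a ≟ᶠ a) refl)))
        (trans (balance a) (trans (cong (load σ a +_) (𝟙-no (b ≟ᶠ a) (a≢b ∘ sym))) (+-identityʳ _))))
      load-b : load shifted b ≡ suc (load σ b)
      load-b = trans (sym (+-identityʳ _)) (trans (cong (load shifted b +_) (sym (𝟙-no (a ≟ᶠ b) a≢b)))
        (trans (balance b) (trans (cong (load σ b +_) (𝟙-yes (b ≟ᶠ b) refl)) (+-comm (load σ b) 1))))
      lo-a : lo a ≤ load shifted a
      lo-a = ≤-pred (subst (lo a <_) (sym load-a) (*-cancelˡ-< L _ _ (≤-<-trans (lo-bound a) above)))
      hi-b : suc (load σ b) ≤ hi b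
      hi-b = *-cancelˡ-< L _ _ (<-≤-trans below (hi-bound b))
      le : ∀ v → d shifted v ≤ d σ v
      le v with a ≟ᶠ v | b ≟ᶠ v | balance v
      ... | yes refl | _ | _ = subst (λ z → d shifted a ≤ defect (lo a) (hi a) z) load-a (defect-down {lo a} {hi a} lo-a)
      ... | no _ | yes refl | _ = subst (λ z → defect (lo b) (hi b) z ≤ d σ b) (sym load-b) (defect-up {lo b} {hi b} hi-b)
      ... | no _ | no _ | eq = ≤-reflexive (cong (defect (lo v) (hi v)) (+-cancelʳ-≡ 0 _ _ eq))
      strict : hi a < load σ a ⊎ load σ b < lo b → total-defect shifted < total-defect σ
      strict (inj₁ over) = sum-mono-< le a (subst (λ z → d shifted a < defect (lo a) (hi a) z) load-a
        (defect-down-< {lo a} {hi a} lo-a (≤-pred (subst (hi a <_) (sym load-a) over))))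
      strict (inj₂ under) = sum-mono-< le b (subst (λ z → defect (lo b) (hi b) z < d σ b) (sym load-b)
        (defect-up-< {lo b} {hi b} hi-b under))

    improve : ∀ fuel σ → Supported σ → total-defect σ ≤ fuel →
              ∃ λ σ → Supported σ × ∀ v → lo v ≤ load σ v × load σ v ≤ hi v
    improve fuel σ supp small with Finₚ.any? (λ v → hi v <? load σ v) | Finₚ.any? (λ v → load σ v <? lo v)
    ... | no no-over | no no-under = σ , supp , λ v → ≮⇒≥ (λ h → no-under (v , h)) , ≮⇒≥ (λ h → no-over (v , h))
    ... | yes (a , over) | _ = continue fuel small (shift-from σ supp a (≤-<-trans (hi-bound a) (*-monoʳ-< L {{>-nonZero L>0}} over)))
      where
      continue : ∀ fuel → total-defect σ ≤ fuel → ∃ (λ b → Shift σ a b) → _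
      continue zero small (b , s) = contradiction (<-≤-trans (shift-defect σ a b s (inj₁ over)) small) λ ()
      continue (suc fuel) small (b , s) =
        improve fuel (Shift.shifted s) (Shift.supported s) (≤-pred (<-≤-trans (shift-defect σ a b s (inj₁ over)) small))
    ... | no _ | yes (b , under) = continue fuel small (shift-to σ supp b (<-≤-trans (*-monoʳ-< L {{>-nonZero L>0}} under) (lo-bound b)))
      where
      continue : ∀ fuel → total-defect σ ≤ fuel → ∃ (λ a → Shift σ a b) → _
      continue zero small (a , s) = contradiction (<-≤-trans (shift-defect σ a b s (inj₂ under)) small) λ ()
      continue (suc fuel) small (a , s) =
        improve fuel (Shift.shifted s) (Shift.supported s) (≤-pred (<-≤-trans (shift-defect σ a b s (inj₂ under)) small))

    -- Any choice within the support serves as a start; every shift lowers the total defect, so the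
    -- process ends with all loads in range.
    rounding : ∃ λ (σ : Fin p → Fin V) → (∀ j → 0 < w j (σ j)) × ∀ v → lo v ≤ load σ v × load σ v ≤ hi v
    rounding = improve _ (λ j → proj₁ (start j)) (λ j → proj₂ (start j)) ≤-refl
      where
      start : ∀ j → ∃ λ v → 0 < w j v
      start j = sum-pos (w j) (subst (0 <_) (sym (rows j)) L>0)

-- Binomial identities

nC0≡1 : ∀ n → n C 0 ≡ 1
nC0≡1 n = *-cancelˡ-≡ _ _ 1 (C0 n)
  where
  C0 : ∀ n → 1 * (n C 0) ≡ 1 * 1
  C0 zero = refl
  C0 (suc n) = refl

pascal : ∀ n k → suc n C suc k ≡ n C k + n C suc k
pascal n k = sym (nCk+nC[k+1]≡[n+1]C[k+1] n k)

absorption : ∀ n k → suc k * (suc n C suc k) ≡ suc n * (n C k)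
absorption zero zero = refl
absorption zero (suc k) = *-zeroʳ k
absorption (suc n) zero = begin
  1 * (suc (suc n) C 1) ≡⟨ cong (1 *_) (pascal (suc n) 0) ⟩
  1 * (suc n C 0 + suc n C 1) ≡⟨ cong (λ z → 1 * (z + suc n C 1)) (nC0≡1 (suc n)) ⟩
  1 * (1 + suc n C 1) ≡⟨ *-distribˡ-+ 1 1 (suc n C 1) ⟩
  1 + 1 * (suc n C 1) ≡⟨ cong suc (absorption n zero) ⟩
  1 + suc n * (n C 0) ≡⟨ cong (λ z → 1 + suc n * z) (nC0≡1 n) ⟩
  1 + suc n * 1 ≡⟨ eq n ⟩
  suc (suc n) * 1 ≡⟨ cong (suc (suc n) *_) (nC0≡1 (suc n)) ⟨
  suc (suc n) * (suc n C 0) ∎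
  where
  open ≡-Reasoning
  eq : ∀ n → 1 + suc n * 1 ≡ suc (suc n) * 1
  eq = solve-∀
absorption (suc n) (suc k) = begin
  suc (suc k) * (suc (suc n) C suc (suc k))
    ≡⟨ cong (suc (suc k) *_) (pascal (suc n) (suc k)) ⟩
  suc (suc k) * (suc n C suc k + suc n C suc (suc k))
    ≡⟨ eq₁ k (suc n C suc k) (suc n C suc (suc k)) ⟩
  suc n C suc k + (suc k * (suc n C suc k) + suc (suc k) * (suc n C suc (suc k)))
    ≡⟨ cong₂ (λ x y → suc n C suc k + (x + y)) (absorption n k) (absorption n (suc k)) ⟩
  suc n C suc k + (suc n * (n C k) + suc n * (n C suc k))
    ≡⟨ cong (suc n C suc k +_) (trans (sym (*-distribˡ-+ (suc n) (n C k) _)) (cong (suc n *_) (sym (pascal n k)))) ⟩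
  suc (suc n) * (suc n C suc k) ∎
  where
  open ≡-Reasoning
  eq₁ : ∀ k x y → suc (suc k) * (x + y) ≡ x + (suc k * x + suc (suc k) * y)
  eq₁ = solve-∀

-- This is (n + 1 - k) C(n + 1, k) = (n + 1) C(n, k) without subtraction, hence valid for all `k`.
absorption-complement : ∀ n k → suc n * (suc n C k) ≡ k * (suc n C k) + suc n * (n C k)
absorption-complement n zero = cong (suc n *_) (trans (nC0≡1 (suc n)) (sym (nC0≡1 n)))
absorption-complement n (suc k) = begin
  suc n * (suc n C suc k) ≡⟨ cong (suc n *_) (pascal n k) ⟩
  suc n * (n C k + n C suc k) ≡⟨ *-distribˡ-+ (suc n) (n C k) _ ⟩
  suc n * (n C k) + suc n * (n C suc k) ≡⟨ cong (_+ suc n * (n C suc k)) (absorption n k) ⟨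
  suc k * (suc n C suc k) + suc n * (n C suc k) ∎
  where open ≡-Reasoning

-- A Baranyai-type theorem: distributing points over prescribed classes

tally : ∀ {p k V} → (Fin p → Fin k → Fin V) → Fin V → ℕ
tally ℓ v = sum (λ j → sum (λ a → 𝟙 (ℓ j a ≟ᶠ v)))

-- Class a of row j has label ℓ j a and must receive e (ℓ j a) of the N points.
-- The refined label records ℓ j a together with the set of points received, and
-- cap bounds how often each refined label may occur.
record Distribution {p k : ℕ} (N : ℕ) {V : ℕ} (e cap : Fin V → ℕ) (ℓ : Fin p → Fin k → Fin V) : Set where
  field
    part : Fin p → Fin N → Fin k
    size : ∀ j a → sum (λ x → 𝟙 (part j x ≟ᶠ a)) ≡ e (ℓ j a)
    V* : ℕ
    ℓ* : Fin p → Fin k → Fin V*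
    coarse : Fin V* → Fin V
    coarse-ℓ* : ∀ j a → coarse (ℓ* j a) ≡ ℓ j a
    tally-ℓ* : ∀ v → tally ℓ* v ≤ cap (coarse v)
    separate : ∀ j a j′ a′ → ℓ j a ≡ ℓ j′ a′ →
               (∀ x → 𝟙 (part j x ≟ᶠ a) ≡ 𝟙 (part j′ x ≟ᶠ a′)) → ℓ* j a ≡ ℓ* j′ a′

split-elim : ∀ {m n} (P : Fin (m + n) → Set) → (∀ i → P (i ↑ˡ n)) → (∀ i → P (m ↑ʳ i)) → ∀ i → P i
split-elim {m} {n} P l r i = subst P (Finₚ.join-splitAt m n i) (joined (splitAt m i))
  where
  joined : ∀ s → P (join m n s)
  joined (inj₁ i) = l i
  joined (inj₂ i) = r i

mark : ∀ {V} {P : Set} → Dec P → Fin V → Fin (V + V)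
mark {V} (yes _) v = v ↑ˡ V
mark {V} (no _) v = V ↑ʳ v

picked : ∀ {p k V} → (Fin p → Fin k → Fin V) → (Fin p → Fin k) → Fin V → ℕ
picked ℓ chosen v = sum (λ j → 𝟙 (ℓ j (chosen j) ≟ᶠ v))

-- Averaging: let the new point of a row enter a class with probability `e / (N + 1)`. By the two
-- absorption identities the expected number of classes labelled `v` that receive it is at most
-- `cap v * (N C (e v ∸ 1))`, and of those that do not at most `cap v * (N C e v)`. `rounding`
-- preserves both bounds.
choose-classes : ∀ {p k} N {V} (e cap : Fin V → ℕ) (ℓ : Fin p → Fin k → Fin V) →
  (∀ j → sum (λ a → e (ℓ j a)) ≡ suc N) → (∀ v → tally ℓ v ≤ cap v * (suc N C e v)) →
  ∃ λ chosen → (∀ j → 0 < e (ℓ j (chosen j))) ×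
    ∀ v → picked ℓ chosen v ≤ cap v * (N C (e v ∸ 1)) × tally ℓ v ≤ cap v * (N C e v) + picked ℓ chosen v
choose-classes {p} {k} N {V} e cap ℓ rows tallies = chosen , e-chosen , λ v →
  ≤-trans (≤-reflexive (picked≡load v)) (proj₂ (bounds v)) ,
  ≤-trans (m≤n+m∸n (tally ℓ v) (cap v * (N C e v)))
    (+-monoʳ-≤ (cap v * (N C e v)) (≤-trans (proj₁ (bounds v)) (≤-reflexive (sym (picked≡load v)))))
  where
  L = suc N
  w : Fin p → Fin V → ℕ
  w j v = ∑[ a < k ] (𝟙 (ℓ j a ≟ᶠ v) * e v)
  w-rows : ∀ j → sum (w j) ≡ L
  w-rows j = trans (∑-comm (λ (v : Fin V) (a : Fin k) → 𝟙 (ℓ j a ≟ᶠ v) * e v))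
                   (trans (sum-cong-≗ (λ (a : Fin k) → sum-select (ℓ j a) e)) (rows j))
  w-column : ∀ v → ∑[ j < p ] (w j v) ≡ tally ℓ v * e v
  w-column v = sym (trans (*-distribʳ-sum (e v) (λ (j : Fin p) → ∑[ a < k ] (𝟙 (ℓ j a ≟ᶠ v))))
    (sum-cong-≗ λ (j : Fin p) → *-distribʳ-sum (e v) (λ (a : Fin k) → 𝟙 (ℓ j a ≟ᶠ v))))
  -- The bound on the classes passed over becomes, by truncated subtraction from the tally, a lower
  -- bound on the classes picked.
  hi lo : Fin V → ℕ
  hi v = cap v * (N C (e v ∸ 1))
  lo v = tally ℓ v ∸ cap v * (N C e v)
  open ≤-Reasoning
  hi-bound : ∀ v → ∑[ j < p ] (w j v) ≤ L * hi v
  hi-bound v = subst (_≤ L * hi v) (sym (w-column v)) (bound (tally ℓ v) (e v) (tallies v))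
    where
    bound : ∀ t d → t ≤ cap v * (L C d) → t * d ≤ L * (cap v * (N C (d ∸ 1)))
    -- A label that asks for no points has weight zero, so the value `0 ∸ 1 = 0` is harmless here.
    bound t zero _ = subst (_≤ L * (cap v * (N C 0))) (sym (*-zeroʳ t)) z≤n
    bound t (suc d) t≤ = begin
      t * suc d ≤⟨ *-monoˡ-≤ (suc d) t≤ ⟩
      cap v * (L C suc d) * suc d ≡⟨ eq (cap v) (L C suc d) (suc d) ⟩
      cap v * (suc d * (L C suc d)) ≡⟨ cong (cap v *_) (absorption N d) ⟩
      cap v * (L * (N C d)) ≡⟨ x∙yz≈y∙xz (cap v) L (N C d) ⟩
      L * (cap v * (N C d)) ∎
      where
      eq : ∀ x y z → x * y * z ≡ x * (z * y)
      eq = solve-∀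
  lo-bound : ∀ v → L * lo v ≤ ∑[ j < p ] (w j v)
  lo-bound v = subst (L * lo v ≤_) (sym (w-column v))
    (subst (_≤ tally ℓ v * e v) (sym (*-distribˡ-∸ L (tally ℓ v) (cap v * (N C e v)))) (m≤n+o⇒m∸n≤o (L * tally ℓ v) (L * (cap v * (N C e v))) (bound (tally ℓ v) (e v) (tallies v))))
    where
    bound : ∀ t d → t ≤ cap v * (L C d) → L * t ≤ L * (cap v * (N C d)) + t * d
    bound t d t≤ with d ≤? L
    ... | no d≰L = subst (λ z → L * z ≤ L * (cap v * (N C d)) + z * d) (sym t≡0) (≤-trans (≤-reflexive (*-zeroʳ L)) z≤n)
      where
      t≡0 : t ≡ 0
      t≡0 = n≤0⇒n≡0 (≤-trans t≤ (≤-reflexive (trans (cong (cap v *_) (k>n⇒nCk≡0 (≰⇒> d≰L))) (*-zeroʳ (cap v)))))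
    ... | yes d≤L = begin
      L * t ≡⟨ cong (_* t) (m∸n+n≡m d≤L) ⟨
      (L ∸ d + d) * t ≡⟨ *-distribʳ-+ t (L ∸ d) d ⟩
      (L ∸ d) * t + d * t ≤⟨ +-mono-≤ (*-monoʳ-≤ (L ∸ d) t≤) (≤-reflexive (*-comm d t)) ⟩
      (L ∸ d) * (cap v * (L C d)) + t * d ≡⟨ cong (_+ t * d) (x∙yz≈y∙xz (L ∸ d) (cap v) (L C d)) ⟩
      cap v * ((L ∸ d) * (L C d)) + t * d ≡⟨ cong (λ z → cap v * z + t * d) complement ⟩
      cap v * (L * (N C d)) + t * d ≡⟨ cong (_+ t * d) (x∙yz≈y∙xz (cap v) L (N C d)) ⟩
      L * (cap v * (N C d)) + t * d ∎
      where
      complement : (L ∸ d) * (L C d) ≡ L * (N C d)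
      complement = +-cancelˡ-≡ (d * (L C d)) _ _ (begin-equality
        d * (L C d) + (L ∸ d) * (L C d) ≡⟨ *-distribʳ-+ (L C d) d (L ∸ d) ⟨
        (d + (L ∸ d)) * (L C d) ≡⟨ cong (_* (L C d)) (m+[n∸m]≡n d≤L) ⟩
        L * (L C d) ≡⟨ absorption-complement N d ⟩
        d * (L C d) + L * (N C d) ∎)
  rounded = rounding w L w-rows (s≤s z≤n) lo hi lo-bound hi-bound
  σ = proj₁ rounded
  choice : ∀ j → ∃ λ a → 0 < 𝟙 (ℓ j a ≟ᶠ σ j) * e (σ j)
  choice j = sum-pos (λ (a : Fin k) → 𝟙 (ℓ j a ≟ᶠ σ j) * e (σ j)) (proj₁ (proj₂ rounded) j)
  chosen : Fin p → Fin k
  chosen j = proj₁ (choice j)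
  product-pos : ∀ x y → 0 < x * y → 0 < x × 0 < y
  product-pos (suc x) (suc y) _ = s≤s z≤n , s≤s z≤n
  product-pos (suc x) zero h = contradiction (subst (0 <_) (*-zeroʳ x) h) λ ()
  ℓ-chosen : ∀ j → ℓ j (chosen j) ≡ σ j
  ℓ-chosen j = 𝟙-pos (ℓ j (chosen j) ≟ᶠ σ j) (proj₁ (product-pos _ _ (proj₂ (choice j))))
  e-chosen : ∀ j → 0 < e (ℓ j (chosen j))
  e-chosen j = subst (λ v → 0 < e v) (sym (ℓ-chosen j))
    (proj₂ (product-pos (𝟙 (ℓ j (chosen j) ≟ᶠ σ j)) (e (σ j)) (proj₂ (choice j))))
  bounds = proj₂ (proj₂ rounded)
  picked≡load : ∀ v → picked ℓ chosen v ≡ load σ v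
  picked≡load v = sum-cong-≗ λ (j : Fin p) → cong (λ z → 𝟙 (z ≟ᶠ v)) (ℓ-chosen j)

module _ {p k : ℕ} (N : ℕ) {V : ℕ} (e cap : Fin V → ℕ) (ℓ : Fin p → Fin k → Fin V)
  (rows : ∀ j → sum (λ a → e (ℓ j a)) ≡ suc N) (chosen : Fin p → Fin k) (e-chosen : ∀ j → 0 < e (ℓ j (chosen j)))
  (counts : ∀ v → picked ℓ chosen v ≤ cap v * (N C (e v ∸ 1)) × tally ℓ v ≤ cap v * (N C e v) + picked ℓ chosen v)
  where

  open ≤-Reasoning

  marked-label : Fin p → Fin k → Fin (V + V)
  marked-label j a = mark (chosen j ≟ᶠ a) (ℓ j a)
  marked-demand : Fin (V + V) → ℕ
  marked-demand = [ (λ v → e v ∸ 1) , e ]′ ∘ splitAt V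
  unmark : Fin (V + V) → Fin V
  unmark = [ id , id ]′ ∘ splitAt V
  unmark-mark : ∀ {P : Set} (d : Dec P) v → unmark (mark d v) ≡ v
  unmark-mark (yes _) v = cong [ id , id ]′ (Finₚ.splitAt-↑ˡ V v V)
  unmark-mark (no _) v = cong [ id , id ]′ (Finₚ.splitAt-↑ʳ V V v)
  demand : ∀ j a → 𝟙 (chosen j ≟ᶠ a) + marked-demand (marked-label j a) ≡ e (ℓ j a)
  demand j a with chosen j ≟ᶠ a
  ... | yes refl = trans (cong (λ z → suc ([ (λ v → e v ∸ 1) , e ]′ z)) (Finₚ.splitAt-↑ˡ V (ℓ j a) V)) (m+[n∸m]≡n (e-chosen j))
  ... | no _ = cong [ (λ v → e v ∸ 1) , e ]′ (Finₚ.splitAt-↑ʳ V V (ℓ j a))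
  marked-rows : ∀ j → ∑[ a < k ] (marked-demand (marked-label j a)) ≡ N
  marked-rows j = suc-injective (begin-equality
    1 + ∑[ a < k ] (marked-demand (marked-label j a)) ≡⟨ cong (_+ ∑[ a < k ] (marked-demand (marked-label j a))) (sum-one (chosen j)) ⟨
    ∑[ a < k ] (𝟙 (chosen j ≟ᶠ a)) + ∑[ a < k ] (marked-demand (marked-label j a)) ≡⟨ ∑-distrib-+ (λ (a : Fin k) → 𝟙 (chosen j ≟ᶠ a)) (λ (a : Fin k) → marked-demand (marked-label j a)) ⟨
    ∑[ a < k ] (𝟙 (chosen j ≟ᶠ a) + marked-demand (marked-label j a)) ≡⟨ sum-cong-≗ (demand j) ⟩
    ∑[ a < k ] (e (ℓ j a)) ≡⟨ rows j ⟩
    suc N ∎)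
  selected : ∀ v → ∑[ j < p ] ∑[ a < k ] (𝟙 (chosen j ≟ᶠ a) * 𝟙 (ℓ j a ≟ᶠ v)) ≡ picked ℓ chosen v
  selected v = sum-cong-≗ λ (j : Fin p) → sum-select (chosen j) (λ (a : Fin k) → 𝟙 (ℓ j a ≟ᶠ v))
  tally-left : ∀ v → tally marked-label (v ↑ˡ V) ≡ picked ℓ chosen v
  tally-left v = trans (sum-cong-≗ λ (j : Fin p) → sum-cong-≗ λ (a : Fin k) → pointwise j a) (selected v)
    where
    pointwise : ∀ j a → 𝟙 (marked-label j a ≟ᶠ v ↑ˡ V) ≡ 𝟙 (chosen j ≟ᶠ a) * 𝟙 (ℓ j a ≟ᶠ v)
    pointwise j a with chosen j ≟ᶠ a
    ... | yes _ = trans (𝟙-cong (ℓ j a ↑ˡ V ≟ᶠ v ↑ˡ V) (ℓ j a ≟ᶠ v) (Finₚ.↑ˡ-injective V _ _) (cong (_↑ˡ V))) (sym (+-identityʳ _))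
    ... | no _ = 𝟙-no (V ↑ʳ ℓ j a ≟ᶠ v ↑ˡ V) λ eq → case trans (sym (Finₚ.splitAt-↑ʳ V V (ℓ j a))) (trans (cong (splitAt V) eq) (Finₚ.splitAt-↑ˡ V v V)) of λ ()
  tally-right : ∀ v → tally marked-label (V ↑ʳ v) + picked ℓ chosen v ≡ tally ℓ v
  tally-right v = begin-equality
    tally marked-label (V ↑ʳ v) + picked ℓ chosen v
      ≡⟨ cong (tally marked-label (V ↑ʳ v) +_) (selected v) ⟨
    tally marked-label (V ↑ʳ v) + ∑[ j < p ] ∑[ a < k ] (𝟙 (chosen j ≟ᶠ a) * 𝟙 (ℓ j a ≟ᶠ v))
      ≡⟨ ∑-distrib-+ (λ (j : Fin p) → ∑[ a < k ] (𝟙 (marked-label j a ≟ᶠ V ↑ʳ v))) (λ (j : Fin p) → ∑[ a < k ] (𝟙 (chosen j ≟ᶠ a) * 𝟙 (ℓ j a ≟ᶠ v))) ⟨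
    ∑[ j < p ] (∑[ a < k ] (𝟙 (marked-label j a ≟ᶠ V ↑ʳ v)) + ∑[ a < k ] (𝟙 (chosen j ≟ᶠ a) * 𝟙 (ℓ j a ≟ᶠ v)))
      ≡⟨ sum-cong-≗ (λ (j : Fin p) → trans (sym (∑-distrib-+ (λ (a : Fin k) → 𝟙 (marked-label j a ≟ᶠ V ↑ʳ v)) (λ (a : Fin k) → 𝟙 (chosen j ≟ᶠ a) * 𝟙 (ℓ j a ≟ᶠ v)))) (sum-cong-≗ (pointwise j))) ⟩
    tally ℓ v ∎
    where
    pointwise : ∀ j a → 𝟙 (marked-label j a ≟ᶠ V ↑ʳ v) + 𝟙 (chosen j ≟ᶠ a) * 𝟙 (ℓ j a ≟ᶠ v) ≡ 𝟙 (ℓ j a ≟ᶠ v)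
    pointwise j a with chosen j ≟ᶠ a
    ... | yes _ = trans (cong (_+ 1 * 𝟙 (ℓ j a ≟ᶠ v)) (𝟙-no (ℓ j a ↑ˡ V ≟ᶠ V ↑ʳ v) λ eq →
      case trans (sym (Finₚ.splitAt-↑ˡ V (ℓ j a) V)) (trans (cong (splitAt V) eq) (Finₚ.splitAt-↑ʳ V V v)) of λ ())) (+-identityʳ _)
    ... | no _ = trans (+-identityʳ _) (𝟙-cong (V ↑ʳ ℓ j a ≟ᶠ V ↑ʳ v) (ℓ j a ≟ᶠ v) (Finₚ.↑ʳ-injective V _ _) (cong (V ↑ʳ_)))
  marked-tally : ∀ v → tally marked-label v ≤ cap (unmark v) * (N C marked-demand v)
  marked-tally = split-elim _ left right
    where
    left : ∀ v → tally marked-label (v ↑ˡ V) ≤ cap (unmark (v ↑ˡ V)) * (N C marked-demand (v ↑ˡ V))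
    left v = subst (λ s → tally marked-label (v ↑ˡ V) ≤ cap ([ id , id ]′ s) * (N C [ (λ v → e v ∸ 1) , e ]′ s)) (sym (Finₚ.splitAt-↑ˡ V v V))
      (≤-trans (≤-reflexive (tally-left v)) (proj₁ (counts v)))
    right : ∀ v → tally marked-label (V ↑ʳ v) ≤ cap (unmark (V ↑ʳ v)) * (N C marked-demand (V ↑ʳ v))
    right v = subst (λ s → tally marked-label (V ↑ʳ v) ≤ cap ([ id , id ]′ s) * (N C [ (λ v → e v ∸ 1) , e ]′ s)) (sym (Finₚ.splitAt-↑ʳ V V v))
      (+-cancelʳ-≤ (picked ℓ chosen v) _ _ (≤-trans (≤-reflexive (tally-right v)) (proj₂ (counts v))))

  -- The picked copy of a label asks for one point fewer. Two classes with equal traces agree in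
  -- particular on the new point, so they carry the same mark and the separation of the smaller
  -- distribution applies.
  add-point : Distribution N marked-demand (cap ∘ unmark) marked-label → Distribution (suc N) e cap ℓ
  add-point D = record
    { part = part ; size = size ; V* = D.V* ; ℓ* = D.ℓ* ; coarse = unmark ∘ D.coarse
    ; coarse-ℓ* = λ j a → trans (cong unmark (D.coarse-ℓ* j a)) (unmark-mark (chosen j ≟ᶠ a) (ℓ j a))
    ; tally-ℓ* = D.tally-ℓ* ; separate = separate }
    where
    module D = Distribution D
    part : Fin p → Fin (suc N) → Fin k
    part j zero = chosen j
    part j (suc x) = D.part j x
    size : ∀ j a → sum (λ x → 𝟙 (part j x ≟ᶠ a)) ≡ e (ℓ j a)
    size j a = trans (cong (𝟙 (chosen j ≟ᶠ a) +_) (D.size j a)) (demand j a)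
    separate : ∀ j a j′ a′ → ℓ j a ≡ ℓ j′ a′ →
               (∀ x → 𝟙 (part j x ≟ᶠ a) ≡ 𝟙 (part j′ x ≟ᶠ a′)) → D.ℓ* j a ≡ D.ℓ* j′ a′
    separate j a j′ a′ eq same = D.separate j a j′ a′ (marks (chosen j ≟ᶠ a) (chosen j′ ≟ᶠ a′) (same zero)) (same ∘ suc)
      where
      marks : ∀ {P Q : Set} (d : Dec P) (d′ : Dec Q) → 𝟙 d ≡ 𝟙 d′ → mark d (ℓ j a) ≡ mark d′ (ℓ j′ a′)
      marks (yes _) (yes _) _ = cong (_↑ˡ V) eq
      marks (no _) (no _) _ = cong (V ↑ʳ_) eq

-- Induction on the points still to be placed. A label that needs `e` of `N` points can still split
-- into `N C e` sets, so `tally ≤ cap * (N C e)` is the room that is left; at `N = 0` it has become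
-- the required bound by `cap`.
distribute : ∀ {p k} N {V} (e cap : Fin V → ℕ) (ℓ : Fin p → Fin k → Fin V) →
  (∀ j → sum (λ a → e (ℓ j a)) ≡ N) → (∀ v → tally ℓ v ≤ cap v * (N C e v)) → Distribution N e cap ℓ
distribute zero {V} e cap ℓ rows tallies = record
  { part = λ j () ; size = λ j a → sym (n≤0⇒n≡0 (≤-trans (term≤sum (λ a → e (ℓ j a)) a) (≤-reflexive (rows j))))
  ; V* = V ; ℓ* = ℓ ; coarse = id ; coarse-ℓ* = λ j a → refl
  ; tally-ℓ* = λ v → ≤-trans (tallies v) (≤-trans (*-monoʳ-≤ (cap v) (0C≤1 (e v))) (≤-reflexive (*-identityʳ (cap v))))
  ; separate = λ j a j′ a′ eq _ → eq }
  where
  0C≤1 : ∀ k → 0 C k ≤ 1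
  0C≤1 zero = ≤-refl
  0C≤1 (suc k) = z≤n
distribute {p} {k} (suc N) {V} e cap ℓ rows tallies = extend (choose-classes N e cap ℓ rows tallies)
  where
  extend : (∃ λ chosen → (∀ j → 0 < e (ℓ j (chosen j))) ×
             ∀ v → picked ℓ chosen v ≤ cap v * (N C (e v ∸ 1)) × tally ℓ v ≤ cap v * (N C e v) + picked ℓ chosen v) →
           Distribution (suc N) e cap ℓ
  extend (chosen , e-chosen , counts) =
    add-point N e cap ℓ rows chosen e-chosen counts
      (distribute {p} {k} N {V + V} (marked-demand N e cap ℓ rows chosen e-chosen counts)
        (λ v → cap (unmark N e cap ℓ rows chosen e-chosen counts v)) (marked-label N e cap ℓ rows chosen e-chosen counts)
        (marked-rows N e cap ℓ rows chosen e-chosen counts) (marked-tally N e cap ℓ rows chosen e-chosen counts))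

two-rows : ∀ {p} (f : Fin p → ℕ) {i j} → i ≢ j → 1 ≤ f i → 1 ≤ f j → 2 ≤ sum f
two-rows f {i} {j} i≢j fi fj = begin
  1 + 1 ≡⟨ cong₂ _+_ (sum-one i) (sum-one j) ⟨
  sum (λ x → 𝟙 (i ≟ᶠ x)) + sum (λ x → 𝟙 (j ≟ᶠ x)) ≡⟨ ∑-distrib-+ (λ x → 𝟙 (i ≟ᶠ x)) (λ x → 𝟙 (j ≟ᶠ x)) ⟨
  sum (λ x → 𝟙 (i ≟ᶠ x) + 𝟙 (j ≟ᶠ x)) ≤⟨ sum-mono le ⟩
  sum f ∎
  where
  open ≤-Reasoning
  le : ∀ x → 𝟙 (i ≟ᶠ x) + 𝟙 (j ≟ᶠ x) ≤ f x
  le x with i ≟ᶠ x | j ≟ᶠ x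
  ... | yes refl | yes refl = contradiction refl i≢j
  ... | yes refl | no _ = fi
  ... | no _ | yes refl = fj
  ... | no _ | no _ = z≤n

module _ {p k N₁ N₂ V : ℕ} (e₁ e₂ cap : Fin V → ℕ) (ℓ : Fin p → Fin k → Fin V)
  (positive : ∀ j a → 0 < e₁ (ℓ j a) + e₂ (ℓ j a))
  (antichain : ∀ j a j′ a′ → e₁ (ℓ j a) ≤ e₁ (ℓ j′ a′) → e₂ (ℓ j a) ≤ e₂ (ℓ j′ a′) → ℓ j a ≡ ℓ j′ a′)
  (D₁ : Distribution N₁ e₁ cap ℓ)
  (D₂ : Distribution N₂ (e₂ ∘ Distribution.coarse D₁) (λ _ → 1) (Distribution.ℓ* D₁))
  where

  private
    module D₁ = Distribution D₁
    module D₂ = Distribution D₂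

  glue : Fin p → Fin (N₁ + N₂) → Fin k
  glue j x = [ D₁.part j , D₂.part j ]′ (splitAt N₁ x)

  glue-left : ∀ j x → glue j (x ↑ˡ N₂) ≡ D₁.part j x
  glue-left j x = cong [ D₁.part j , D₂.part j ]′ (Finₚ.splitAt-↑ˡ N₁ x N₂)

  glue-right : ∀ j x → glue j (N₁ ↑ʳ x) ≡ D₂.part j x
  glue-right j x = cong [ D₁.part j , D₂.part j ]′ (Finₚ.splitAt-↑ʳ N₁ N₂ x)

  size₂ : ∀ j a → sum (λ x → 𝟙 (D₂.part j x ≟ᶠ a)) ≡ e₂ (ℓ j a)
  size₂ j a = trans (D₂.size j a) (cong e₂ (D₁.coarse-ℓ* j a))

  glue-surj : ∀ j → Surj (glue j)
  glue-surj j a with sum-pos (λ x → 𝟙 (glue j x ≟ᶠ a)) (subst (0 <_) (sym total) (positive j a))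
    where
    total : sum (λ x → 𝟙 (glue j x ≟ᶠ a)) ≡ e₁ (ℓ j a) + e₂ (ℓ j a)
    total = trans (sum-+ N₁ (λ x → 𝟙 (glue j x ≟ᶠ a))) (cong₂ _+_
      (trans (sum-cong-≗ λ x → cong (λ z → 𝟙 (z ≟ᶠ a)) (glue-left j x)) (D₁.size j a))
      (trans (sum-cong-≗ λ x → cong (λ z → 𝟙 (z ≟ᶠ a)) (glue-right j x)) (size₂ j a)))
  ... | x , pos = x , 𝟙-pos (glue j x ≟ᶠ a) pos

  -- An inclusion of classes makes their types comparable, hence equal by `antichain`. Equal sizes
  -- turn the inclusion into equality, so one fully refined label occurs in two rows, although its
  -- tally is at most 1.
  glue-sperner : IsSpernerSystem (N₁ + N₂) k p glue
  glue-sperner = glue-surj , λ j j′ j≢j′ a b a⊆b → impossible j j′ j≢j′ a b a⊆b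
    where
    impossible : ∀ j j′ → j ≢ j′ → ∀ a b → ¬ ClassSubset (glue j) a (glue j′) b
    impossible j j′ j≢j′ a b a⊆b = contradiction (≤-trans both (D₂.tally-ℓ* (D₂.ℓ* j a))) λ { (s≤s ()) }
      where
      left : ∀ x → 𝟙 (D₁.part j x ≟ᶠ a) ≤ 𝟙 (D₁.part j′ x ≟ᶠ b)
      left x = 𝟙-mono (D₁.part j x ≟ᶠ a) (D₁.part j′ x ≟ᶠ b) λ eq →
        trans (sym (glue-left j′ x)) (a⊆b (x ↑ˡ N₂) (trans (glue-left j x) eq))
      right : ∀ x → 𝟙 (D₂.part j x ≟ᶠ a) ≤ 𝟙 (D₂.part j′ x ≟ᶠ b)
      right x = 𝟙-mono (D₂.part j x ≟ᶠ a) (D₂.part j′ x ≟ᶠ b) λ eq →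
        trans (sym (glue-right j′ x)) (a⊆b (N₁ ↑ʳ x) (trans (glue-right j x) eq))
      same : ℓ j a ≡ ℓ j′ b
      same = antichain j a j′ b (subst₂ _≤_ (D₁.size j a) (D₁.size j′ b) (sum-mono left))
                                (subst₂ _≤_ (size₂ j a) (size₂ j′ b) (sum-mono right))
      same₁ : D₁.ℓ* j a ≡ D₁.ℓ* j′ b
      same₁ = D₁.separate j a j′ b same (sum-squeeze left
        (≤-reflexive (trans (D₁.size j′ b) (trans (cong e₁ (sym same)) (sym (D₁.size j a))))))
      same₂ : D₂.ℓ* j a ≡ D₂.ℓ* j′ b
      same₂ = D₂.separate j a j′ b same₁ (sum-squeeze right
        (≤-reflexive (trans (size₂ j′ b) (trans (cong e₂ (sym same)) (sym (size₂ j a))))))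
      hit : ∀ i c → D₂.ℓ* j a ≡ D₂.ℓ* i c → 1 ≤ sum (λ c → 𝟙 (D₂.ℓ* i c ≟ᶠ D₂.ℓ* j a))
      hit i c eq = ≤-trans (≤-reflexive (sym (𝟙-yes (D₂.ℓ* i c ≟ᶠ D₂.ℓ* j a) (sym eq))))
                           (term≤sum (λ c → 𝟙 (D₂.ℓ* i c ≟ᶠ D₂.ℓ* j a)) c)
      both : 2 ≤ tally D₂.ℓ* (D₂.ℓ* j a)
      both = two-rows (λ i → sum (λ c → 𝟙 (D₂.ℓ* i c ≟ᶠ D₂.ℓ* j a))) j≢j′ (hit j a refl) (hit j′ b same₂)

System : ℕ → ℕ → ℕ → Set
System n k p = ∃ λ (P : Fin p → Fin n → Fin k) → IsSpernerSystem n k p P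

-- The first half is distributed with cap `N₂ C e₂`: classes that agree there are no more numerous
-- than the sets available in the second half. Their refined labels are then distributed over the
-- second half with cap 1.
sperner-from-types : ∀ {p k} N₁ N₂ (T₁ T₂ : Fin p → Fin k → ℕ) →
  (∀ j → sum (T₁ j) ≡ N₁) → (∀ j → sum (T₂ j) ≡ N₂) →
  (∀ x y → sum (λ j → sum (λ a → 𝟙 (T₁ j a ≟ x) * 𝟙 (T₂ j a ≟ y))) ≤ (N₁ C x) * (N₂ C y)) →
  (∀ j a → 0 < T₁ j a + T₂ j a) →
  (∀ j a j′ a′ → T₁ j a ≤ T₁ j′ a′ → T₂ j a ≤ T₂ j′ a′ → T₁ j a ≡ T₁ j′ a′ × T₂ j a ≡ T₂ j′ a′) →
  System (N₁ + N₂) k p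
sperner-from-types {p} {k} N₁ N₂ T₁ T₂ rows₁ rows₂ counts positive antichain =
  build (distribute N₁ e₁ (λ v → N₂ C e₂ v) ℓ (λ j → trans (sum-cong-≗ (e₁-ℓ j)) (rows₁ j)) tallies)
  where
  V = suc N₁ * suc N₂
  e₁ e₂ : Fin V → ℕ
  e₁ v = toℕ (proj₁ (remQuot {suc N₁} (suc N₂) v))
  e₂ v = toℕ (proj₂ (remQuot {suc N₁} (suc N₂) v))
  small₁ : ∀ j a → T₁ j a < suc N₁
  small₁ j a = s≤s (subst (T₁ j a ≤_) (rows₁ j) (term≤sum (T₁ j) a))
  small₂ : ∀ j a → T₂ j a < suc N₂
  small₂ j a = s≤s (subst (T₂ j a ≤_) (rows₂ j) (term≤sum (T₂ j) a))
  ℓ : Fin p → Fin k → Fin V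
  ℓ j a = combine (fromℕ< (small₁ j a)) (fromℕ< (small₂ j a))
  e₁-ℓ : ∀ j a → e₁ (ℓ j a) ≡ T₁ j a
  e₁-ℓ j a = trans (cong (toℕ ∘ proj₁) (Finₚ.remQuot-combine (fromℕ< (small₁ j a)) (fromℕ< (small₂ j a)))) (Finₚ.toℕ-fromℕ< (small₁ j a))
  e₂-ℓ : ∀ j a → e₂ (ℓ j a) ≡ T₂ j a
  e₂-ℓ j a = trans (cong (toℕ ∘ proj₂) (Finₚ.remQuot-combine (fromℕ< (small₁ j a)) (fromℕ< (small₂ j a)))) (Finₚ.toℕ-fromℕ< (small₂ j a))
  tallies : ∀ v → tally ℓ v ≤ (N₂ C e₂ v) * (N₁ C e₁ v)
  tallies v = begin
    tally ℓ v ≤⟨ sum-mono (λ j → sum-mono (le j)) ⟩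
    sum (λ j → sum (λ a → 𝟙 (T₁ j a ≟ e₁ v) * 𝟙 (T₂ j a ≟ e₂ v))) ≤⟨ counts (e₁ v) (e₂ v) ⟩
    (N₁ C e₁ v) * (N₂ C e₂ v) ≡⟨ *-comm (N₁ C e₁ v) _ ⟩
    (N₂ C e₂ v) * (N₁ C e₁ v) ∎
    where
    open ≤-Reasoning
    le : ∀ j a → 𝟙 (ℓ j a ≟ᶠ v) ≤ 𝟙 (T₁ j a ≟ e₁ v) * 𝟙 (T₂ j a ≟ e₂ v)
    le j a with ℓ j a ≟ᶠ v
    ... | no _ = z≤n
    ... | yes eq = ≤-reflexive (sym (cong₂ _*_ (𝟙-yes (T₁ j a ≟ e₁ v) (trans (sym (e₁-ℓ j a)) (cong e₁ eq)))
                                               (𝟙-yes (T₂ j a ≟ e₂ v) (trans (sym (e₂-ℓ j a)) (cong e₂ eq)))))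
  build : Distribution N₁ e₁ (λ v → N₂ C e₂ v) ℓ → System (N₁ + N₂) k p
  build D₁ = _ , glue-sperner e₁ e₂ (λ v → N₂ C e₂ v) ℓ positive′ antichain′ D₁ D₂
    where
    module D₁ = Distribution D₁
    D₂ : Distribution N₂ (e₂ ∘ D₁.coarse) (λ _ → 1) D₁.ℓ*
    D₂ = distribute N₂ (e₂ ∘ D₁.coarse) (λ _ → 1) D₁.ℓ*
      (λ j → trans (sum-cong-≗ λ a → trans (cong e₂ (D₁.coarse-ℓ* j a)) (e₂-ℓ j a)) (rows₂ j))
      (λ v → ≤-trans (D₁.tally-ℓ* v) (≤-reflexive (sym (*-identityˡ _))))
    positive′ : ∀ j a → 0 < e₁ (ℓ j a) + e₂ (ℓ j a)
    positive′ j a = subst (0 <_) (sym (cong₂ _+_ (e₁-ℓ j a) (e₂-ℓ j a))) (positive j a)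
    antichain′ : ∀ j a j′ a′ → e₁ (ℓ j a) ≤ e₁ (ℓ j′ a′) → e₂ (ℓ j a) ≤ e₂ (ℓ j′ a′) → ℓ j a ≡ ℓ j′ a′
    antichain′ j a j′ a′ le₁ le₂ with antichain j a j′ a′ (subst₂ _≤_ (e₁-ℓ j a) (e₁-ℓ j′ a′) le₁) (subst₂ _≤_ (e₂-ℓ j a) (e₂-ℓ j′ a′) le₂)
    ... | eq₁ , eq₂ = cong₂ combine (Finₚ.fromℕ<-cong _ _ eq₁ (small₁ j a) (small₁ j′ a′)) (Finₚ.fromℕ<-cong _ _ eq₂ (small₂ j a) (small₂ j′ a′))

-- The LYM inequality and the upper bound

size cosize : ∀ {n} → (Fin n → Bool) → ℕ
size A = sum (λ x → χ (A x))
cosize A = sum (λ x → χ (not (A x)))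

-- Each summand counts the maximal chains through a member. The induction sorts the chains by the
-- point `x` added last; `mask` drops the members containing `x` without reindexing the family. A
-- full member contains all others and is therefore alone.
lym : ∀ n {m} (mask : Fin m → Bool) (A : Fin m → Fin n → Bool) →
  (∀ i i′ → mask i ≡ true → mask i′ ≡ true → (∀ x → A i x ≡ true → A i′ x ≡ true) → i ≡ i′) →
  sum (λ i → χ (mask i) * (size (A i) ! * cosize (A i) !)) ≤ n !
lym n {m} mask A antichain with Finₚ.any? (λ i → (mask i ≟ᵇ true) ×-dec (Finₚ.all? (λ x → A i x ≟ᵇ true)))
... | yes (i , mi , full) = begin
  sum (λ i′ → χ (mask i′) * (size (A i′) ! * cosize (A i′) !)) ≤⟨ sum-mono le ⟩
  sum (λ i′ → 𝟙 (i ≟ᶠ i′) * n !) ≡⟨ sum-select i (λ _ → n !) ⟩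
  n ! ∎
  where
  open ≤-Reasoning
  full-size : size (A i) ! * cosize (A i) ! ≡ n !
  full-size = trans (cong₂ (λ x y → x ! * y !)
      (trans (sum-cong-≗ λ x → cong χ (full x)) (trans (sum-const n 1) (*-identityʳ n)))
      (sum-zero λ x → cong (χ ∘ not) (full x)))
    (*-identityʳ (n !))
  le : ∀ i′ → χ (mask i′) * (size (A i′) ! * cosize (A i′) !) ≤ 𝟙 (i ≟ᶠ i′) * n !
  le i′ with mask i′ in mi′
  ... | false = z≤n
  ... | true with antichain i′ i mi′ mi (λ x _ → full x)
  ... | refl = ≤-reflexive (cong₂ _*_ (sym (𝟙-yes (i ≟ᶠ i) refl)) full-size)
lym zero {m} mask A antichain | no none = ≤-trans (≤-reflexive (sum-zero λ i → off i)) z≤n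
  where
  off : ∀ i → χ (mask i) * (1 * 1) ≡ 0
  off i with mask i in mi
  ... | false = refl
  ... | true = contradiction (i , mi , λ ()) none
lym (suc n) {m} mask A antichain | no none = begin
  ∑[ i < m ] (χ (mask i) * (size (A i) ! * cosize (A i) !))
    ≤⟨ sum-mono expand ⟩
  ∑[ i < m ] ∑[ x < (suc n) ] (χ (not (A i x)) * rest i)
    ≡⟨ ∑-comm (λ (i : Fin m) (x : Fin (suc n)) → χ (not (A i x)) * rest i) ⟩
  ∑[ x < (suc n) ] ∑[ i < m ] (χ (not (A i x)) * rest i)
    ≤⟨ sum-mono (λ x → ≤-trans (sum-mono (restrict x)) (lym n (mask′ x) (λ i → A i ∘ punchIn x) (antichain′ x))) ⟩
  ∑[ x < (suc n) ] (n !)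
    ≡⟨ sum-const (suc n) (n !) ⟩
  suc n * n ! ∎
  where
  open ≤-Reasoning
  rest : Fin m → ℕ
  rest i = χ (mask i) * (size (A i) ! * (cosize (A i) ∸ 1) !)
  expand : ∀ i → χ (mask i) * (size (A i) ! * cosize (A i) !) ≤ ∑[ x < (suc n) ] (χ (not (A i x)) * rest i)
  expand i with mask i in mi
  ... | false = z≤n
  ... | true with cosize (A i) in eq
  ... | zero = contradiction (i , mi , full) none
    where
    full : ∀ x → A i x ≡ true
    full x with A i x in Aix
    ... | true = refl
    ... | false = contradiction (≤-trans (≤-reflexive (sym (cong (χ ∘ not) Aix))) (≤-trans (term≤sum (λ y → χ (not (A i y))) x) (≤-reflexive eq))) λ ()
  ... | suc s = ≤-reflexive (trans (eq′ (size (A i) !) (suc s) (s !))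
                    (trans (cong (_* (1 * (size (A i) ! * s !))) (sym eq)) (*-distribʳ-sum (1 * (size (A i) ! * s !)) (λ x → χ (not (A i x))))))
    where
    eq′ : ∀ x y z → 1 * (x * (y * z)) ≡ y * (1 * (x * z))
    eq′ = solve-∀
  mask′ : Fin (suc n) → Fin m → Bool
  mask′ x i = mask i ∧ not (A i x)
  restrict : ∀ x i → χ (not (A i x)) * rest i ≤ χ (mask′ x i) * (size (A i ∘ punchIn x) ! * cosize (A i ∘ punchIn x) !)
  restrict x i with mask i | A i x in Aix
  ... | false | true = ≤-refl
  ... | false | false = ≤-refl
  ... | true | true = z≤n
  ... | true | false = ≤-reflexive (trans (*-identityˡ _) (cong₂ (λ y z → 1 * (y ! * z !))
      (trans (sum-remove {i = x} (χ ∘ A i)) (cong (λ b → χ b + size (A i ∘ punchIn x)) Aix))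
      (cong (_∸ 1) (trans (sum-remove {i = x} (χ ∘ not ∘ A i)) (cong (λ b → χ (not b) + cosize (A i ∘ punchIn x)) Aix)))))
  antichain′ : ∀ x i i′ → mask′ x i ≡ true → mask′ x i′ ≡ true →
               (∀ y → A i (punchIn x y) ≡ true → A i′ (punchIn x y) ≡ true) → i ≡ i′
  antichain′ x i i′ mi mi′ sub with mask i in eq | mask i′ in eq′ | A i x in Aix
  ... | true | true | false = antichain i i′ eq eq′ λ y Aiy → sub′ y Aiy
    where
    sub′ : ∀ y → A i y ≡ true → A i′ y ≡ true
    sub′ y Aiy with x ≟ᶠ y
    ... | yes refl = contradiction (trans (sym Aiy) Aix) λ ()
    ... | no x≢y = subst (λ z → A i′ z ≡ true) (Finₚ.punchIn-punchOut x≢y)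
        (sub (Fin.punchOut x≢y) (subst (λ z → A i z ≡ true) (sym (Finₚ.punchIn-punchOut x≢y)) Aiy))

sum-combine : ∀ p {k} (f : Fin (p * k) → ℕ) → sum f ≡ ∑[ j < p ] ∑[ a < k ] (f (combine j a))
sum-combine zero f = refl
sum-combine (suc p) {k} f = trans (sum-+ k f) (cong (sum (f ∘ (_↑ˡ (p * k))) +_) (sum-combine p (f ∘ (k ↑ʳ_))))

choose-factorial : ∀ a b → ((a + b) C a) * (a ! * b !) ≡ (a + b) !
choose-factorial a b = begin
  ((a + b) C a) * (a ! * b !) ≡⟨ cong (λ z → ((a + b) C a) * (a ! * z !)) (m+n∸m≡n a b) ⟨
  ((a + b) C a) * (a ! * (a + b ∸ a) !) ≡⟨ cong (_* (a ! * (a + b ∸ a) !)) (nCk≡n!/k![n-k]! (m≤m+n a b)) ⟩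
  ((a + b) ! / (a ! * (a + b ∸ a) !)) * (a ! * (a + b ∸ a) !) ≡⟨ m/n*n≡m (k![n∸k]!∣n! (m≤m+n a b)) ⟩
  (a + b) ! ∎
  where
  open ≡-Reasoning
  instance _ = a !* (a + b ∸ a) !≢0

2xy≤x²+y² : ∀ x y → 2 * (x * y) ≤ x * x + y * y
2xy≤x²+y² x y with ≤-total x y
... | inj₁ x≤y = subst (λ z → 2 * (x * z) ≤ x * x + z * z) (m+[n∸m]≡n x≤y) (≤-trans (m≤m+n _ ((y ∸ x) * (y ∸ x))) (≤-reflexive (eq x (y ∸ x))))
  where
  eq : ∀ x k → 2 * (x * (x + k)) + k * k ≡ x * x + (x + k) * (x + k)
  eq = solve-∀
... | inj₂ y≤x = subst (λ z → 2 * (z * y) ≤ z * z + y * y) (m+[n∸m]≡n y≤x) (≤-trans (m≤m+n _ ((x ∸ y) * (x ∸ y))) (≤-reflexive (eq y (x ∸ y))))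
  where
  eq : ∀ y k → 2 * ((y + k) * y) + k * k ≡ (y + k) * (y + k) + y * y
  eq = solve-∀

-- y ↦ y! (n - y)! is convex, hence lies above the chord through c and c + 1.
factorial-chord : ∀ c d t y′ → t + y′ ≡ suc d →
  c ! * suc d ! + t * (suc c ! * d !) ≤ (c + t) ! * y′ ! + t * (c ! * suc d !)
factorial-chord c d zero y′ refl = ≤-reflexive (cong (λ z → z ! * suc d ! + 0) (sym (+-identityʳ c)))
factorial-chord c zero (suc zero) zero _ =
  subst (λ z → c ! * 1 + 1 * (suc c ! * 1) ≤ z ! * 1 + 1 * (c ! * 1)) (+-comm 1 c) (≤-reflexive (eq (c !) (suc c !)))
  where
  eq : ∀ x y → x * 1 + 1 * (y * 1) ≡ y * 1 + 1 * (x * 1)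
  eq = solve-∀
factorial-chord c (suc d) (suc t) y′ eq = linear
  (c₁ + t * c₂ + t * (2 * c₁)) (y + t * c₁ + t * (c₀ + c₂)) 0
  (+-mono-≤ ih (*-monoʳ-≤ t convex)) (eq₁ c₀ c₁ c₂ y t)
  where
  c₀ = c ! * suc (suc d) !
  c₁ = suc c ! * suc d !
  c₂ = suc (suc c) ! * d !
  y = (c + suc t) ! * y′ !
  eq₁ : ∀ c₀ c₁ c₂ y t → c₀ + suc t * c₁ + (y + t * c₁ + t * (c₀ + c₂)) + 0 ≡ y + suc t * c₀ + (c₁ + t * c₂ + t * (2 * c₁))
  eq₁ = solve-∀
  ih : c₁ + t * c₂ ≤ y + t * c₁
  ih = subst (λ z → c₁ + t * c₂ ≤ z ! * y′ ! + t * c₁) (sym (+-suc c t)) (factorial-chord (suc c) d t y′ (suc-injective eq))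
  -- Divided by `c ! * d !` this is 2xy ≤ (x² + x) + (y² + y) for x = c + 1 and y = d + 1, so the
  -- slack in `linear` comes from x + y.
  convex : 2 * c₁ ≤ c₀ + c₂
  convex = linear (c ! * d ! * (2 * (suc c * suc d))) (c ! * d ! * (suc c * suc c + suc d * suc d)) (c ! * d ! * (suc c + suc d))
    (*-monoʳ-≤ (c ! * d !) (2xy≤x²+y² (suc c) (suc d))) (eq₂ (c !) (d !) c d)
    where
    eq₂ : ∀ u v c d → 2 * (suc c * u * (suc d * v)) + u * v * (suc c * suc c + suc d * suc d) + u * v * (suc c + suc d)
      ≡ u * (suc (suc d) * (suc d * v)) + suc (suc c) * (suc c * u) * v + u * v * (2 * (suc c * suc d))
    eq₂ = solve-∀

-- The line through the values at `c` and `c + 1`, arranged without subtraction so that its sum over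
-- a partition depends only on the number of classes and their total size. For `y ≤ c` the chord
-- inequality is applied to the complementary sizes.
factorial-supporting-line : ∀ c d y y′ → y + y′ ≡ suc (c + d) →
  suc c * (c ! * suc d !) + y * (suc c ! * d !) ≤ y ! * y′ ! + y * (c ! * suc d !) + c * (suc c ! * d !)
factorial-supporting-line c d y y′ eq with ≤-total c y
... | inj₁ c≤y = linear (F₀ + t * F₁) (y ! * y′ ! + t * F₀) 0 chord (trans (cong (λ z → suc c * F₀ + z * F₁ + (y ! * y′ ! + t * F₀) + 0) (sym (m+[n∸m]≡n c≤y))) (trans (eq₁ c t F₀ F₁ (y ! * y′ !)) (cong (λ z → y ! * y′ ! + z * F₀ + c * F₁ + (F₀ + t * F₁)) (m+[n∸m]≡n c≤y))))
  where
  F₀ = c ! * suc d !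
  F₁ = suc c ! * d !
  t = y ∸ c
  eq₁ : ∀ c t F₀ F₁ Y → suc c * F₀ + (c + t) * F₁ + (Y + t * F₀) + 0 ≡ Y + (c + t) * F₀ + c * F₁ + (F₀ + t * F₁)
  eq₁ = solve-∀
  chord : F₀ + t * F₁ ≤ y ! * y′ ! + t * F₀
  chord = subst (λ z → F₀ + t * F₁ ≤ z ! * y′ ! + t * F₀) (m+[n∸m]≡n c≤y) (factorial-chord c d t y′
    (+-cancelˡ-≡ c _ _ (trans (sym (+-assoc c t y′)) (trans (cong (_+ y′) (m+[n∸m]≡n c≤y)) (trans eq (sym (+-suc c d)))))))
... | inj₂ y≤c = linear (F₁ + suc t * F₀) (y ! * y′ ! + suc t * F₁) 0 chord (trans (cong (λ z → suc z * F₀ + y * F₁ + (y ! * y′ ! + suc t * F₁) + 0) (sym (m+[n∸m]≡n y≤c))) (trans (eq₁ y t F₀ F₁ (y ! * y′ !)) (cong (λ z → y ! * y′ ! + y * F₀ + z * F₁ + (F₁ + suc t * F₀)) (m+[n∸m]≡n y≤c))))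
  where
  F₀ = c ! * suc d !
  F₁ = suc c ! * d !
  t = c ∸ y
  eq₁ : ∀ y t F₀ F₁ Y → suc (y + t) * F₀ + y * F₁ + (Y + suc t * F₁) + 0 ≡ Y + y * F₀ + (y + t) * F₁ + (F₁ + suc t * F₀)
  eq₁ = solve-∀
  y′-eq : d + suc t ≡ y′
  y′-eq = +-cancelˡ-≡ y _ _ (trans (eq₂ y d t) (trans (cong (λ z → suc (z + d)) (m+[n∸m]≡n y≤c)) (sym eq)))
    where
    eq₂ : ∀ y d t → y + (d + suc t) ≡ suc (y + t + d)
    eq₂ = solve-∀
  chord : F₁ + suc t * F₀ ≤ y ! * y′ ! + suc t * F₁
  chord = subst₂ _≤_ (cong₂ (λ a b → a + suc t * b) (*-comm (d !) (suc c !)) (*-comm (suc d !) (c !)))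
    (cong₂ (λ a b → a + suc t * b) (trans (cong (λ z → z ! * y !) y′-eq) (*-comm (y′ !) (y !))) (*-comm (d !) (suc c !)))
    (factorial-chord d c (suc t) y (cong suc (m∸n+n≡m y≤c)))

-- Each partition uses at least `(k ∸ r) * F₀ + r * F₁` of the n! maximal chains counted by `lym`;
-- dividing by `c ! * d !` gives the bound.
sperner-upper : ∀ {k p} c r d (P : Fin p → Fin (suc (c + d)) → Fin k) → IsSpernerSystem (suc (c + d)) k p P →
  suc (c + d) ≡ c * k + r → r ≤ k → p * ((k ∸ r) * suc d + r * suc c) ≤ (suc (c + d) C c) * suc d
sperner-upper {k} {p} c r d P (surj , sperner) n≡ r≤k = *-cancelˡ-≤ (c ! * d !) {{c !* d !≢0}} (begin
  c ! * d ! * (p * ((k ∸ r) * suc d + r * suc c))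
    ≡⟨ eq₁ (c !) (d !) p (k ∸ r) d r c ⟩
  p * ((k ∸ r) * F₀ + r * F₁)
    ≡⟨ sum-const p _ ⟨
  ∑[ j < p ] ((k ∸ r) * F₀ + r * F₁)
    ≤⟨ sum-mono partition-weight ⟩
  ∑[ j < p ] ∑[ a < k ] (size (A j a) ! * cosize (A j a) !)
    ≡⟨ sum-cong-≗ (λ (j : Fin p) → sum-cong-≗ λ (a : Fin k) → cong (λ z → size (A (proj₁ z) (proj₂ z)) ! * cosize (A (proj₁ z) (proj₂ z)) !) (Finₚ.remQuot-combine j a)) ⟨
  ∑[ j < p ] ∑[ a < k ] (size (B (combine j a)) ! * cosize (B (combine j a)) !)
    ≡⟨ sum-combine p (λ i → size (B i) ! * cosize (B i) !) ⟨
  ∑[ i < (p * k) ] (size (B i) ! * cosize (B i) !)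
    ≡⟨ sum-cong-≗ (λ (i : Fin (p * k)) → *-identityˡ (size (B i) ! * cosize (B i) !)) ⟨
  ∑[ i < (p * k) ] (1 * (size (B i) ! * cosize (B i) !))
    ≤⟨ lym n (λ _ → true) B antichain ⟩
  n !
    ≡⟨ subst (λ z → (z C c) * F₀ ≡ z !) (+-suc c d) (choose-factorial c (suc d)) ⟨
  (n C c) * (c ! * suc d !)
    ≡⟨ eq₂ (n C c) (c !) d (d !) ⟩
  c ! * d ! * ((n C c) * suc d) ∎)
  where
  open ≤-Reasoning
  n = suc (c + d)
  F₀ = c ! * suc d !
  F₁ = suc c ! * d !
  A : Fin p → Fin k → Fin n → Bool
  A j a x = does (P j x ≟ᶠ a)
  B : Fin (p * k) → Fin n → Bool
  B i = A (proj₁ (remQuot {p} k i)) (proj₂ (remQuot {p} k i))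
  eq₁ : ∀ u v p m d r c → u * v * (p * (m * suc d + r * suc c)) ≡ p * (m * (u * (suc d * v)) + r * (suc c * u * v))
  eq₁ = solve-∀
  eq₂ : ∀ b u d v → b * (u * (suc d * v)) ≡ u * v * (b * suc d)
  eq₂ = solve-∀
  antichain : ∀ i i′ → true ≡ true → true ≡ true → (∀ x → B i x ≡ true → B i′ x ≡ true) → i ≡ i′
  antichain i i′ _ _ sub = trans (sym (Finₚ.combine-remQuot {p} k i)) (trans (cong (λ z → combine (proj₁ z) (proj₂ z)) (same (remQuot {p} k i) (remQuot {p} k i′)
      λ x eq → does⇒ (P (proj₁ (remQuot {p} k i′)) x ≟ᶠ proj₂ (remQuot {p} k i′)) (sub x (dec-true (P (proj₁ (remQuot {p} k i)) x ≟ᶠ proj₂ (remQuot {p} k i)) eq))))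
    (Finₚ.combine-remQuot {p} k i′))
    where
    same : ∀ (z z′ : Fin p × Fin k) → ClassSubset (P (proj₁ z)) (proj₂ z) (P (proj₁ z′)) (proj₂ z′) → z ≡ z′
    same (j , a) (j′ , a′) sub with j ≟ᶠ j′
    ... | no j≢j′ = contradiction sub (sperner j j′ j≢j′ a a′)
    -- Within one partition an inclusion forces equality, as the included class is nonempty and the
    -- classes are disjoint.
    ... | yes refl with surj j a
    ... | x , Px≡a = cong (j ,_) (trans (sym Px≡a) (sub x Px≡a))
  indicator : ∀ {Q : Set} (q : Dec Q) → χ (does q) ≡ 𝟙 q
  indicator (yes _) = refl
  indicator (no _) = refl
  complement : ∀ b → χ b + χ (not b) ≡ 1
  complement true = refl
  complement false = refl
  sizes : ∀ (A : Fin n → Bool) → size A + cosize A ≡ n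
  sizes A = trans (sym (∑-distrib-+ (χ ∘ A) (χ ∘ not ∘ A)))
    (trans (sum-cong-≗ {n} λ x → complement (A x)) (trans (sum-const n 1) (*-identityʳ n)))
  total : ∀ j → ∑[ a < k ] (size (A j a)) ≡ n
  total j = trans (∑-comm (λ (a : Fin k) (x : Fin n) → χ (A j a x)))
    (trans (sum-cong-≗ {n} λ x → trans (sum-cong-≗ λ a → indicator (P j x ≟ᶠ a)) (sum-one (P j x))) (trans (sum-const n 1) (*-identityʳ n)))
  partition-weight : ∀ j → (k ∸ r) * F₀ + r * F₁ ≤ ∑[ a < k ] (size (A j a) ! * cosize (A j a) !)
  partition-weight j = linear
    (k * (suc c * F₀) + n * F₁) (W + n * F₀ + k * (c * F₁)) 0 summed
    (trans (cong₂ (λ N K → (k ∸ r) * F₀ + r * F₁ + (W + N * F₀ + K * (c * F₁)) + 0) (trans n≡ (cong (λ z → c * z + r) (sym K≡))) (sym K≡))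
      (trans (eq₃ (k ∸ r) r c W F₀ F₁) (cong₂ (λ N K → W + (K * (suc c * F₀) + N * F₁)) (trans (cong (λ z → c * z + r) K≡) (sym n≡)) K≡)))
    where
    W = ∑[ a < k ] (size (A j a) ! * cosize (A j a) !)
    K≡ : (k ∸ r) + r ≡ k
    K≡ = m∸n+n≡m r≤k
    eq₃ : ∀ m r c W F₀ F₁ → m * F₀ + r * F₁ + (W + (c * (m + r) + r) * F₀ + (m + r) * (c * F₁)) + 0
        ≡ W + ((m + r) * (suc c * F₀) + (c * (m + r) + r) * F₁)
    eq₃ = solve-∀
    summed : k * (suc c * F₀) + n * F₁ ≤ W + n * F₀ + k * (c * F₁)
    summed = begin
      k * (suc c * F₀) + n * F₁
        ≡⟨ cong₂ (λ x y → x + y * F₁) (sum-const k (suc c * F₀)) (total j) ⟨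
      ∑[ a < k ] (suc c * F₀) + ∑[ a < k ] (size (A j a)) * F₁
        ≡⟨ cong (∑[ a < k ] (suc c * F₀) +_) (*-distribʳ-sum F₁ (λ (a : Fin k) → size (A j a))) ⟩
      ∑[ a < k ] (suc c * F₀) + ∑[ a < k ] (size (A j a) * F₁)
        ≡⟨ ∑-distrib-+ (λ (a : Fin k) → suc c * F₀) (λ (a : Fin k) → size (A j a) * F₁) ⟨
      ∑[ a < k ] (suc c * F₀ + size (A j a) * F₁)
        ≤⟨ sum-mono (λ a → factorial-supporting-line c d (size (A j a)) (cosize (A j a)) (sizes (A j a))) ⟩
      ∑[ a < k ] (size (A j a) ! * cosize (A j a) ! + size (A j a) * F₀ + c * F₁)
        ≡⟨ ∑-distrib-+ (λ (a : Fin k) → size (A j a) ! * cosize (A j a) ! + size (A j a) * F₀) (λ _ → c * F₁) ⟩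
      ∑[ a < k ] (size (A j a) ! * cosize (A j a) ! + size (A j a) * F₀) + ∑[ a < k ] (c * F₁)
        ≡⟨ cong₂ _+_ (∑-distrib-+ (λ (a : Fin k) → size (A j a) ! * cosize (A j a) !) (λ (a : Fin k) → size (A j a) * F₀)) (sum-const k (c * F₁)) ⟩
      W + ∑[ a < k ] (size (A j a) * F₀) + k * (c * F₁)
        ≡⟨ cong (λ z → W + z + k * (c * F₁)) (trans (sym (*-distribʳ-sum F₀ (λ (a : Fin k) → size (A j a)))) (cong (_* F₀) (total j))) ⟩
      W + n * F₀ + k * (c * F₁) ∎

-- Blocks: the intersection sizes with one half of the classes of a partition

prefix : (ℕ → ℕ) → ℕ → ℕ
prefix f zero = 0
prefix f (suc n) = prefix f n + f n

Block : ℕ → Set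
Block a = Fin a → ℕ

occ : ∀ {a} → ℕ → Block a → ℕ
occ i b = sum (λ α → 𝟙 (b α ≟ i))

cnt : ∀ {a} → ℕ → List (Block a) → ℕ
cnt i [] = 0
cnt i (b ∷ L) = occ i b + cnt i L

cnt-++ : ∀ {a} i (L L′ : List (Block a)) → cnt i (L ++ L′) ≡ cnt i L + cnt i L′
cnt-++ i [] L′ = refl
cnt-++ i (b ∷ L) L′ = trans (cong (occ i b +_) (cnt-++ i L L′)) (sym (+-assoc (occ i b) _ _))

cnt-replicate : ∀ {a} i q (b : Block a) → cnt i (replicate q b) ≡ q * occ i b
cnt-replicate i zero b = refl
cnt-replicate i (suc q) b = cong (occ i b +_) (cnt-replicate i q b)

cnt-tabulate : ∀ {a n} i (F : Fin n → Block a) → cnt i (tabulate F) ≡ sum (λ j → occ i (F j))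
cnt-tabulate {n = zero} i F = refl
cnt-tabulate {n = suc n} i F = cong (occ i (F zero) +_) (cnt-tabulate i (F ∘ suc))

repeat : ∀ {A : Set} → ℕ → List A → List A
repeat zero L = []
repeat (suc q) L = L ++ repeat q L

cnt-repeat : ∀ {a} i q (L : List (Block a)) → cnt i (repeat q L) ≡ q * cnt i L
cnt-repeat i zero L = refl
cnt-repeat i (suc q) L = trans (cnt-++ i L (repeat q L)) (cong (cnt i L +_) (cnt-repeat i q L))

length-repeat : ∀ {A : Set} q (L : List A) → length (repeat q L) ≡ q * length L
length-repeat zero L = refl
length-repeat (suc q) L = trans (length-++ L) (cong (length L +_) (length-repeat q L))

repeat⁺ : ∀ {A : Set} {Q : A → Set} q {L} → All Q L → All Q (repeat q L)
repeat⁺ zero h = []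
repeat⁺ (suc q) h = ++⁺ h (repeat⁺ q h)

take-blocks : ∀ {a} {Q : Block a → Set} p {L} → All Q L → p ≤ length L →
  ∃ λ (B : Fin p → Block a) → (∀ j → Q (B j)) × ∀ i → sum (λ j → occ i (B j)) ≤ cnt i L
take-blocks zero h le = (λ ()) , (λ ()) , λ i → z≤n
take-blocks {a} {Q} (suc p) {b ∷ L} (qb ∷ h) (s≤s le) with take-blocks p h le
... | B , QB , count = B′ , QB′ , λ i → +-monoʳ-≤ (occ i b) (count i)
  where
  B′ : Fin (suc p) → Block a
  B′ zero = b
  B′ (suc j) = B j
  QB′ : ∀ j → Q (B′ j)
  QB′ zero = qb
  QB′ (suc j) = QB j

<-quotient : ∀ m n .{{_ : NonZero n}} → m ≤ n * (m / n) + n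
<-quotient m n = ≤-trans (≤-reflexive (m≡m%n+[m/n]*n m n))
  (≤-trans (+-monoˡ-≤ _ (<⇒≤ (m%n<n m n))) (≤-reflexive (trans (+-comm n _) (cong (_+ n) (*-comm (m / n) n)))))

pairBlock : ∀ e → ℕ → ℕ → Block (e + e)
pairBlock e x y = [ (λ _ → x) , (λ _ → y) ]′ ∘ splitAt e

sum-pairBlock : ∀ e x y (g : ℕ → ℕ) → sum (λ α → g (pairBlock e x y α)) ≡ e * (g x + g y)
sum-pairBlock e x y g = trans (sum-+ e (λ α → g (pairBlock e x y α))) (trans (cong₂ _+_
    (trans (sum-cong-≗ {e} λ α → cong (g ∘ [ (λ _ → x) , (λ _ → y) ]′) (Finₚ.splitAt-↑ˡ e α e)) (sum-const e (g x)))
    (trans (sum-cong-≗ {e} λ α → cong (g ∘ [ (λ _ → x) , (λ _ → y) ]′) (Finₚ.splitAt-↑ʳ e e α)) (sum-const e (g y))))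
  (sym (*-distribˡ-+ e (g x) (g y))))

IsPair : ∀ e s lo hi → Block (e + e) → Set
IsPair e s lo hi b = ∃ λ x → lo ≤ x × x < hi × b ≡ pairBlock e x (s ∸ x)

module _ (e₀ s : ℕ) (f : ℕ → ℕ) (symmetric : ∀ x → x ≤ s → f (s ∸ x) ≡ f x) (lo : ℕ) where

  private
    e = suc e₀

  -- A pair block uses `x` and `s - x` exactly `e` times each, so the weight `f x` pays for
  -- `f x / e` copies.
  pairs : ℕ → List (Block (e + e))
  pairs zero = []
  pairs (suc m) = pairs m ++ replicate (f (lo + m) / e) (pairBlock e (lo + m) (s ∸ (lo + m)))

  pairs-All : ∀ m → All (IsPair e s lo (lo + m)) (pairs m)
  pairs-All zero = []
  pairs-All (suc m) = ++⁺ (weaken (pairs-All m)) (replicate⁺ _ (lo + m , m≤m+n lo m , +-monoʳ-< lo (n<1+n m) , refl))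
    where
    weaken : ∀ {L} → All (IsPair e s lo (lo + m)) L → All (IsPair e s lo (lo + suc m)) L
    weaken [] = []
    weaken ((x , a , b , c) ∷ h) = (x , a , <-trans b (+-monoʳ-< lo (n<1+n m)) , c) ∷ weaken h

  -- Each floor loses at most one block, hence at most `m` blocks are lost in all.
  pairs-length : ∀ m → prefix f (lo + m) ≤ prefix f lo + e * (length (pairs m) + m)
  pairs-length zero = ≤-trans (≤-reflexive (cong (prefix f) (+-identityʳ lo))) (m≤m+n _ _)
  pairs-length (suc m) = begin
    prefix f (lo + suc m) ≡⟨ cong (prefix f) (+-suc lo m) ⟩
    prefix f (lo + m) + f (lo + m) ≤⟨ +-mono-≤ (pairs-length m) (<-quotient (f (lo + m)) e) ⟩
    prefix f lo + e * (length (pairs m) + m) + (e * q + e) ≡⟨ eq (prefix f lo) e (length (pairs m)) m q ⟩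
    prefix f lo + e * (length (pairs m) + q + suc m) ≡⟨ cong (λ z → prefix f lo + e * (z + suc m)) len ⟨
    prefix f lo + e * (length (pairs (suc m)) + suc m) ∎
    where
    open ≤-Reasoning
    q = f (lo + m) / e
    eq : ∀ P e l m q → P + e * (l + m) + (e * q + e) ≡ P + e * (l + q + suc m)
    eq = solve-∀
    len : length (pairs (suc m)) ≡ length (pairs m) + q
    len = trans (length-++ (pairs m)) (cong (length (pairs m) +_) (length-replicate q))

  -- As `x + x < s`, the pairs of values `x`, `s - x` are disjoint for different `x`, so each value
  -- is charged by one pair only. The second component is the invariant which shows that the next
  -- pair is fresh.
  pairs-cnt : ∀ m → (∀ x → x < lo + m → x + x < s) → ∀ i →
    cnt i (pairs m) ≤ f i × (cnt i (pairs m) ≡ 0 ⊎ ∃ λ x → x < lo + m × (x ≡ i ⊎ s ∸ x ≡ i))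
  pairs-cnt zero half i = z≤n , inj₁ refl
  pairs-cnt (suc m) half i = subst (λ z → z ≤ f i × (z ≡ 0 ⊎ ∃ λ y → y < lo + suc m × (y ≡ i ⊎ s ∸ y ≡ i))) (sym total) cases
    where
    x = lo + m
    q = f x / e
    x< : x < lo + suc m
    x< = +-monoʳ-< lo (n<1+n m)
    2x<s : x + x < s
    2x<s = half x x<
    x≤s : x ≤ s
    x≤s = ≤-trans (m≤m+n x x) (<⇒≤ 2x<s)
    total : cnt i (pairs (suc m)) ≡ cnt i (pairs m) + q * (e * (𝟙 (x ≟ i) + 𝟙 (s ∸ x ≟ i)))
    total = trans (cnt-++ i (pairs m) _) (cong (cnt i (pairs m) +_)
      (trans (cnt-replicate i q _) (cong (q *_) (sum-pairBlock e x (s ∸ x) (λ y → 𝟙 (y ≟ i))))))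
    ih = pairs-cnt m (λ y y< → half y (<-trans y< x<)) i
    x≢s∸y : ∀ y → y ≤ x → y ≤ s → x ≢ s ∸ y
    x≢s∸y y y≤x y≤s eq = <-irrefl (trans (cong (_+ y) eq) (m∸n+n≡m y≤s)) (≤-<-trans (+-monoʳ-≤ x y≤x) 2x<s)
    fresh : x ≡ i ⊎ s ∸ x ≡ i → cnt i (pairs m) ≡ 0
    fresh hit with proj₂ ih
    ... | inj₁ zero≡ = zero≡
    ... | inj₂ (y , y<x , hit′) = contradiction (clash hit hit′) id
      where
      y≤s : y ≤ s
      y≤s = ≤-trans (<⇒≤ y<x) x≤s
      clash : x ≡ i ⊎ s ∸ x ≡ i → y ≡ i ⊎ s ∸ y ≡ i → ⊥
      clash (inj₁ refl) (inj₁ refl) = <-irrefl refl y<x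
      clash (inj₁ refl) (inj₂ eq) = x≢s∸y y (<⇒≤ y<x) y≤s (sym eq)
      clash (inj₂ refl) (inj₁ eq) = x≢s∸y y (<⇒≤ y<x) y≤s (trans (sym (m∸[m∸n]≡n x≤s)) (cong (s ∸_) (sym eq)))
      clash (inj₂ refl) (inj₂ eq) = <-irrefl (∸-cancelˡ-≡ y≤s x≤s eq) y<x
    cost : f x ≡ f i → q * (e * 1) ≤ f i
    cost eq = ≤-trans (≤-reflexive (cong (q *_) (*-identityʳ e))) (≤-trans (m/n*n≤m (f x) e) (≤-reflexive eq))
    cases : cnt i (pairs m) + q * (e * (𝟙 (x ≟ i) + 𝟙 (s ∸ x ≟ i))) ≤ f i
          × (cnt i (pairs m) + q * (e * (𝟙 (x ≟ i) + 𝟙 (s ∸ x ≟ i))) ≡ 0 ⊎ ∃ λ y → y < lo + suc m × (y ≡ i ⊎ s ∸ y ≡ i))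
    cases with x ≟ i | s ∸ x ≟ i
    ... | yes refl | yes eq = contradiction (sym eq) (x≢s∸y x ≤-refl x≤s)
    ... | yes refl | no _ = ≤-trans (≤-reflexive (cong (_+ q * (e * 1)) (fresh (inj₁ refl)))) (cost refl) , inj₂ (x , x< , inj₁ refl)
    ... | no _ | yes refl = ≤-trans (≤-reflexive (cong (_+ q * (e * 1)) (fresh (inj₂ refl)))) (cost (sym (symmetric x x≤s))) , inj₂ (x , x< , inj₂ refl)
    ... | no _ | no _ = ≤-trans (≤-reflexive drop) (proj₁ ih) , rest (proj₂ ih)
      where
      drop : cnt i (pairs m) + q * (e * 0) ≡ cnt i (pairs m)
      drop = trans (cong (cnt i (pairs m) +_) (trans (cong (q *_) (*-zeroʳ e)) (*-zeroʳ q))) (+-identityʳ _)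
      rest : cnt i (pairs m) ≡ 0 ⊎ (∃ λ y → y < lo + m × (y ≡ i ⊎ s ∸ y ≡ i)) →
             cnt i (pairs m) + q * (e * 0) ≡ 0 ⊎ ∃ λ y → y < lo + suc m × (y ≡ i ⊎ s ∸ y ≡ i)
      rest (inj₁ z) = inj₁ (trans drop z)
      rest (inj₂ (y , y< , hit)) = inj₂ (y , <-trans y< x< , hit)

-- Blocks with one triple: uniform layers around a centre

injective-count : ∀ {n} (g : Fin n → ℕ) → (∀ x y → g x ≡ g y → x ≡ y) → ∀ i → sum (λ x → 𝟙 (g x ≟ i)) ≤ 1
injective-count g inj i with Finₚ.any? (λ x → g x ≟ i)
... | no none = ≤-trans (≤-reflexive (sum-zero λ x → 𝟙-no (g x ≟ i) (λ eq → none (x , eq)))) z≤n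
... | yes (x , eq) = ≤-trans (sum-mono λ y → 𝟙-mono (g y ≟ i) (x ≟ᶠ y) λ eq′ → inj x y (trans eq (sym eq′))) (≤-reflexive (sum-one x))

disjoint-count : ∀ {m n} (g : Fin m → ℕ) (g′ : Fin n → ℕ) → (∀ x y → g x ≡ g y → x ≡ y) → (∀ x y → g′ x ≡ g′ y → x ≡ y) →
  (∀ x y → g x ≢ g′ y) → ∀ i → sum (λ x → 𝟙 (g x ≟ i)) + sum (λ x → 𝟙 (g′ x ≟ i)) ≤ 1
disjoint-count g g′ inj inj′ disjoint i with Finₚ.any? (λ x → g x ≟ i)
... | no none = subst (λ z → z + sum (λ x → 𝟙 (g′ x ≟ i)) ≤ 1) (sym (sum-zero λ x → 𝟙-no (g x ≟ i) (λ eq → none (x , eq))))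
    (injective-count g′ inj′ i)
... | yes (x , eq) = subst (λ z → sum (λ x → 𝟙 (g x ≟ i)) + z ≤ 1) (sym (sum-zero λ y → 𝟙-no (g′ y ≟ i) (λ eq′ → disjoint x y (trans eq (sym eq′)))))
    (≤-trans (≤-reflexive (+-identityʳ _)) (injective-count g inj i))

-- `x′` is intended to be the mirror image of `x`, so the `e` pairs contribute nothing to the
-- imbalance and only the triple has to be balanced.
tripleBlock : ∀ e → ℕ → ℕ → ℕ → ℕ → Block (3 + (e + e))
tripleBlock e x′ x y z zero = x
tripleBlock e x′ x y z (suc zero) = y
tripleBlock e x′ x y z (suc (suc zero)) = z
tripleBlock e x′ x y z (suc (suc (suc α))) = pairBlock e x x′ α

sum-tripleBlock : ∀ e x′ x y z (g : ℕ → ℕ) → sum (λ α → g (tripleBlock e x′ x y z α)) ≡ g x + (g y + (g z + e * (g x + g x′)))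
sum-tripleBlock e x′ x y z g = cong (λ w → g x + (g y + (g z + w))) (sum-pairBlock e x x′ g)

-- One layer uses every value of [lo, lo + 2d] exactly a = 3 + 2e times: the columns
-- (lo + 2j, h - j, h + d - j) for j ≤ d and (lo + 2j + 1, h + d - j, h - 1 - j) for j < d
-- all sum to 3h, where h = lo + d, and each of the three rows is a permutation of the interval.
module Layer (e lo d : ℕ) where

  private
    h = lo + d
    a = 3 + (e + e)

  evenColumn : Fin (suc d) → Block a
  evenColumn j = tripleBlock e (h + h ∸ (lo + 2 * toℕ j)) (lo + 2 * toℕ j) (h ∸ toℕ j) (h + d ∸ toℕ j)

  oddColumn : Fin d → Block a
  oddColumn j = tripleBlock e (h + h ∸ (lo + 2 * toℕ j + 1)) (lo + 2 * toℕ j + 1) (h + d ∸ toℕ j) (h ∸ suc (toℕ j))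

  layer : List (Block a)
  layer = tabulate evenColumn ++ tabulate oddColumn

  layer-length : length layer ≡ 2 * d + 1
  layer-length = trans (length-++ (tabulate evenColumn)) (trans (cong₂ _+_ (length-tabulate evenColumn) (length-tabulate oddColumn)) (eq d))
    where
    eq : ∀ d → suc d + d ≡ 2 * d + 1
    eq = solve-∀

  InLayer : Block a → Set
  InLayer b = (∀ α → lo ≤ b α × b α ≤ h + d) × sum b ≡ a * h

  j≤d : (j : Fin (suc d)) → toℕ j ≤ d
  j≤d j = ≤-pred (Finₚ.toℕ<n j)

  d≤h : d ≤ h
  d≤h = m≤n+m d lo

  2h≡ : h + h ≡ lo + (h + d)
  2h≡ = eq lo d
    where
    eq : ∀ lo d → lo + d + (lo + d) ≡ lo + (lo + d + d)
    eq = solve-∀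

  Between : ℕ → Set
  Between x = lo ≤ x × x ≤ h + d

  mirror : ∀ x → Between x → Between (h + h ∸ x)
  mirror x (lo≤x , x≤) =
    ≤-trans (≤-reflexive (sym (trans (cong (_∸ (h + d)) 2h≡) (m+n∸n≡m lo (h + d))))) (∸-monoʳ-≤ (h + h) x≤) ,
    ≤-trans (∸-monoʳ-≤ (h + h) lo≤x) (≤-reflexive (trans (cong (_∸ lo) 2h≡) (m+n∸m≡n lo (h + d))))

  inLayer : ∀ x y z → Between x → Between y → Between z → x + (y + z) ≡ 3 * h → InLayer (tripleBlock e (h + h ∸ x) x y z)
  inLayer x y z bx by bz total = between , trans (sum-tripleBlock e (h + h ∸ x) x y z id) (begin
    x + (y + (z + e * (x + (h + h ∸ x)))) ≡⟨ cong (λ w → x + (y + (z + e * w))) (m+[n∸m]≡n x≤2h) ⟩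
    x + (y + (z + e * (h + h))) ≡⟨ eq₁ x y z (e * (h + h)) ⟩
    x + (y + z) + e * (h + h) ≡⟨ cong (_+ e * (h + h)) total ⟩
    3 * h + e * (h + h) ≡⟨ eq₂ e h ⟩
    a * h ∎)
    where
    open ≡-Reasoning
    x≤2h : x ≤ h + h
    x≤2h = ≤-trans (proj₂ bx) (≤-trans (m≤n+m (h + d) lo) (≤-reflexive (sym 2h≡)))
    eq₁ : ∀ x y z w → x + (y + (z + w)) ≡ x + (y + z) + w
    eq₁ = solve-∀
    eq₂ : ∀ e h → 3 * h + e * (h + h) ≡ (3 + (e + e)) * h
    eq₂ = solve-∀
    pair-between : ∀ α → Between (pairBlock e x (h + h ∸ x) α)
    pair-between α with splitAt e α
    ... | inj₁ _ = bx
    ... | inj₂ _ = mirror x bx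
    between : ∀ α → Between (tripleBlock e (h + h ∸ x) x y z α)
    between zero = bx
    between (suc zero) = by
    between (suc (suc zero)) = bz
    between (suc (suc (suc α))) = pair-between α

  lo≤h∸ : ∀ {j} → j ≤ d → lo ≤ h ∸ j
  lo≤h∸ {j} j≤ = ≤-trans (≤-reflexive (sym (m+n∸n≡m lo d))) (∸-monoʳ-≤ h j≤)

  h≤h+d∸ : ∀ {j} → j ≤ d → h ≤ h + d ∸ j
  h≤h+d∸ {j} j≤ = ≤-trans (≤-reflexive (sym (m+n∸n≡m h d))) (∸-monoʳ-≤ (h + d) j≤)

  x≤h+d : ∀ {i} → i ≤ d + d → lo + i ≤ h + d
  x≤h+d {i} i≤ = ≤-trans (+-monoʳ-≤ lo i≤) (≤-reflexive (sym (+-assoc lo d d)))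

  2j≤ : ∀ {j} → j ≤ d → 2 * j ≤ d + d
  2j≤ {j} j≤ = ≤-trans (*-monoʳ-≤ 2 j≤) (≤-reflexive (cong (d +_) (+-identityʳ d)))

  2j+1≤ : ∀ {j} → j < d → 2 * j + 1 ≤ d + d
  2j+1≤ {j} j< = ≤-trans (≤-trans (m≤n+m (2 * j + 1) 1) (≤-reflexive (eq j))) (2j≤ j<)
    where
    eq : ∀ j → 1 + (2 * j + 1) ≡ 2 * suc j
    eq = solve-∀

  evenColumn-in : ∀ j → InLayer (evenColumn j)
  evenColumn-in j = inLayer (lo + 2 * i) (h ∸ i) (h + d ∸ i)
    (m≤m+n lo _ , x≤h+d (2j≤ (j≤d j)))
    (lo≤h∸ (j≤d j) , ≤-trans (m∸n≤m h i) (m≤m+n h d))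
    (≤-trans (m≤m+n lo d) (h≤h+d∸ (j≤d j)) , m∸n≤m (h + d) i)
    (trans (eq lo i (h ∸ i) (h + d ∸ i)) (trans (cong₂ (λ x y → lo + (x + y)) (m∸n+n≡m (≤-trans (j≤d j) d≤h)) (m∸n+n≡m (≤-trans (j≤d j) (m≤n+m d h)))) (eq′ lo d)))
    where
    i = toℕ j
    eq : ∀ lo i y z → lo + 2 * i + (y + z) ≡ lo + ((y + i) + (z + i))
    eq = solve-∀
    eq′ : ∀ lo d → lo + (lo + d + (lo + d + d)) ≡ 3 * (lo + d)
    eq′ = solve-∀

  oddColumn-in : ∀ j → InLayer (oddColumn j)
  oddColumn-in j = inLayer (lo + 2 * i + 1) (h + d ∸ i) (h ∸ suc i)
    (≤-trans (m≤m+n lo (2 * i)) (m≤m+n _ 1) , ≤-trans (≤-reflexive (+-assoc lo (2 * i) 1)) (x≤h+d (2j+1≤ i<d)))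
    (≤-trans (m≤m+n lo d) (h≤h+d∸ (<⇒≤ i<d)) , m∸n≤m (h + d) i)
    (lo≤h∸ i<d , ≤-trans (m∸n≤m h (suc i)) (m≤m+n h d))
    (trans (eq lo i (h + d ∸ i) (h ∸ suc i)) (trans (cong₂ (λ x y → lo + (x + y)) (m∸n+n≡m (≤-trans (<⇒≤ i<d) (m≤n+m d h))) (m∸n+n≡m (≤-trans i<d d≤h))) (eq′ lo d)))
    where
    i = toℕ j
    i<d = Finₚ.toℕ<n j
    eq : ∀ lo i y z → lo + 2 * i + 1 + (y + z) ≡ lo + ((y + i) + (z + suc i))
    eq = solve-∀
    eq′ : ∀ lo d → lo + (lo + d + d + (lo + d)) ≡ 3 * (lo + d)
    eq′ = solve-∀

  layer-All : All InLayer layer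
  layer-All = ++⁺ (tabulate⁺ evenColumn-in) (tabulate⁺ oddColumn-in)

  private
    ∸-inj : ∀ {n} N → n ≤ suc N → (x y : Fin n) → N ∸ toℕ x ≡ N ∸ toℕ y → x ≡ y
    ∸-inj N n≤ x y eq = Finₚ.toℕ-injective (∸-cancelˡ-≡ (bound x) (bound y) eq)
      where
      bound : ∀ x → toℕ x ≤ N
      bound x = ≤-pred (≤-trans (Finₚ.toℕ<n x) n≤)

    2*-inj : ∀ {n} {x y : Fin n} → 2 * toℕ x ≡ 2 * toℕ y → x ≡ y
    2*-inj {x = x} {y} eq = Finₚ.toℕ-injective (*-cancelˡ-≡ (toℕ x) (toℕ y) 2 eq)

    X : Fin (suc d) → ℕ
    X j = lo + 2 * toℕ j
    X′ : Fin d → ℕ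
    X′ j = lo + 2 * toℕ j + 1
    X-inj : ∀ x y → X x ≡ X y → x ≡ y
    X-inj x y eq = 2*-inj (+-cancelˡ-≡ lo _ _ eq)
    X′-inj : ∀ x y → X′ x ≡ X′ y → x ≡ y
    X′-inj x y eq = 2*-inj (+-cancelˡ-≡ lo _ _ (+-cancelʳ-≡ 1 _ _ eq))
    X≢X′ : ∀ x y → X x ≢ X′ y
    X≢X′ x y eq = even≢odd (toℕ x) (toℕ y) (trans (+-cancelˡ-≡ lo _ _ (trans eq (+-assoc lo (2 * toℕ y) 1))) (+-comm (2 * toℕ y) 1))
    X≤ : ∀ x → X x ≤ h + h
    X≤ x = ≤-trans (proj₂ (proj₁ (evenColumn-in x) zero)) (≤-trans (m≤n+m (h + d) lo) (≤-reflexive (sym 2h≡)))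
    X′≤ : ∀ x → X′ x ≤ h + h
    X′≤ x = ≤-trans (proj₂ (proj₁ (oddColumn-in x) zero)) (≤-trans (m≤n+m (h + d) lo) (≤-reflexive (sym 2h≡)))

  -- In each row the even and odd columns take different values: `X` and `X′` differ in parity
  -- relative to `lo`, `Y ≤ h < Y′`, `Z′ < h ≤ Z`, and `W`, `W′` mirror `X`, `X′`. Hence a value
  -- occurs at most once in each of the `a` rows.
  layer-cnt : ∀ i → cnt i layer ≤ a
  layer-cnt i = begin
    cnt i layer
      ≡⟨ trans (cnt-++ i (tabulate evenColumn) (tabulate oddColumn)) (cong₂ _+_ (cnt-tabulate i evenColumn) (cnt-tabulate i oddColumn)) ⟩
    sum (λ j → occ i (evenColumn j)) + sum (λ j → occ i (oddColumn j))
      ≡⟨ cong₂ _+_ (split (λ j → h + h ∸ X j) X (λ j → h ∸ toℕ j) (λ j → h + d ∸ toℕ j)) (split (λ j → h + h ∸ X′ j) X′ (λ j → h + d ∸ toℕ j) (λ j → h ∸ suc (toℕ j))) ⟩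
    (♯ X + (♯ Y + (♯ Z + e * (♯ X + ♯ W)))) + (♯ X′ + (♯ Y′ + (♯ Z′ + e * (♯ X′ + ♯ W′))))
      ≡⟨ eq (♯ X) (♯ Y) (♯ Z) (♯ W) (♯ X′) (♯ Y′) (♯ Z′) (♯ W′) e ⟩
    (♯ X + ♯ X′) + ((♯ Y + ♯ Y′) + ((♯ Z + ♯ Z′) + e * ((♯ X + ♯ X′) + (♯ W + ♯ W′))))
      ≤⟨ +-mono-≤ x≤1 (+-mono-≤ y≤1 (+-mono-≤ z≤1 (*-monoʳ-≤ e (+-mono-≤ x≤1 w≤1)))) ⟩
    1 + (1 + (1 + e * (1 + 1)))
      ≡⟨ eq₂ e ⟩
    a ∎
    where
    open ≤-Reasoning
    ♯ : ∀ {n} → (Fin n → ℕ) → ℕ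
    ♯ g = sum (λ j → 𝟙 (g j ≟ i))
    Y Z W : Fin (suc d) → ℕ
    Y j = h ∸ toℕ j
    Z j = h + d ∸ toℕ j
    W j = h + h ∸ X j
    Y′ Z′ W′ : Fin d → ℕ
    Y′ j = h + d ∸ toℕ j
    Z′ j = h ∸ suc (toℕ j)
    W′ j = h + h ∸ X′ j
    split : ∀ {n} (x′ x y z : Fin n → ℕ) → sum (λ j → occ i (tripleBlock e (x′ j) (x j) (y j) (z j))) ≡ ♯ x + (♯ y + (♯ z + e * (♯ x + ♯ x′)))
    split {n} x′ x y z = begin-equality
      sum (λ j → occ i (tripleBlock e (x′ j) (x j) (y j) (z j)))
        ≡⟨ sum-cong-≗ (λ j → sum-tripleBlock e (x′ j) (x j) (y j) (z j) (λ v → 𝟙 (v ≟ i))) ⟩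
      sum (λ j → 𝟙 (x j ≟ i) + (𝟙 (y j ≟ i) + (𝟙 (z j ≟ i) + e * (𝟙 (x j ≟ i) + 𝟙 (x′ j ≟ i)))))
        ≡⟨ ∑-distrib-+ (λ (j : Fin n) → 𝟙 (x j ≟ i)) (λ j → 𝟙 (y j ≟ i) + (𝟙 (z j ≟ i) + e * (𝟙 (x j ≟ i) + 𝟙 (x′ j ≟ i)))) ⟩
      ♯ x + sum (λ j → 𝟙 (y j ≟ i) + (𝟙 (z j ≟ i) + e * (𝟙 (x j ≟ i) + 𝟙 (x′ j ≟ i))))
        ≡⟨ cong (♯ x +_) (∑-distrib-+ (λ (j : Fin n) → 𝟙 (y j ≟ i)) (λ j → 𝟙 (z j ≟ i) + e * (𝟙 (x j ≟ i) + 𝟙 (x′ j ≟ i)))) ⟩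
      ♯ x + (♯ y + sum (λ j → 𝟙 (z j ≟ i) + e * (𝟙 (x j ≟ i) + 𝟙 (x′ j ≟ i))))
        ≡⟨ cong (λ w → ♯ x + (♯ y + w)) (∑-distrib-+ (λ (j : Fin n) → 𝟙 (z j ≟ i)) (λ j → e * (𝟙 (x j ≟ i) + 𝟙 (x′ j ≟ i)))) ⟩
      ♯ x + (♯ y + (♯ z + sum (λ j → e * (𝟙 (x j ≟ i) + 𝟙 (x′ j ≟ i)))))
        ≡⟨ cong (λ w → ♯ x + (♯ y + (♯ z + w))) (trans (sym (*-distribˡ-sum e (λ (j : Fin n) → 𝟙 (x j ≟ i) + 𝟙 (x′ j ≟ i)))) (cong (e *_) (∑-distrib-+ (λ (j : Fin n) → 𝟙 (x j ≟ i)) (λ j → 𝟙 (x′ j ≟ i))))) ⟩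
      ♯ x + (♯ y + (♯ z + e * (♯ x + ♯ x′))) ∎
    eq : ∀ x y z w x′ y′ z′ w′ e → (x + (y + (z + e * (x + w)))) + (x′ + (y′ + (z′ + e * (x′ + w′))))
       ≡ (x + x′) + ((y + y′) + ((z + z′) + e * ((x + x′) + (w + w′))))
    eq = solve-∀
    eq₂ : ∀ e → 1 + (1 + (1 + e * (1 + 1))) ≡ 3 + (e + e)
    eq₂ = solve-∀
    x≤1 : ♯ X + ♯ X′ ≤ 1
    x≤1 = disjoint-count X X′ X-inj X′-inj X≢X′ i
    w≤1 : ♯ W + ♯ W′ ≤ 1
    w≤1 = disjoint-count W W′ (λ x y eq → X-inj x y (∸-cancelˡ-≡ (X≤ x) (X≤ y) eq)) (λ x y eq → X′-inj x y (∸-cancelˡ-≡ (X′≤ x) (X′≤ y) eq))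
      (λ x y eq → X≢X′ x y (∸-cancelˡ-≡ (X≤ x) (X′≤ y) eq)) i
    y≤1 : ♯ Y + ♯ Y′ ≤ 1
    y≤1 = disjoint-count Y Y′ (∸-inj h (s≤s d≤h)) (∸-inj (h + d) (≤-trans (m≤n+m d h) (n≤1+n _)))
      (λ x y → <⇒≢ (≤-<-trans (m∸n≤m h (toℕ x)) (h<h+d∸ (Finₚ.toℕ<n y)))) i
      where
      h<h+d∸ : ∀ {j} → j < d → h < h + d ∸ j
      h<h+d∸ {j} j<d = ≤-<-trans (≤-reflexive (sym (m+n∸n≡m h d))) (∸-monoʳ-< j<d (m≤n+m d h))
    z≤1 : ♯ Z + ♯ Z′ ≤ 1
    z≤1 = disjoint-count Z Z′ (∸-inj (h + d) (s≤s (m≤n+m d h))) Z′-inj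
      (λ x y → ≢-sym (<⇒≢ (<-≤-trans (Z′<h y) (h≤h+d∸ (j≤d x))))) i
      where
      Z′≤ : (j : Fin d) → suc (toℕ j) ≤ h
      Z′≤ j = ≤-trans (Finₚ.toℕ<n j) d≤h
      Z′-inj : ∀ x y → Z′ x ≡ Z′ y → x ≡ y
      Z′-inj x y eq = Finₚ.toℕ-injective (suc-injective (∸-cancelˡ-≡ (Z′≤ x) (Z′≤ y) eq))
      Z′<h : ∀ y → Z′ y < h
      Z′<h y = ∸-monoʳ-< {h} {suc (toℕ y)} {0} (s≤s z≤n) (Z′≤ y)

cnt-zero : ∀ {a} i {L : List (Block a)} → All (λ b → ∀ α → b α ≢ i) L → cnt i L ≡ 0
cnt-zero i [] = refl
cnt-zero i {b ∷ L} (h ∷ hs) = cong₂ _+_ (sum-zero λ α → 𝟙-no (b α ≟ i) (h α)) (cnt-zero i hs)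

distance-to-centre : ∀ lo d x → lo ≤ x → x ≤ lo + d + d → ∣ x - (lo + d) ∣ ≤ d
distance-to-centre lo d x lo≤x x≤ with ≤-total x (lo + d)
... | inj₁ x≤h = ≤-trans (≤-reflexive (m≤n⇒∣m-n∣≡n∸m x≤h)) (≤-trans (∸-monoʳ-≤ (lo + d) lo≤x) (≤-reflexive (m+n∸m≡n lo d)))
... | inj₂ h≤x = ≤-trans (≤-reflexive (m≤n⇒∣n-m∣≡n∸m h≤x)) (m≤n+o⇒m∸n≤o x (lo + d) x≤)

-- The number of integers at distance `d` from a fixed centre.
κ : ℕ → ℕ
κ zero = 1
κ (suc _) = 2

prefix-κ : ∀ m → prefix κ (suc m) ≡ 2 * m + 1
prefix-κ zero = refl
prefix-κ (suc m) = trans (cong (_+ 2) (prefix-κ m)) (eq m)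
  where
  eq : ∀ m → 2 * m + 1 + 2 ≡ 2 * suc m + 1
  eq = solve-∀

prefix-shift : ∀ (v : ℕ → ℕ) c m → prefix (λ d → κ d * v d) m ≤ prefix (λ d → κ d * (v d ∸ c)) m + prefix κ m * c
prefix-shift v c zero = z≤n
prefix-shift v c (suc m) = begin
  prefix (λ d → κ d * v d) m + κ m * v m
    ≤⟨ +-mono-≤ (prefix-shift v c m) (*-monoʳ-≤ (κ m) (m≤n+m∸n (v m) c)) ⟩
  prefix (λ d → κ d * (v d ∸ c)) m + prefix κ m * c + κ m * (c + (v m ∸ c))
    ≡⟨ eq (prefix (λ d → κ d * (v d ∸ c)) m) (prefix κ m) c (κ m) (v m ∸ c) ⟩
  prefix (λ d → κ d * (v d ∸ c)) m + κ m * (v m ∸ c) + (prefix κ m + κ m) * c ∎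
  where
  open ≤-Reasoning
  eq : ∀ P Q c k w → P + Q * c + k * (c + w) ≡ P + k * w + (Q + k) * c
  eq = solve-∀

CentredBlock : ∀ e → ℕ → ℕ → Block (3 + (e + e)) → Set
CentredBlock e h m b = (∀ α → ∣ b α - h ∣ < m) × sum b ≡ (3 + (e + e)) * h

-- Peel off the outermost layer as often as its weight allows; the weights of the inner
-- layers exceed it, so they can pay for the full layers.
centred-blocks : ∀ e h m → m ≤ suc h → (v : ℕ → ℕ) → (∀ d d′ → d ≤ d′ → d′ < m → v d′ ≤ v d) →
  ∃ λ L → All (CentredBlock e h m) L × (∀ i → ∣ i - h ∣ < m → cnt i L ≤ v ∣ i - h ∣) ×
          prefix (λ d → κ d * v d) m ≤ (3 + (e + e)) * (length L + m * m)
centred-blocks e h zero _ v mono = [] , [] , (λ _ _ → z≤n) , z≤n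
centred-blocks e h (suc m) (s≤s m≤h) v mono =
  step (h ∸ m) (sym (m∸n+n≡m m≤h)) (centred-blocks e h m (m≤n⇒m≤1+n m≤h) (λ d → v d ∸ v m)
    λ d d′ d≤d′ d′<m → ∸-monoˡ-≤ (v m) (mono d d′ d≤d′ (m<n⇒m<1+n d′<m)))
  where
  a = 3 + (e + e)
  q = v m / a
  step : ∀ lo → h ≡ lo + m →
    (∃ λ L → All (CentredBlock e h m) L × (∀ i → ∣ i - h ∣ < m → cnt i L ≤ v ∣ i - h ∣ ∸ v m) ×
      prefix (λ d → κ d * (v d ∸ v m)) m ≤ a * (length L + m * m)) →
    ∃ λ L → All (CentredBlock e h (suc m)) L × (∀ i → ∣ i - h ∣ < suc m → cnt i L ≤ v ∣ i - h ∣) ×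
      prefix (λ d → κ d * v d) (suc m) ≤ a * (length L + suc m * suc m)
  step lo refl (L , good , count , long) = L ++ repeat q layer ,
    ++⁺ (All.map (λ { (near , total) → (λ α → m<n⇒m<1+n (near α)) , total }) good)
        (repeat⁺ q (All.map (λ { (between , total) → (λ α → s≤s (distance-to-centre lo m _ (proj₁ (between α)) (proj₂ (between α)))) , total }) layer-All)) ,
    count′ , long′
    where
    open Layer e lo m
    open ≤-Reasoning
    cnt-layers : ∀ i → q * cnt i layer ≤ v m
    cnt-layers i = ≤-trans (*-monoʳ-≤ q (layer-cnt i)) (m/n*n≤m (v m) a)
    count′ : ∀ i → ∣ i - lo + m ∣ < suc m → cnt i (L ++ repeat q layer) ≤ v ∣ i - lo + m ∣
    count′ i near = subst (_≤ v ∣ i - lo + m ∣) (sym (trans (cnt-++ i L _) (cong (cnt i L +_) (cnt-repeat i q layer)))) (cases (m≤n⇒m<n∨m≡n (≤-pred near)))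
      where
      cases : ∣ i - lo + m ∣ < m ⊎ ∣ i - lo + m ∣ ≡ m → cnt i L + q * cnt i layer ≤ v ∣ i - lo + m ∣
      -- The recursive call granted an inner value only its weight reduced by `v m`; the full layers
      -- spend that remainder.
      cases (inj₁ inner) = ≤-trans (+-mono-≤ (count i inner) (cnt-layers i)) (≤-reflexive (m∸n+n≡m (mono _ m (<⇒≤ inner) (n<1+n m))))
      cases (inj₂ outer) = ≤-trans (≤-reflexive (cong (_+ q * cnt i layer) (cnt-zero i
          (All.map (λ { (near′ , _) α refl → <-irrefl outer (near′ α) }) good)))) (≤-trans (cnt-layers i) (≤-reflexive (cong v (sym outer))))
    -- The floor `q` costs at most `a` uses of each of the `2 * m + 1` values, and adding
    -- `2 * m + 1` to `m * m` gives the next square.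
    long′ : prefix (λ d → κ d * v d) (suc m) ≤ a * (length (L ++ repeat q layer) + suc m * suc m)
    long′ = begin
      prefix (λ d → κ d * v d) m + κ m * v m
        ≤⟨ +-monoˡ-≤ (κ m * v m) (prefix-shift v (v m) m) ⟩
      prefix (λ d → κ d * (v d ∸ v m)) m + prefix κ m * v m + κ m * v m
        ≡⟨ eq₁ (prefix (λ d → κ d * (v d ∸ v m)) m) (prefix κ m) (κ m) (v m) ⟩
      prefix (λ d → κ d * (v d ∸ v m)) m + (prefix κ m + κ m) * v m
        ≤⟨ +-mono-≤ long (*-mono-≤ (≤-reflexive (prefix-κ m)) (<-quotient (v m) a)) ⟩
      a * (length L + m * m) + (2 * m + 1) * (a * q + a)
        ≡⟨ eq₂ a (length L) m q ⟩
      a * (length L + q * (2 * m + 1) + suc m * suc m)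
        ≡⟨ cong (λ z → a * (z + suc m * suc m)) (trans (length-++ L) (cong (length L +_) (trans (length-repeat q layer) (cong (q *_) layer-length)))) ⟨
      a * (length (L ++ repeat q layer) + suc m * suc m) ∎
      where
      eq₁ : ∀ P Q k w → P + Q * w + k * w ≡ P + (Q + k) * w
      eq₁ = solve-∀
      eq₂ : ∀ a l m q → a * (l + m * m) + (2 * m + 1) * (a * q + a) ≡ a * (l + q * (2 * m + 1) + suc m * suc m)
      eq₂ = solve-∀

-- For `f` symmetric about `h` both sides are its total over 0, ..., 2h; the right side separates
-- the two tails from the layers at distance at most `D`.
prefix-κ-centre : ∀ (f : ℕ → ℕ) h D → D ≤ h →
  2 * prefix f h + f h ≡ 2 * prefix f (h ∸ D) + prefix (λ d → κ d * f (h ∸ d)) (suc D)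
prefix-κ-centre f h zero _ = cong (2 * prefix f h +_) (sym (+-identityʳ (f h)))
prefix-κ-centre f h (suc D) D<h = begin
  2 * prefix f h + f h
    ≡⟨ prefix-κ-centre f h D (<⇒≤ D<h) ⟩
  2 * prefix f (h ∸ D) + P
    ≡⟨ cong (λ z → 2 * prefix f z + P) (+-∸-assoc 1 D<h) ⟩
  2 * (prefix f (h ∸ suc D) + f (h ∸ suc D)) + P
    ≡⟨ eq (prefix f (h ∸ suc D)) (f (h ∸ suc D)) P ⟩
  2 * prefix f (h ∸ suc D) + (P + 2 * f (h ∸ suc D)) ∎
  where
  open ≡-Reasoning
  P = prefix (λ d → κ d * f (h ∸ d)) (suc D)
  eq : ∀ x y p → 2 * (x + y) + p ≡ 2 * x + (p + 2 * y)
  eq = solve-∀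

-- The distribution of subsets over the two halves of the ground set

-- The number of sets with x points in the first half and s - x in the second, for x ≤ s.
w : ℕ → ℕ → ℕ → ℕ
w N s x = (N C x) * (N C (s ∸ x))

-- This is (k + 1) C(n, k + 1) = (n - k) C(n, k) without subtraction.
ascend : ∀ n k → suc k * (n C suc k) + k * (n C k) ≡ n * (n C k)
ascend n k = +-cancelˡ-≡ (n C k) _ _ (begin
  n C k + (suc k * (n C suc k) + k * (n C k)) ≡⟨ eq k (n C k) (n C suc k) ⟩
  suc k * (n C k + n C suc k) ≡⟨ cong (suc k *_) (pascal n k) ⟨
  suc k * (suc n C suc k) ≡⟨ absorption n k ⟩
  suc n * (n C k) ∎)
  where
  open ≡-Reasoning
  eq : ∀ k x y → x + (suc k * y + k * x) ≡ suc k * (x + y)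
  eq = solve-∀

-- Double counting of pairs E ⊂ E′ with |E| = s, |E′| = s + 1 and E meeting the first half in fewer than t points.
shadow-identity : ∀ N s t → t ≤ suc s →
  (N + N) * prefix (w N s) t ≡ suc s * prefix (w N (suc s)) t + t * w N (suc s) t + s * prefix (w N s) t
shadow-identity N s zero _ = trans (*-zeroʳ (N + N)) (sym (cong₂ _+_ (trans (+-identityʳ _) (*-zeroʳ (suc s))) (*-zeroʳ s)))
shadow-identity N s (suc t) (s≤s t≤s) = begin
  (N + N) * (P + w N s t) ≡⟨ *-distribˡ-+ (N + N) P (w N s t) ⟩
  (N + N) * P + (N + N) * w N s t ≡⟨ cong (_+ (N + N) * w N s t) (shadow-identity N s t (m≤n⇒m≤1+n t≤s)) ⟩
  suc s * P′ + t * w N (suc s) t + s * P + (N + N) * w N s t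
    ≡⟨ cong₂ (λ z z′ → suc z * P′ + t * ((N C t) * (N C z′)) + z * P + (N + N) * ((N C t) * (N C y))) s≡ (+-∸-assoc 1 t≤s) ⟩
  suc (t + y) * P′ + t * (A * B′) + (t + y) * P + (N + N) * (A * B)
    ≡⟨ eq₁ t y P P′ A B B′ N ⟩
  suc (t + y) * P′ + t * (A * B′) + (t + y) * P + ((N * A) * B + A * (N * B))
    ≡⟨ cong₂ (λ z z′ → suc (t + y) * P′ + t * (A * B′) + (t + y) * P + (z * B + A * z′)) (ascend N t) (ascend N y) ⟨
  suc (t + y) * P′ + t * (A * B′) + (t + y) * P + ((suc t * A′ + t * A) * B + A * (suc y * B′ + y * B))
    ≡⟨ eq₂ t y P P′ A A′ B B′ ⟩
  suc (t + y) * (P′ + A * B′) + suc t * (A′ * B) + (t + y) * (P + A * B)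
    ≡⟨ cong₂ (λ z z′ → suc z * (P′ + (N C t) * (N C z′)) + suc t * (A′ * B) + z * (P + A * B)) s≡ (+-∸-assoc 1 t≤s) ⟨
  suc s * (P′ + w N (suc s) t) + suc t * w N (suc s) (suc t) + s * (P + w N s t) ∎
  where
  open ≡-Reasoning
  y = s ∸ t
  s≡ : s ≡ t + y
  s≡ = sym (m+[n∸m]≡n t≤s)
  P = prefix (w N s) t
  P′ = prefix (w N (suc s)) t
  A = N C t
  A′ = N C suc t
  B = N C y
  B′ = N C suc y
  eq₁ : ∀ t y P P′ A B B′ N → suc (t + y) * P′ + t * (A * B′) + (t + y) * P + (N + N) * (A * B)
      ≡ suc (t + y) * P′ + t * (A * B′) + (t + y) * P + ((N * A) * B + A * (N * B))
  eq₁ = solve-∀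
  eq₂ : ∀ t y P P′ A A′ B B′ → suc (t + y) * P′ + t * (A * B′) + (t + y) * P + ((suc t * A′ + t * A) * B + A * (suc y * B′ + y * B))
      ≡ suc (t + y) * (P′ + A * B′) + suc t * (A′ * B) + (t + y) * (P + A * B)
  eq₂ = solve-∀

-- At `t = s + 1` the shadow identity covers all types, so the totals obey the recursion `ascend` of
-- binomial coefficients.
vandermonde : ∀ N s → prefix (w N s) (suc s) ≡ (N + N) C s
vandermonde N zero = trans (cong₂ _*_ (nC0≡1 N) (nC0≡1 N)) (sym (nC0≡1 (N + N)))
vandermonde N (suc s) = *-cancelˡ-≡ _ _ (suc s) (+-cancelʳ-≡ (s * ((N + N) C s)) _ _ (begin
  suc s * prefix (w N (suc s)) (suc (suc s)) + s * ((N + N) C s)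
    ≡⟨ cong₂ (λ x y → x + s * y) (*-distribˡ-+ (suc s) (prefix (w N (suc s)) (suc s)) _) (sym (vandermonde N s)) ⟩
  suc s * prefix (w N (suc s)) (suc s) + suc s * w N (suc s) (suc s) + s * prefix (w N s) (suc s)
    ≡⟨ shadow-identity N s (suc s) ≤-refl ⟨
  (N + N) * prefix (w N s) (suc s)
    ≡⟨ cong ((N + N) *_) (vandermonde N s) ⟩
  (N + N) * ((N + N) C s)
    ≡⟨ ascend (N + N) s ⟨
  suc s * ((N + N) C suc s) + s * ((N + N) C s) ∎))
  where open ≡-Reasoning

w-symmetric : ∀ N s x → x ≤ s → w N s (s ∸ x) ≡ w N s x
w-symmetric N s x x≤s = trans (cong (λ z → (N C (s ∸ x)) * (N C z)) (m∸[m∸n]≡n x≤s)) (*-comm (N C (s ∸ x)) (N C x))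

prefix-cong : ∀ {f g : ℕ → ℕ} n → (∀ i → i < n → f i ≡ g i) → prefix f n ≡ prefix g n
prefix-cong zero h = refl
prefix-cong (suc n) h = cong₂ _+_ (prefix-cong n λ i i< → h i (m<n⇒m<1+n i<)) (h n (n<1+n n))

prefix-mono : ∀ (f : ℕ → ℕ) {m n} → m ≤ n → prefix f m ≤ prefix f n
prefix-mono f {m} {n} m≤n = subst (λ z → prefix f m ≤ prefix f z) (m∸n+n≡m m≤n) (grow (n ∸ m))
  where
  grow : ∀ k → prefix f m ≤ prefix f (k + m)
  grow zero = ≤-refl
  grow (suc k) = ≤-trans (grow k) (m≤m+n _ _)

prefix-+ : ∀ f a b → prefix f (a + b) ≡ prefix f a + prefix (λ i → f (a + i)) b
prefix-+ f a zero = trans (cong (prefix f) (+-identityʳ a)) (sym (+-identityʳ _))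
prefix-+ f a (suc b) = trans (cong (prefix f) (+-suc a b)) (trans (cong (_+ f (a + b)) (prefix-+ f a b)) (+-assoc (prefix f a) _ _))

prefix-reverse : ∀ f n → prefix f n ≡ prefix (λ i → f (n ∸ suc i)) n
prefix-reverse f zero = refl
prefix-reverse f (suc n) = trans (+-comm (prefix f n) (f n))
  (trans (cong (f n +_) (prefix-reverse f n)) (sym (prefix-+ (λ i → f (n ∸ i)) 1 n)))

prefix-symmetric : ∀ f s → (∀ x → x ≤ s → f (s ∸ x) ≡ f x) → ∀ a b → a + b ≡ suc s →
  prefix f (suc s) ≡ prefix f a + prefix f b
prefix-symmetric f s symmetric a b eq = begin
  prefix f (suc s) ≡⟨ cong (prefix f) eq ⟨
  prefix f (a + b) ≡⟨ prefix-+ f a b ⟩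
  prefix f a + prefix (λ i → f (a + i)) b ≡⟨ cong (prefix f a +_) (prefix-cong b reflect) ⟩
  prefix f a + prefix (λ i → f (b ∸ suc i)) b ≡⟨ cong (prefix f a +_) (prefix-reverse f b) ⟨
  prefix f a + prefix f b ∎
  where
  open ≡-Reasoning
  reflect : ∀ i → i < b → f (a + i) ≡ f (b ∸ suc i)
  reflect i i<b = trans (sym (symmetric (a + i) (≤-pred (subst (a + i <_) eq (+-monoʳ-< a i<b)))))
    (cong f (trans (cong (_∸ suc (a + i)) (sym eq)) (trans (cong (a + b ∸_) (sym (+-suc a i))) ([m+n]∸[m+o]≡n∸o a b (suc i)))))

-- The ratio C(n, x + 1) / C(n, x) = (n - x) / (x + 1) decreases in `x`. Clearing denominators
-- through `ascend` avoids the difference n - x and so covers arguments beyond `n`.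
log-concave : ∀ n x y → x ≤ y → (n C x) * (n C suc y) ≤ (n C suc x) * (n C y)
log-concave n x y x≤y = *-cancelˡ-≤ (suc x * suc y) (+-cancelʳ-≤ (suc x * y * (X * Y) + suc y * x * (X * Y)) _ _ (begin
  suc x * suc y * (X * Y′) + (suc x * y * (X * Y) + suc y * x * (X * Y))
    ≡⟨ eq₁ x y X Y Y′ ⟩
  suc x * X * (suc y * Y′ + y * Y) + suc y * x * (X * Y)
    ≡⟨ cong (λ z → suc x * X * z + suc y * x * (X * Y)) (ascend n y) ⟩
  suc x * X * (n * Y) + suc y * x * (X * Y)
    ≤⟨ subst (λ y → suc x * X * (n * Y) + suc y * x * (X * Y) ≤ suc y * Y * (n * X) + suc x * y * (X * Y)) (m+[n∸m]≡n x≤y)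
         (≤-trans (m≤m+n _ ((y ∸ x) * (n * (X * Y)) + (y ∸ x) * (X * Y))) (≤-reflexive (eq₂ x (y ∸ x) n X Y))) ⟩
  suc y * Y * (n * X) + suc x * y * (X * Y)
    ≡⟨ cong (λ z → suc y * Y * z + suc x * y * (X * Y)) (ascend n x) ⟨
  suc y * Y * (suc x * X′ + x * X) + suc x * y * (X * Y)
    ≡⟨ eq₃ x y X X′ Y ⟩
  suc x * suc y * (X′ * Y) + (suc x * y * (X * Y) + suc y * x * (X * Y)) ∎))
  where
  open ≤-Reasoning
  X = n C x
  X′ = n C suc x
  Y = n C y
  Y′ = n C suc y
  eq₁ : ∀ x y X Y Y′ → suc x * suc y * (X * Y′) + (suc x * y * (X * Y) + suc y * x * (X * Y)) ≡ suc x * X * (suc y * Y′ + y * Y) + suc y * x * (X * Y)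
  eq₁ = solve-∀
  eq₂ : ∀ x k n X Y → suc x * X * (n * Y) + suc (x + k) * x * (X * Y) + (k * (n * (X * Y)) + k * (X * Y))
      ≡ suc (x + k) * Y * (n * X) + suc x * (x + k) * (X * Y)
  eq₂ = solve-∀
  eq₃ : ∀ x y X X′ Y → suc y * Y * (suc x * X′ + x * X) + suc x * y * (X * Y) ≡ suc x * suc y * (X′ * Y) + (suc x * y * (X * Y) + suc y * x * (X * Y))
  eq₃ = solve-∀

-- Log-concavity at `x` and `s - x - 1`: a more even split of `s` has a larger product.
w-increasing : ∀ N s x → suc (x + x) ≤ s → w N s x ≤ w N s (suc x)
w-increasing N s x 2x<s = subst (λ z → (N C x) * (N C z) ≤ w N s (suc x)) (sym (+-∸-assoc 1 x<s)) (log-concave N x (s ∸ suc x) x≤)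
  where
  x<s : suc x ≤ s
  x<s = ≤-trans (s≤s (m≤m+n x x)) 2x<s
  x≤ : x ≤ s ∸ suc x
  x≤ = m+n≤o⇒m≤o∸n x (subst (_≤ s) (sym (+-suc x x)) 2x<s)

w-unimodal : ∀ N h x k → x + k ≤ h → w N (h + h) x ≤ w N (h + h) (x + k)
w-unimodal N h x zero _ = ≤-reflexive (cong (w N (h + h)) (sym (+-identityʳ x)))
w-unimodal N h x (suc k) le = ≤-trans (w-unimodal N h x k (<⇒≤ le′))
  (≤-trans (w-increasing N (h + h) (x + k) (+-mono-≤ le′ (<⇒≤ le′))) (≤-reflexive (cong (w N (h + h)) (sym (+-suc x k)))))
  where
  le′ : suc (x + k) ≤ h
  le′ = subst (_≤ h) (+-suc x k) le

w-centre-max : ∀ N h x → x ≤ h + h → w N (h + h) x ≤ w N (h + h) h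
w-centre-max N h x x≤2h with ≤-total x h
... | inj₁ x≤h = subst (λ z → w N (h + h) x ≤ w N (h + h) z) (m+[n∸m]≡n x≤h) (w-unimodal N h x (h ∸ x) (≤-reflexive (m+[n∸m]≡n x≤h)))
... | inj₂ h≤x = subst (_≤ w N (h + h) h) (w-symmetric N (h + h) x x≤2h) (subst (λ z → w N (h + h) x′ ≤ w N (h + h) z) (m+[n∸m]≡n x′≤h) (w-unimodal N h x′ (h ∸ x′) (≤-reflexive (m+[n∸m]≡n x′≤h))))
  where
  x′ = h + h ∸ x
  x′≤h : x′ ≤ h
  x′≤h = ≤-trans (∸-monoʳ-≤ (h + h) h≤x) (≤-reflexive (m+n∸n≡m h h))

-- Central binomial coefficients and the share of a single type

-- Both sides are (2N)! / (m! l!)² with N = m + l. This expresses the share of the central type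
-- among the sets of size 2m by central binomial coefficients.
central-identity : ∀ m l →
  ((m + l) C m) * ((m + l) C m) * (((m + l) + (m + l)) C (m + l)) ≡ (((m + m) + (l + l)) C (m + m)) * (((m + m) C m) * ((l + l) C l))
central-identity m l = *-cancelʳ-≡ _ _ (m ! * l ! * (m ! * l !)) {{m*n≢0 (m ! * l !) (m ! * l !) {{m !* l !≢0}} {{m !* l !≢0}}}} (begin
  b * b * B * (m ! * l ! * (m ! * l !))
    ≡⟨ eq₁ b B (m !) (l !) ⟩
  B * ((b * (m ! * l !)) * (b * (m ! * l !)))
    ≡⟨ cong (λ z → B * (z * z)) (choose-factorial m l) ⟩
  B * ((m + l) ! * (m + l) !)
    ≡⟨ choose-factorial (m + l) (m + l) ⟩
  ((m + l) + (m + l)) !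
    ≡⟨ cong _! (eq₂ m l) ⟩
  ((m + m) + (l + l)) !
    ≡⟨ choose-factorial (m + m) (l + l) ⟨
  T * ((m + m) ! * (l + l) !)
    ≡⟨ cong₂ (λ x y → T * (x * y)) (choose-factorial m m) (choose-factorial l l) ⟨
  T * (((m + m) C m) * (m ! * m !) * (((l + l) C l) * (l ! * l !)))
    ≡⟨ eq₃ T ((m + m) C m) ((l + l) C l) (m !) (l !) ⟩
  T * (((m + m) C m) * ((l + l) C l)) * (m ! * l ! * (m ! * l !)) ∎)
  where
  open ≡-Reasoning
  b = (m + l) C m
  B = ((m + l) + (m + l)) C (m + l)
  T = ((m + m) + (l + l)) C (m + m)
  eq₁ : ∀ b B u v → b * b * B * (u * v * (u * v)) ≡ B * ((b * (u * v)) * (b * (u * v)))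
  eq₁ = solve-∀
  eq₂ : ∀ m l → (m + l) + (m + l) ≡ (m + m) + (l + l)
  eq₂ = solve-∀
  eq₃ : ∀ T x y u v → T * (x * (u * u) * (y * (v * v))) ≡ T * (x * y) * (u * v * (u * v))
  eq₃ = solve-∀

central : ℕ → ℕ
central n = (n + n) C n

central-step : ∀ n → suc n * central (suc n) ≡ 2 * (2 * n + 1) * central n
central-step n = *-cancelˡ-≡ _ _ (suc n * (n ! * n !)) {{m*n≢0 (suc n) (n ! * n !) {{_}} {{n !* n !≢0}}}} (begin
  suc n * (n ! * n !) * (suc n * central (suc n)) ≡⟨ eq₁ n (n !) (central (suc n)) ⟩
  central (suc n) * (suc n ! * suc n !) ≡⟨ choose-factorial (suc n) (suc n) ⟩
  (suc n + suc n) ! ≡⟨ cong _! (cong suc (+-suc n n)) ⟩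
  suc (suc (n + n)) * (suc (n + n) * (n + n) !) ≡⟨ cong (λ z → suc (suc (n + n)) * (suc (n + n) * z)) (choose-factorial n n) ⟨
  suc (suc (n + n)) * (suc (n + n) * (central n * (n ! * n !))) ≡⟨ eq₂ n (central n) (n !) ⟩
  suc n * (n ! * n !) * (2 * (2 * n + 1) * central n) ∎)
  where
  open ≡-Reasoning
  eq₁ : ∀ n u b → suc n * (u * u) * (suc n * b) ≡ b * (suc n * u * (suc n * u))
  eq₁ = solve-∀
  eq₂ : ∀ n b u → suc (suc (n + n)) * (suc (n + n) * (b * (u * u))) ≡ suc n * (u * u) * (2 * (2 * n + 1) * b)
  eq₂ = solve-∀

-- central n is of order 4ⁿ / √n.
central-upper : ∀ n → (2 * n + 1) * (central n * central n) ≤ 16 ^ n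
central-upper zero = ≤-refl
central-upper (suc n) = *-cancelˡ-≤ (suc n * suc n) (begin
  suc n * suc n * ((2 * suc n + 1) * (central (suc n) * central (suc n)))
    ≡⟨ eq₁ n (central (suc n)) ⟩
  (2 * suc n + 1) * ((suc n * central (suc n)) * (suc n * central (suc n)))
    ≡⟨ cong (λ z → (2 * suc n + 1) * (z * z)) (central-step n) ⟩
  (2 * suc n + 1) * ((2 * (2 * n + 1) * central n) * (2 * (2 * n + 1) * central n))
    ≡⟨ eq₂ n (central n) ⟩
  4 * (2 * suc n + 1) * (2 * n + 1) * ((2 * n + 1) * (central n * central n))
    ≤⟨ *-mono-≤ {4 * (2 * suc n + 1) * (2 * n + 1)} {suc n * suc n * 16} (≤-trans (m≤m+n _ 4) (≤-reflexive (eq₃ n))) (central-upper n) ⟩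
  suc n * suc n * 16 * 16 ^ n
    ≡⟨ *-assoc (suc n * suc n) 16 (16 ^ n) ⟩
  suc n * suc n * (16 * 16 ^ n) ∎)
  where
  open ≤-Reasoning
  eq₁ : ∀ n b → suc n * suc n * ((2 * suc n + 1) * (b * b)) ≡ (2 * suc n + 1) * ((suc n * b) * (suc n * b))
  eq₁ = solve-∀
  eq₂ : ∀ n b → (2 * suc n + 1) * ((2 * (2 * n + 1) * b) * (2 * (2 * n + 1) * b)) ≡ 4 * (2 * suc n + 1) * (2 * n + 1) * ((2 * n + 1) * (b * b))
  eq₂ = solve-∀
  eq₃ : ∀ n → 4 * (2 * suc n + 1) * (2 * n + 1) + 4 ≡ suc n * suc n * 16
  eq₃ = solve-∀

-- The inequality 16ⁿ ≤ 4n (central n)² fails at n = 0, so the statement begins at n = 1.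
central-lower : ∀ n → 16 ^ suc n ≤ 4 * suc n * (central (suc n) * central (suc n))
central-lower zero = ≤-refl
central-lower (suc n) = *-cancelˡ-≤ (suc (suc n) * suc (suc n)) (begin
  N * N * (16 * 16 ^ suc n)
    ≡⟨ eq₀ N (16 ^ suc n) ⟩
  16 * (N * N) * 16 ^ suc n
    ≤⟨ *-monoʳ-≤ (16 * (N * N)) (central-lower n) ⟩
  16 * (N * N) * (4 * suc n * (b * b))
    ≤⟨ ≤-trans (m≤m+n _ (16 * N * (b * b))) (≤-reflexive (eq₁ n b)) ⟩
  4 * N * ((2 * (2 * suc n + 1) * b) * (2 * (2 * suc n + 1) * b))
    ≡⟨ cong (λ z → 4 * N * (z * z)) (central-step (suc n)) ⟨
  4 * N * ((N * central N) * (N * central N))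
    ≡⟨ eq₂ N (central N) ⟩
  N * N * (4 * N * (central N * central N)) ∎)
  where
  open ≤-Reasoning
  N = suc (suc n)
  b = central (suc n)
  eq₀ : ∀ N x → N * N * (16 * x) ≡ 16 * (N * N) * x
  eq₀ = solve-∀
  eq₁ : ∀ n b → 16 * (suc (suc n) * suc (suc n)) * (4 * suc n * (b * b)) + 16 * suc (suc n) * (b * b)
      ≡ 4 * suc (suc n) * ((2 * (2 * suc n + 1) * b) * (2 * (2 * suc n + 1) * b))
  eq₁ = solve-∀
  eq₂ : ∀ N b → 4 * N * ((N * b) * (N * b)) ≡ N * N * (4 * N * (b * b))
  eq₂ = solve-∀

square-cancel : ∀ x y → x * x ≤ y * y → x ≤ y
square-cancel x y h with x ≤? y
... | yes x≤y = x≤y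
... | no x≰y = contradiction h (<⇒≱ (*-mono-< (≰⇒> x≰y) (≰⇒> x≰y)))

-- By the bounds on central coefficients, the squared share of the central type is at most 4N / ((2m
-- + 1)(2l + 1)) with N = m + l. As m ≤ l gives N ≤ 2l + 1, this is at most 4 / (2m + 1) ≤ 1 / q²
-- when q > 0.
small-centre : ∀ q m l → m ≤ l → 0 < l → 4 * (q * q) ≤ 2 * m + 1 →
  q * w (m + l) (m + m) m ≤ ((m + l) + (m + l)) C (m + m)
small-centre q m (suc l) m≤l _ q≤ = square-cancel (q * W) T
  (*-cancelˡ-≤ 4 (≤-trans (≤-reflexive (eq₀ q W)) (≤-trans (*-monoˡ-≤ (W * W) q≤) bound)))
  where
  open ≤-Reasoning
  L = suc l
  N = m + L
  W = w N (m + m) m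
  T = (N + N) C (m + m)
  b = central m
  b′ = central L
  eq₀ : ∀ q W → 4 * (q * W * (q * W)) ≡ 4 * (q * q) * (W * W)
  eq₀ = solve-∀
  N≡ : N ≡ suc (m + l)
  N≡ = +-suc m l
  instance
    nz : NonZero N
    nz = subst NonZero (sym N≡) _
  W≡ : W * central N ≡ T * (b * b′)
  W≡ = trans (cong (λ z → (N C m) * (N C z) * central N) (m+n∸m≡n m m))
    (trans (central-identity m L) (cong (λ z → (z C (m + m)) * (b * b′)) (eq m L)))
    where
    eq : ∀ m L → (m + m) + (L + L) ≡ (m + L) + (m + L)
    eq = solve-∀
  lower : 16 ^ N ≤ 4 * N * (central N * central N)
  lower = subst (λ z → 16 ^ z ≤ 4 * z * (central z * central z)) (sym N≡) (central-lower (m + l))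
  N≤ : N ≤ 2 * L + 1
  N≤ = ≤-trans (+-monoˡ-≤ L m≤l) (≤-trans (m≤m+n (L + L) 1) (≤-reflexive (cong (_+ 1) (cong (L +_) (sym (+-identityʳ L))))))
  bound : (2 * m + 1) * (W * W) ≤ 4 * (T * T)
  bound = *-cancelˡ-≤ (N * 16 ^ N) {{m*n≢0 N (16 ^ N) {{nz}} {{m^n≢0 16 N}}}} (begin
    N * 16 ^ N * ((2 * m + 1) * (W * W))
      ≤⟨ *-monoˡ-≤ ((2 * m + 1) * (W * W)) (*-mono-≤ N≤ lower) ⟩
    (2 * L + 1) * (4 * N * (central N * central N)) * ((2 * m + 1) * (W * W))
      ≡⟨ eq₁ (2 * L + 1) N (central N) (2 * m + 1) W ⟩
    (2 * L + 1) * (2 * m + 1) * (4 * N) * ((W * central N) * (W * central N))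
      ≡⟨ cong (λ z → (2 * L + 1) * (2 * m + 1) * (4 * N) * (z * z)) W≡ ⟩
    (2 * L + 1) * (2 * m + 1) * (4 * N) * ((T * (b * b′)) * (T * (b * b′)))
      ≡⟨ eq₂ (2 * L + 1) (2 * m + 1) (4 * N) T b b′ ⟩
    ((2 * m + 1) * (b * b)) * ((2 * L + 1) * (b′ * b′)) * (4 * N * (T * T))
      ≤⟨ *-monoˡ-≤ (4 * N * (T * T)) (*-mono-≤ (central-upper m) (central-upper L)) ⟩
    16 ^ m * 16 ^ L * (4 * N * (T * T))
      ≡⟨ cong (_* (4 * N * (T * T))) (^-distribˡ-+-* 16 m L) ⟨
    16 ^ N * (4 * N * (T * T))
      ≡⟨ eq₃ (16 ^ N) N T ⟩
    N * 16 ^ N * (4 * (T * T)) ∎)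
    where
    eq₁ : ∀ x N c y W → x * (4 * N * (c * c)) * (y * (W * W)) ≡ x * y * (4 * N) * ((W * c) * (W * c))
    eq₁ = solve-∀
    eq₂ : ∀ x y z T b b′ → x * y * z * ((T * (b * b′)) * (T * (b * b′))) ≡ (y * (b * b)) * (x * (b′ * b′)) * (z * (T * T))
    eq₂ = solve-∀
    eq₃ : ∀ p N T → p * (4 * N * (T * T)) ≡ N * p * (4 * (T * T))
    eq₃ = solve-∀

Halves : ℕ → ℕ → Set
Halves s h = s ≡ h + h ⊎ s ≡ suc (h + h)

parity : ∀ s → ∃ λ h → Halves s h
parity zero = 0 , inj₁ refl
parity (suc s) with parity s
... | h , inj₁ eq = h , inj₂ (cong suc eq)
... | h , inj₂ eq = suc h , inj₁ (trans (cong suc eq) (cong suc (sym (+-suc h h))))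

-- For odd s the bound is transferred from s + 1.
small-types : ∀ q N s x → 256 * (q * q) ≤ s → 0 < s → 4 * s ≤ 3 * N → x ≤ s → q * w N s x ≤ (N + N) C s
small-types q N s x q≤ s>0 4s≤3N x≤s = cases (parity s)
  where
  open ≤-Reasoning
  s<N : s < N
  s<N = *-cancelˡ-< 3 s N (<-≤-trans (+-monoˡ-< (3 * s) s>0) 4s≤3N)
  even : ∀ q h → h + h ≤ N → 0 < h → 4 * (q * q) ≤ 2 * h + 1 → ∀ y → y ≤ h + h → q * w N (h + h) y ≤ (N + N) C (h + h)
  even q h 2h≤N h>0 q≤ y y≤ = ≤-trans (*-monoʳ-≤ q (w-centre-max N h y y≤))
    (subst (λ n → q * w n (h + h) h ≤ (n + n) C (h + h)) (m+[n∸m]≡n h≤N)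
      (small-centre q h (N ∸ h) h≤ (<-≤-trans h>0 h≤) q≤))
    where
    h≤N : h ≤ N
    h≤N = ≤-trans (m≤m+n h h) 2h≤N
    h≤ : h ≤ N ∸ h
    h≤ = m+n≤o⇒m≤o∸n h 2h≤N
  2h≡ : ∀ h → h + h ≡ 2 * h
  2h≡ h = cong (h +_) (sym (+-identityʳ h))
  cases : (∃ λ h → Halves s h) → q * w N s x ≤ (N + N) C s
  cases (zero , inj₁ refl) = contradiction s>0 λ ()
  cases (suc h , inj₁ refl) = even q (suc h) (<⇒≤ s<N) (s≤s z≤n)
    (≤-trans (*-monoˡ-≤ (q * q) {4} {256} (m≤m+n 4 252)) (≤-trans q≤ (≤-trans (≤-reflexive (2h≡ (suc h))) (m≤m+n _ 1)))) x x≤s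
  -- From s + 1 down to s, a type grows by a factor at most 4(s + 1) / N and the whole level shrinks
  -- by at most 2N / (s + 1). Together these cost a factor 8, so the even case is applied to
  -- `8 * q`; this explains 256 = 4 * 8 * 8.
  cases (h₀ , inj₂ s≡) = *-cancelˡ-≤ (8 * (N * suc s)) {{m*n≢0 8 (N * suc s) {{_}} {{m*n≢0 N (suc s) {{>-nonZero (≤-<-trans z≤n s<N)}}}}}} (begin
    8 * (N * suc s) * (q * W)
      ≡⟨ eq₁ N (suc s) q W ⟩
    8 * q * suc s * W * N
      ≤⟨ *-monoʳ-≤ (8 * q * suc s * W) N≤4 ⟩
    8 * q * suc s * W * (4 * (N ∸ y))
      ≡⟨ eq₂ q (suc s) (N C x) (N C y) (N ∸ y) ⟩
    4 * (8 * q * suc s) * ((N C x) * ((N ∸ y) * (N C y)))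
      ≡⟨ cong (λ z → 4 * (8 * q * suc s) * ((N C x) * z)) descend ⟩
    4 * (8 * q * suc s) * ((N C x) * (suc y * (N C suc y)))
      ≡⟨ eq₃ q (suc s) (N C x) (suc y) (N C suc y) ⟩
    4 * suc y * suc s * (8 * q * ((N C x) * (N C suc y)))
      ≤⟨ *-monoʳ-≤ (4 * suc y * suc s) next ⟩
    4 * suc y * suc s * ((N + N) C suc s)
      ≡⟨ *-assoc (4 * suc y) (suc s) _ ⟩
    4 * suc y * (suc s * ((N + N) C suc s))
      ≤⟨ *-mono-≤ (*-monoʳ-≤ 4 (s≤s (m∸n≤m s x))) (≤-trans (m≤m+n _ (s * ((N + N) C s))) (≤-reflexive (ascend (N + N) s))) ⟩
    4 * suc s * ((N + N) * ((N + N) C s))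
      ≡⟨ eq₄ (suc s) N ((N + N) C s) ⟩
    8 * (N * suc s) * ((N + N) C s) ∎)
    where
    h = suc h₀
    eq : suc s ≡ h + h
    eq = cong suc (trans s≡ (sym (+-suc h₀ h₀)))
    y = s ∸ x
    W = w N s x
    eq₁ : ∀ N s q W → 8 * (N * s) * (q * W) ≡ 8 * q * s * W * N
    eq₁ = solve-∀
    eq₂ : ∀ q s a b k → 8 * q * s * (a * b) * (4 * k) ≡ 4 * (8 * q * s) * (a * (k * b))
    eq₂ = solve-∀
    eq₃ : ∀ q s a y b → 4 * (8 * q * s) * (a * (y * b)) ≡ 4 * y * s * (8 * q * (a * b))
    eq₃ = solve-∀
    eq₄ : ∀ s N T → 4 * s * ((N + N) * T) ≡ 8 * (N * s) * T
    eq₄ = solve-∀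
    y≤N : y ≤ N
    y≤N = ≤-trans (m∸n≤m s x) (<⇒≤ s<N)
    N≤4 : N ≤ 4 * (N ∸ y)
    N≤4 = +-cancelʳ-≤ (4 * y) _ _ (begin
      N + 4 * y ≤⟨ +-monoʳ-≤ N (≤-trans (*-monoʳ-≤ 4 (m∸n≤m s x)) 4s≤3N) ⟩
      4 * N ≡⟨ cong (4 *_) (m∸n+n≡m y≤N) ⟨
      4 * (N ∸ y + y) ≡⟨ *-distribˡ-+ 4 (N ∸ y) y ⟩
      4 * (N ∸ y) + 4 * y ∎)
    descend : (N ∸ y) * (N C y) ≡ suc y * (N C suc y)
    descend = +-cancelʳ-≡ (y * (N C y)) _ _ (trans (sym (*-distribʳ-+ (N C y) (N ∸ y) y)) (trans (cong (_* (N C y)) (m∸n+n≡m y≤N)) (sym (ascend N y))))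
    next : 8 * q * ((N C x) * (N C suc y)) ≤ (N + N) C suc s
    next = subst₂ (λ z S → 8 * q * ((N C x) * (N C z)) ≤ (N + N) C S) (trans (cong (_∸ x) (sym eq)) (+-∸-assoc 1 x≤s)) (sym eq)
      (even (8 * q) h (subst (_≤ N) eq s<N) (s≤s z≤n)
        (begin
          4 * (8 * q * (8 * q)) ≡⟨ eq₅ q ⟩
          256 * (q * q) ≤⟨ q≤ ⟩
          s ≤⟨ n≤1+n s ⟩
          suc s ≡⟨ trans eq (2h≡ h) ⟩
          2 * h ≤⟨ m≤m+n (2 * h) 1 ⟩
          2 * h + 1 ∎) x (subst (x ≤_) eq (m≤n⇒m≤1+n x≤s)))
      where
      eq₅ : ∀ q → 4 * (8 * q * (8 * q)) ≡ 256 * (q * q)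
      eq₅ = solve-∀

-- Building a Sperner system from blocks

module _ {N a b s s′ um uo p : ℕ} (Bm : Fin p → Block a) (Bo : Fin p → Block b)
  (mid : ∀ j α → um ≤ Bm j α × Bm j α + um ≤ s)
  (outer : ∀ j α → Bo j α ≤ s′ × (Bo j α < uo ⊎ s′ ∸ Bo j α < uo))
  (mid-count : ∀ i → i ≤ s → sum (λ j → occ i (Bm j)) ≤ w N s i)
  (outer-count : ∀ i → i ≤ s′ → sum (λ j → occ i (Bo j)) ≤ w N s′ i)
  (sums : ∀ j → sum (Bm j) + sum (Bo j) ≡ N)
  (total : a * s + b * s′ ≡ N + N)
  (uo≤um : uo ≤ um) (gap : s + uo ≤ s′ + um) (s≢s′ : s ≢ s′) (s>0 : 0 < s) (s′>0 : 0 < s′)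
  where

  private
    t₁ t₂ : Fin p → Fin a ⊎ Fin b → ℕ
    t₁ j = [ Bm j , Bo j ]′
    t₂ j = [ (λ α → s ∸ Bm j α) , (λ α → s′ ∸ Bo j α) ]′

    mid≤s : ∀ j α → Bm j α ≤ s
    mid≤s j α = ≤-trans (m≤m+n _ um) (proj₂ (mid j α))

    sum-split : (g : Fin a ⊎ Fin b → ℕ) → sum (g ∘ splitAt a) ≡ sum (g ∘ inj₁) + sum (g ∘ inj₂)
    sum-split g = trans (sum-+ a (g ∘ splitAt a)) (cong₂ _+_
      (sum-cong-≗ λ α → cong g (Finₚ.splitAt-↑ˡ a α b)) (sum-cong-≗ λ α → cong g (Finₚ.splitAt-↑ʳ a b α)))

    rows₁ : ∀ j → sum (t₁ j ∘ splitAt a) ≡ N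
    rows₁ j = trans (sum-split (t₁ j)) (sums j)

    t₁+t₂ : ∀ j σ → t₁ j σ + t₂ j σ ≡ [ (λ _ → s) , (λ _ → s′) ]′ σ
    t₁+t₂ j (inj₁ α) = m+[n∸m]≡n (mid≤s j α)
    t₁+t₂ j (inj₂ α) = m+[n∸m]≡n (proj₁ (outer j α))

    rows₂ : ∀ j → sum (t₂ j ∘ splitAt a) ≡ N
    rows₂ j = +-cancelˡ-≡ N _ _ (begin
      N + sum (t₂ j ∘ splitAt a) ≡⟨ cong (_+ sum (t₂ j ∘ splitAt a)) (rows₁ j) ⟨
      sum (t₁ j ∘ splitAt a) + sum (t₂ j ∘ splitAt a) ≡⟨ ∑-distrib-+ (t₁ j ∘ splitAt a) (t₂ j ∘ splitAt a) ⟨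
      sum (λ α → t₁ j (splitAt a α) + t₂ j (splitAt a α)) ≡⟨ sum-cong-≗ (λ α → t₁+t₂ j (splitAt a α)) ⟩
      sum ([ (λ _ → s) , (λ _ → s′) ]′ ∘ splitAt a) ≡⟨ sum-split [ (λ _ → s) , (λ _ → s′) ]′ ⟩
      sum {a} (λ _ → s) + sum {b} (λ _ → s′) ≡⟨ cong₂ _+_ (sum-const a s) (sum-const b s′) ⟩
      a * s + b * s′ ≡⟨ total ⟩
      N + N ∎)
      where open ≡-Reasoning

    positive : ∀ j σ → 0 < t₁ j σ + t₂ j σ
    positive j (inj₁ α) = subst (0 <_) (sym (t₁+t₂ j (inj₁ α))) s>0
    positive j (inj₂ α) = subst (0 <_) (sym (t₁+t₂ j (inj₂ α))) s′>0

    counts : ∀ x y → sum (λ j → sum (λ α → 𝟙 (t₁ j (splitAt a α) ≟ x) * 𝟙 (t₂ j (splitAt a α) ≟ y))) ≤ (N C x) * (N C y)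
    counts x y = ≤-trans (≤-reflexive divide) cases
      where
      both : Fin p → Fin a ⊎ Fin b → ℕ
      both j σ = 𝟙 (t₁ j σ ≟ x) * 𝟙 (t₂ j σ ≟ y)
      M O : ℕ
      M = sum (λ j → sum (λ α → both j (inj₁ α)))
      O = sum (λ j → sum (λ α → both j (inj₂ α)))
      divide : sum (λ j → sum (λ α → both j (splitAt a α))) ≡ M + O
      divide = trans (sum-cong-≗ λ j → sum-split (both j)) (∑-distrib-+ (λ j → sum (λ α → both j (inj₁ α))) (λ j → sum (λ α → both j (inj₂ α))))
      both≤ : ∀ j σ → both j σ ≤ 𝟙 (t₁ j σ ≟ x)
      both≤ j σ = ≤-trans (*-monoʳ-≤ (𝟙 (t₁ j σ ≟ x)) (𝟙≤1 (t₂ j σ ≟ y))) (≤-reflexive (*-identityʳ _))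
      mismatch : ∀ j σ → x + y ≢ t₁ j σ + t₂ j σ → both j σ ≡ 0
      mismatch j σ ne with t₁ j σ ≟ x | t₂ j σ ≟ y
      ... | yes eq | yes eq′ = contradiction (sym (cong₂ _+_ eq eq′)) ne
      ... | yes _ | no _ = refl
      ... | no _ | _ = refl
      M-zero : x + y ≢ s → M ≡ 0
      M-zero ne = sum-zero λ j → sum-zero λ α → mismatch j (inj₁ α) λ eq → ne (trans eq (t₁+t₂ j (inj₁ α)))
      O-zero : x + y ≢ s′ → O ≡ 0
      O-zero ne = sum-zero λ j → sum-zero λ α → mismatch j (inj₂ α) λ eq → ne (trans eq (t₁+t₂ j (inj₂ α)))
      y≡ : ∀ {S} → x + y ≡ S → S ∸ x ≡ y
      y≡ refl = m+n∸m≡n x y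
      cases : M + O ≤ (N C x) * (N C y)
      -- As `s ≢ s′`, only one of the two sizes can contribute to a given type.
      cases with x + y ≟ s | x + y ≟ s′
      ... | yes eq | _ = begin
        M + O ≡⟨ trans (cong (M +_) (O-zero λ eq′ → s≢s′ (trans (sym eq) eq′))) (+-identityʳ M) ⟩
        M ≤⟨ sum-mono (λ j → sum-mono λ α → both≤ j (inj₁ α)) ⟩
        sum (λ j → occ x (Bm j)) ≤⟨ mid-count x (≤-trans (m≤m+n x y) (≤-reflexive eq)) ⟩
        w N s x ≡⟨ cong (λ z → (N C x) * (N C z)) (y≡ eq) ⟩
        (N C x) * (N C y) ∎
        where open ≤-Reasoning
      ... | no ne | yes eq = begin
        M + O ≡⟨ cong (_+ O) (M-zero ne) ⟩
        O ≤⟨ sum-mono (λ j → sum-mono λ α → both≤ j (inj₂ α)) ⟩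
        sum (λ j → occ x (Bo j)) ≤⟨ outer-count x (≤-trans (m≤m+n x y) (≤-reflexive eq)) ⟩
        w N s′ x ≡⟨ cong (λ z → (N C x) * (N C z)) (y≡ eq) ⟩
        (N C x) * (N C y) ∎
        where open ≤-Reasoning
      ... | no ne | no ne′ = ≤-trans (≤-reflexive (cong₂ _+_ (M-zero ne) (O-zero ne′))) z≤n

    -- Types of equal total are comparable only if equal. Both coordinates of a middle type are at
    -- least `um`, and an outer type has one below `uo ≤ um`, so it cannot dominate. If it were
    -- dominated, adding its small coordinate to the other one would give s′ < uo + (s - um),
    -- against `gap`.
    antichain : ∀ j σ j′ σ′ → t₁ j σ ≤ t₁ j′ σ′ → t₂ j σ ≤ t₂ j′ σ′ → t₁ j σ ≡ t₁ j′ σ′ × t₂ j σ ≡ t₂ j′ σ′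
    antichain j (inj₁ α) j′ (inj₁ α′) le₁ le₂ = eq , cong (s ∸_) eq
      where
      eq : Bm j α ≡ Bm j′ α′
      eq = ≤-antisym le₁ (∸-cancelʳ-≤ (mid≤s j′ α′) le₂)
    antichain j (inj₂ α) j′ (inj₂ α′) le₁ le₂ = eq , cong (s′ ∸_) eq
      where
      eq : Bo j α ≡ Bo j′ α′
      eq = ≤-antisym le₁ (∸-cancelʳ-≤ (proj₁ (outer j′ α′)) le₂)
    antichain j (inj₁ α) j′ (inj₂ α′) le₁ le₂ with proj₂ (outer j′ α′)
    ... | inj₁ z<uo = contradiction (≤-trans (proj₁ (mid j α)) le₁) (<⇒≱ (<-≤-trans z<uo uo≤um))
    ... | inj₂ z<uo = contradiction (≤-trans (m+n≤o⇒m≤o∸n um (subst (_≤ s) (+-comm _ um) (proj₂ (mid j α)))) le₂) (<⇒≱ (<-≤-trans z<uo uo≤um))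
    antichain j (inj₂ α) j′ (inj₁ α′) le₁ le₂ = contradiction gap (<⇒≱ (below (proj₂ (outer j α))))
      where
      open ≤-Reasoning
      x = Bm j′ α′
      z = Bo j α
      um≤s∸x : um ≤ s ∸ x
      um≤s∸x = m+n≤o⇒m≤o∸n um (subst (_≤ s) (+-comm x um) (proj₂ (mid j′ α′)))
      below : z < uo ⊎ s′ ∸ z < uo → s′ + um < s + uo
      below (inj₁ z<uo) = begin-strict
        s′ + um ≡⟨ cong (_+ um) (m+[n∸m]≡n (proj₁ (outer j α))) ⟨
        z + (s′ ∸ z) + um <⟨ +-mono-<-≤ (+-mono-<-≤ z<uo le₂) (proj₁ (mid j′ α′)) ⟩
        uo + (s ∸ x) + x ≡⟨ +-assoc uo (s ∸ x) x ⟩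
        uo + (s ∸ x + x) ≡⟨ cong (uo +_) (m∸n+n≡m (mid≤s j′ α′)) ⟩
        uo + s ≡⟨ +-comm uo s ⟩
        s + uo ∎
      below (inj₂ z<uo) = begin-strict
        s′ + um ≡⟨ cong (_+ um) (m+[n∸m]≡n (proj₁ (outer j α))) ⟨
        z + (s′ ∸ z) + um <⟨ +-mono-<-≤ (+-mono-≤-< le₁ z<uo) um≤s∸x ⟩
        x + uo + (s ∸ x) ≡⟨ cong (_+ (s ∸ x)) (+-comm x uo) ⟩
        uo + x + (s ∸ x) ≡⟨ +-assoc uo x (s ∸ x) ⟩
        uo + (x + (s ∸ x)) ≡⟨ cong (uo +_) (m+[n∸m]≡n (mid≤s j′ α′)) ⟩
        uo + s ≡⟨ +-comm uo s ⟩
        s + uo ∎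

  assemble : System (N + N) (a + b) p
  assemble = sperner-from-types N N (λ j → t₁ j ∘ splitAt a) (λ j → t₂ j ∘ splitAt a) rows₁ rows₂ counts
    (λ j α → positive j (splitAt a α)) (λ j α j′ α′ → antichain j (splitAt a α) j′ (splitAt a α′))

even-blocks : ∀ e₀ s f → (∀ x → x ≤ s → f (s ∸ x) ≡ f x) → ∀ lo m p → (∀ x → x < lo + m → x + x < s) →
  prefix f lo + suc e₀ * (p + m) ≤ prefix f (lo + m) →
  ∃ λ (B : Fin p → Block (suc e₀ + suc e₀)) →
    (∀ j → IsPair (suc e₀) s lo (lo + m) (B j)) × ∀ i → sum (λ j → occ i (B j)) ≤ f i
even-blocks e₀ s f symmetric lo m p half enough =
  bound (take-blocks p (pairs-All e₀ s f symmetric lo m) long)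
  where
  L = pairs e₀ s f symmetric lo m
  long : p ≤ length L
  long = +-cancelʳ-≤ m _ _ (*-cancelˡ-≤ (suc e₀) (+-cancelˡ-≤ (prefix f lo) _ _ (≤-trans enough (pairs-length e₀ s f symmetric lo m))))
  bound : (∃ λ (B : Fin p → Block (suc e₀ + suc e₀)) → (∀ j → IsPair (suc e₀) s lo (lo + m) (B j)) × ∀ i → sum (λ j → occ i (B j)) ≤ cnt i L) → _
  bound (B , good , count) = B , good , λ i → ≤-trans (count i) (proj₁ (pairs-cnt e₀ s f symmetric lo m half i))

pair-values : ∀ e s x α → pairBlock e x (s ∸ x) α ≡ x ⊎ pairBlock e x (s ∸ x) α ≡ s ∸ x
pair-values e s x α with splitAt e α
... | inj₁ _ = inj₁ refl
... | inj₂ _ = inj₂ refl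

pair-sum : ∀ e s {lo hi b} → (∀ x → x < hi → x + x < s) → IsPair e s lo hi b → 2 * sum b ≡ (e + e) * s
pair-sum e s half (x , _ , x<hi , refl) = trans (cong (2 *_) (trans (sum-pairBlock e x (s ∸ x) id) (cong (e *_) (m+[n∸m]≡n (≤-trans (m≤m+n x x) (<⇒≤ (half x x<hi)))))))
  (eq e s)
  where
  eq : ∀ e s → 2 * (e * s) ≡ (e + e) * s
  eq = solve-∀

centre-split : ∀ N h → (N + N) C (h + h) ≡ 2 * prefix (w N (h + h)) h + w N (h + h) h
centre-split N h = trans (sym (vandermonde N (h + h))) (trans (prefix-symmetric (w N (h + h)) (h + h) (w-symmetric N (h + h)) (suc h) h refl)
  (eq (prefix (w N (h + h)) h) (w N (h + h) h)))
  where
  eq : ∀ P x → P + x + P ≡ 2 * P + x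
  eq = solve-∀

-- Between the two symmetric tails lies one central value if `s` is even and two if it is odd.
halves-bound : ∀ N s h M → Halves s h → (∀ x → x ≤ s → w N s x ≤ M) → (N + N) C s ≤ 2 * prefix (w N s) h + 2 * M
halves-bound N s h M (inj₁ refl) w≤M = ≤-trans (≤-reflexive (centre-split N h))
  (+-monoʳ-≤ (2 * prefix (w N s) h) (≤-trans (w≤M h (m≤m+n h h)) (m≤m+n M _)))
halves-bound N s h M (inj₂ refl) w≤M = ≤-trans (≤-reflexive (trans (sym (vandermonde N s))
    (trans (prefix-symmetric (w N s) s (w-symmetric N s) (suc h) (suc h) (cong suc (+-suc h h))) (eq (prefix (w N s) h) (w N s h)))))
  (+-monoʳ-≤ (2 * prefix (w N s) h) (*-monoʳ-≤ 2 (w≤M h (≤-trans (m≤m+n h h) (n≤1+n _)))))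
  where
  eq : ∀ P x → P + x + (P + x) ≡ 2 * P + 2 * x
  eq = solve-∀

below-half : ∀ {s h} → Halves s h → ∀ x → x < h → x + x < s
below-half (inj₁ refl) x x<h = +-mono-< x<h x<h
below-half (inj₂ refl) x x<h = ≤-trans (+-mono-< x<h x<h) (n≤1+n _)

half≤ : ∀ {s h} → Halves s h → h ≤ s
half≤ {h = h} (inj₁ refl) = m≤m+n h h
half≤ {h = h} (inj₂ refl) = ≤-trans (m≤m+n h h) (n≤1+n _)

outer-blocks : ∀ N s h e₀ u p K → Halves s h → u ≤ h → u ≤ K →
  (suc e₀ + suc e₀) * (p + K) ≤ 2 * prefix (w N s) u →
  ∃ λ (B : Fin p → Block (suc e₀ + suc e₀)) → (∀ j α → B j α ≤ s × (B j α < u ⊎ s ∸ B j α < u)) ×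
    (∀ i → sum (λ j → occ i (B j)) ≤ w N s i) × ∀ j → 2 * sum (B j) ≡ (suc e₀ + suc e₀) * s
outer-blocks N s h e₀ u p K halves u≤h u≤K enough with even-blocks e₀ s (w N s) (w-symmetric N s) 0 u p half enough′
  where
  half : ∀ x → x < u → x + x < s
  half x x<u = below-half halves x (<-≤-trans x<u u≤h)
  enough′ : suc e₀ * (p + u) ≤ prefix (w N s) u
  enough′ = *-cancelˡ-≤ 2 (≤-trans (*-monoʳ-≤ 2 (*-monoʳ-≤ (suc e₀) (+-monoʳ-≤ p u≤K))) (≤-trans (≤-reflexive (eq (suc e₀) (p + K))) enough))
    where
    eq : ∀ e q → 2 * (e * q) ≡ (e + e) * q
    eq = solve-∀
... | B , good , count = B , (λ j α → value α (good j)) , count , λ j → pair-sum (suc e₀) s (λ x x<u → below-half halves x (<-≤-trans x<u u≤h)) (good j)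
  where
  value : ∀ {b} α → IsPair (suc e₀) s 0 u b → b α ≤ s × (b α < u ⊎ s ∸ b α < u)
  value α (x , _ , x<u , refl) with x≤s ← ≤-trans (<⇒≤ x<u) (≤-trans u≤h (half≤ halves)) | pair-values (suc e₀) s x α
  ... | inj₁ eq = subst (_≤ s) (sym eq) x≤s , inj₁ (subst (_< u) (sym eq) x<u)
  ... | inj₂ eq = subst (_≤ s) (sym eq) (m∸n≤m s x) , inj₂ (subst (_< u) (sym (trans (cong (s ∸_) eq) (m∸[m∸n]≡n x≤s))) x<u)

-- When a ≥ 2 classes of size s can be balanced between the halves: by pairs if a is even, and with one
-- additional triple if a is odd, which forces s to be even.
Shape : ℕ → ℕ → Set
Shape a s = (∃ λ e₀ → a ≡ suc e₀ + suc e₀) ⊎ (∃₂ λ e h → a ≡ 3 + (e + e) × s ≡ h + h)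

MidBlocks : (N s u a p : ℕ) → Set
MidBlocks N s u a p = ∃ λ (B : Fin p → Block a) → (∀ j α → u ≤ B j α × B j α + u ≤ s) ×
  (∀ i → i ≤ s → sum (λ j → occ i (B j)) ≤ w N s i) × ∀ j → 2 * sum (B j) ≡ a * s

-- Removing both tails below `u` leaves `(N + N) C s` minus `2 * prefix (w N s) u` sets. `K` pays
-- for the floors and `2 * M` for the central values that pairing skips.
mid-blocks : ∀ a s N u p K M → Shape a s → (∀ x → x ≤ s → w N s x ≤ M) → suc s * suc s ≤ K →
  2 * prefix (w N s) u + a * (p + K) + 2 * M ≤ (N + N) C s → MidBlocks N s u a p
mid-blocks a s N u p K M shape w≤M K≥ enough = build shape
  where
  open ≤-Reasoning
  f = w N s
  K>0 : 0 < K
  K>0 = ≤-trans (s≤s z≤n) K≥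
  -- A cut beyond the centre is impossible: the tails below it together with `2 * M` would already
  -- exhaust the level.
  centre : ∀ {h} → Halves s h → 0 < a → u ≤ h
  centre {h} halves a>0 with u ≤? h
  ... | yes u≤h = u≤h
  ... | no u≰h = contradiction enough (<⇒≱ (begin-strict
    (N + N) C s ≤⟨ halves-bound N s h M halves w≤M ⟩
    2 * prefix f h + 2 * M ≤⟨ +-monoˡ-≤ (2 * M) (*-monoʳ-≤ 2 (prefix-mono f (<⇒≤ (≰⇒> u≰h)))) ⟩
    2 * prefix f u + 2 * M ≡⟨ cong (_+ 2 * M) (+-identityʳ (2 * prefix f u)) ⟨
    2 * prefix f u + 0 + 2 * M <⟨ +-monoˡ-< (2 * M) (+-monoʳ-< (2 * prefix f u) (*-mono-< a>0 (<-≤-trans K>0 (m≤n+m K p)))) ⟩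
    2 * prefix f u + a * (p + K) + 2 * M ∎))
  build : Shape a s → MidBlocks N s u a p
  build (inj₁ (e₀ , refl)) with parity s
  ... | h , halves with even-blocks e₀ s f (w-symmetric N s) u (h ∸ u) p half enough′
    where
    u≤h = centre halves (s≤s z≤n)
    half : ∀ x → x < u + (h ∸ u) → x + x < s
    half x x< = below-half halves x (subst (x <_) (m+[n∸m]≡n u≤h) x<)
    enough′ : prefix f u + suc e₀ * (p + (h ∸ u)) ≤ prefix f (u + (h ∸ u))
    enough′ = *-cancelˡ-≤ 2 (+-cancelʳ-≤ (2 * M) _ _ (begin
      2 * (prefix f u + suc e₀ * (p + (h ∸ u))) + 2 * M
        ≤⟨ +-monoˡ-≤ (2 * M) (*-monoʳ-≤ 2 (+-monoʳ-≤ (prefix f u) (*-monoʳ-≤ (suc e₀) (+-monoʳ-≤ p len≤K)))) ⟩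
      2 * (prefix f u + suc e₀ * (p + K)) + 2 * M
        ≡⟨ eq (prefix f u) (suc e₀) (p + K) M ⟩
      2 * prefix f u + (suc e₀ + suc e₀) * (p + K) + 2 * M
        ≤⟨ enough ⟩
      (N + N) C s
        ≤⟨ halves-bound N s h M halves w≤M ⟩
      2 * prefix f h + 2 * M
        ≡⟨ cong (λ z → 2 * prefix f z + 2 * M) (m+[n∸m]≡n u≤h) ⟨
      2 * prefix f (u + (h ∸ u)) + 2 * M ∎))
      where
      len≤K : h ∸ u ≤ K
      len≤K = ≤-trans (m∸n≤m h u) (≤-trans (half≤ halves) (≤-trans (n≤1+n s) (≤-trans (m≤m*n (suc s) (suc s)) K≥)))
      eq : ∀ P e q M → 2 * (P + e * q) + 2 * M ≡ 2 * P + (e + e) * q + 2 * M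
      eq = solve-∀
  ... | B , good , count = B , (λ j α → value α (good j)) , (λ i _ → count i) , λ j → pair-sum (suc e₀) s half (good j)
    where
    u≤h = centre halves (s≤s z≤n)
    half : ∀ x → x < u + (h ∸ u) → x + x < s
    half x x< = below-half halves x (subst (x <_) (m+[n∸m]≡n u≤h) x<)
    value : ∀ {b} α → IsPair (suc e₀) s u (u + (h ∸ u)) b → u ≤ b α × b α + u ≤ s
    value α (x , u≤x , x< , refl) = cases (pair-values (suc e₀) s x α)
      where
      2x≤s : x + x ≤ s
      2x≤s = <⇒≤ (half x x<)
      x≤s : x ≤ s
      x≤s = ≤-trans (m≤m+n x x) 2x≤s
      cases : pairBlock (suc e₀) x (s ∸ x) α ≡ x ⊎ pairBlock (suc e₀) x (s ∸ x) α ≡ s ∸ x →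
              u ≤ pairBlock (suc e₀) x (s ∸ x) α × pairBlock (suc e₀) x (s ∸ x) α + u ≤ s
      cases (inj₁ eq) = subst (λ z → u ≤ z × z + u ≤ s) (sym eq) (u≤x , ≤-trans (+-monoʳ-≤ x u≤x) 2x≤s)
      cases (inj₂ eq) = subst (λ z → u ≤ z × z + u ≤ s) (sym eq)
        (≤-trans u≤x (m+n≤o⇒m≤o∸n x 2x≤s) , ≤-trans (+-monoʳ-≤ (s ∸ x) u≤x) (≤-reflexive (m∸n+n≡m x≤s)))
  -- Symmetry gives both values at distance `d` from `h` the weight `f (h ∸ d)`, and unimodality
  -- makes it decrease in `d`, as the peeling of layers requires.
  build (inj₂ (e , h , refl , refl)) = finish (centred-blocks e h (suc D) (s≤s (m∸n≤m h u)) (λ d → f (h ∸ d)) mono)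
    where
    u≤h : u ≤ h
    u≤h = centre (inj₁ refl) (s≤s z≤n)
    D = h ∸ u
    mono : ∀ d d′ → d ≤ d′ → d′ < suc D → f (h ∸ d′) ≤ f (h ∸ d)
    mono d d′ d≤d′ d′<D = subst (λ z → f (h ∸ d′) ≤ f z) shift (w-unimodal N h (h ∸ d′) (d′ ∸ d) (≤-trans (≤-reflexive shift) (m∸n≤m h d)))
      where
      shift : h ∸ d′ + (d′ ∸ d) ≡ h ∸ d
      shift = trans (sym (+-∸-assoc (h ∸ d′) d≤d′)) (cong (_∸ d) (m∸n+n≡m (≤-trans (≤-pred d′<D) (m∸n≤m h u))))
    finish : (∃ λ L → All (CentredBlock e h (suc D)) L × (∀ i → ∣ i - h ∣ < suc D → cnt i L ≤ f (h ∸ ∣ i - h ∣)) ×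
      prefix (λ d → κ d * f (h ∸ d)) (suc D) ≤ (3 + (e + e)) * (length L + suc D * suc D)) → MidBlocks N s u a p
    finish (L , good , count , len) = extract (take-blocks p good long)
      where
      long : p ≤ length L
      long = +-cancelʳ-≤ K _ _ (*-cancelˡ-≤ a (+-cancelˡ-≤ (2 * prefix f u) _ _ (begin
        2 * prefix f u + a * (p + K)
          ≤⟨ m≤m+n _ (2 * M) ⟩
        2 * prefix f u + a * (p + K) + 2 * M
          ≤⟨ enough ⟩
        (N + N) C (h + h)
          ≡⟨ centre-split N h ⟩
        2 * prefix f h + f h
          ≡⟨ prefix-κ-centre f h D (m∸n≤m h u) ⟩
        2 * prefix f (h ∸ D) + prefix (λ d → κ d * f (h ∸ d)) (suc D)
          ≤⟨ +-mono-≤ (≤-reflexive (cong (λ z → 2 * prefix f z) (m∸[m∸n]≡n u≤h))) len ⟩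
        2 * prefix f u + a * (length L + suc D * suc D)
          ≤⟨ +-monoʳ-≤ (2 * prefix f u) (*-monoʳ-≤ a (+-monoʳ-≤ (length L) (≤-trans (*-mono-≤ D≤ D≤) K≥))) ⟩
        2 * prefix f u + a * (length L + K) ∎)))
        where
        D≤ : suc D ≤ suc s
        D≤ = s≤s (≤-trans (m∸n≤m h u) (m≤m+n h h))
      extract : (∃ λ (B : Fin p → Block a) → (∀ j → CentredBlock e h (suc D) (B j)) × ∀ i → sum (λ j → occ i (B j)) ≤ cnt i L) → MidBlocks N s u a p
      extract (B , good′ , count′) = B , (λ j α → near (B j α) (≤-pred (proj₁ (good′ j) α))) ,
        (λ i i≤s → ≤-trans (count′ i) (bound i i≤s)) , λ j → trans (cong (2 *_) (proj₂ (good′ j))) (eq (3 + (e + e)) h)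
        where
        eq : ∀ a h → 2 * (a * h) ≡ a * (h + h)
        eq = solve-∀
        near : ∀ x → ∣ x - h ∣ ≤ D → u ≤ x × x + u ≤ h + h
        near x dist = +-cancelʳ-≤ D _ _ (≤-trans (≤-reflexive (m+[n∸m]≡n u≤h)) (≤-trans (m≤n+∣n-m∣ h x) (+-monoʳ-≤ x dist))) ,
          ≤-trans (+-monoˡ-≤ u (≤-trans (m≤n+∣m-n∣ x h) (+-monoʳ-≤ h dist))) (≤-reflexive (trans (+-assoc h D u) (cong (h +_) (m∸n+n≡m u≤h))))
        bound : ∀ i → i ≤ s → cnt i L ≤ f i
        bound i i≤s with ∣ i - h ∣ <? suc D
        ... | no far = ≤-trans (≤-reflexive (cnt-zero i (All.map (λ { (near′ , _) α refl → far (near′ α) }) good))) z≤n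
        ... | yes close = ≤-trans (count i close) (≤-reflexive (reflect (≤-total i h)))
          where
          reflect : i ≤ h ⊎ h ≤ i → f (h ∸ ∣ i - h ∣) ≡ f i
          reflect (inj₁ i≤h) = cong f (trans (cong (h ∸_) (m≤n⇒∣m-n∣≡n∸m i≤h)) (m∸[m∸n]≡n i≤h))
          reflect (inj₂ h≤i) = trans (cong f (trans (cong (h ∸_) (m≤n⇒∣n-m∣≡n∸m h≤i)) flip)) (w-symmetric N (h + h) i i≤s)
            where
            flip : h ∸ (i ∸ h) ≡ h + h ∸ i
            flip = trans (sym ([m+n]∸[m+o]≡n∸o h h (i ∸ h))) (cong (h + h ∸_) (m+[n∸m]≡n h≤i))

-- One further value adds at most `2 * M`, so stopping at the first sufficient `u` overshoots `X` by
-- no more than that.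
least-prefix : ∀ (f : ℕ → ℕ) X M h → (∀ x → x < h → f x ≤ M) → X ≤ 2 * prefix f h →
  ∃ λ u → u ≤ h × X ≤ 2 * prefix f u × 2 * prefix f u ≤ X + 2 * M
least-prefix f X M zero _ X≤ = 0 , z≤n , X≤ , z≤n
least-prefix f X M (suc h) f≤M X≤ with X ≤? 2 * prefix f h
... | yes X≤′ = let (u , u≤h , lower , upper) = least-prefix f X M h (λ x x<h → f≤M x (m<n⇒m<1+n x<h)) X≤′
                in u , m≤n⇒m≤1+n u≤h , lower , upper
... | no X≰ = suc h , ≤-refl , X≤ , (begin
    2 * (prefix f h + f h) ≡⟨ *-distribˡ-+ 2 (prefix f h) (f h) ⟩
    2 * prefix f h + 2 * f h ≤⟨ +-mono-≤ (<⇒≤ (≰⇒> X≰)) (*-monoʳ-≤ 2 (f≤M h (n<1+n h))) ⟩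
    X + 2 * M ∎)
  where open ≤-Reasoning

-- φ and φ′ are the weights for which a full level of either size has the same mass Λ; the
-- middle sizes are packed around s / 2 and the outer ones start from the smallest u that suffices.
construct : ∀ N a e₀ s s′ p K φ φ′ Λ Ω → let b = suc e₀ + suc e₀ in
  Shape a s → a * s + b * s′ ≡ N + N → s ≢ s′ → 0 < s → 0 < s′ → 0 < φ → 0 < φ′ →
  φ * ((N + N) C s) ≡ Λ → φ′ * ((N + N) C s′) ≡ Λ →
  (∀ x → x ≤ s → φ * w N s x ≤ Ω) → (∀ x → x ≤ s′ → φ′ * w N s′ x ≤ Ω) →
  (∀ uo → uo ≤ s′ → ∃ λ um → uo ≤ um × s + uo ≤ s′ + um × φ * prefix (w N s) um ≤ φ′ * prefix (w N s′) uo + Ω) →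
  suc s * suc s ≤ K → s′ ≤ K → (a * φ + b * φ′) * (p + K) + 6 * Ω ≤ Λ →
  System (N + N) (a + b) p
construct N a e₀ s s′ p K φ φ′ Λ Ω shape total s≢s′ s>0 s′>0 φ>0 φ′>0 φT φ′T′ small small′ shadow K≥ s′≤K enough =
  choose (parity s′)
  where
  open ≤-Reasoning
  instance
    φ≢0 : NonZero φ
    φ≢0 = >-nonZero φ>0
    φ′≢0 : NonZero φ′
    φ′≢0 = >-nonZero φ′>0
  b = suc e₀ + suc e₀
  X = b * (p + K)
  M = Ω / φ
  M′ = Ω / φ′
  quotient-bound : ∀ ψ .{{_ : NonZero ψ}} x → ψ * x ≤ Ω → x ≤ Ω / ψ
  quotient-bound ψ x le = ≤-trans (≤-reflexive (sym (m*n/n≡m x ψ))) (/-monoˡ-≤ ψ (≤-trans (≤-reflexive (*-comm x ψ)) le))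
  φM≤Ω : φ * M ≤ Ω
  φM≤Ω = ≤-trans (≤-reflexive (*-comm φ M)) (m/n*n≤m Ω φ)
  φ′M′≤Ω : φ′ * M′ ≤ Ω
  φ′M′≤Ω = ≤-trans (≤-reflexive (*-comm φ′ M′)) (m/n*n≤m Ω φ′)
  w≤M : ∀ x → x ≤ s → w N s x ≤ M
  w≤M x x≤s = quotient-bound φ (w N s x) (small x x≤s)
  w′≤M′ : ∀ x → x ≤ s′ → w N s′ x ≤ M′
  w′≤M′ x x≤s′ = quotient-bound φ′ (w N s′ x) (small′ x x≤s′)
  choose : (∃ λ h → Halves s′ h) → System (N + N) (a + b) p
  choose (h , halves) = search (least-prefix (w N s′) X M′ h (λ x x<h → w′≤M′ x (≤-trans (<⇒≤ x<h) (half≤ halves))) X≤)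
    where
    X≤ : X ≤ 2 * prefix (w N s′) h
    X≤ = *-cancelˡ-≤ φ′ (+-cancelʳ-≤ (2 * (φ′ * M′)) _ _ (begin
      φ′ * X + 2 * (φ′ * M′) ≤⟨ +-monoʳ-≤ (φ′ * X) (*-monoʳ-≤ 2 φ′M′≤Ω) ⟩
      φ′ * X + 2 * Ω ≤⟨ ≤-trans (m≤m+n _ (a * φ * (p + K) + 4 * Ω)) (≤-reflexive (eq₁ φ′ b a φ (p + K) Ω)) ⟩
      (a * φ + b * φ′) * (p + K) + 6 * Ω ≤⟨ enough ⟩
      Λ ≡⟨ φ′T′ ⟨
      φ′ * ((N + N) C s′) ≤⟨ *-monoʳ-≤ φ′ (halves-bound N s′ h M′ halves w′≤M′) ⟩
      φ′ * (2 * prefix (w N s′) h + 2 * M′) ≡⟨ eq₂ φ′ (2 * prefix (w N s′) h) M′ ⟩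
      φ′ * (2 * prefix (w N s′) h) + 2 * (φ′ * M′) ∎))
      where
      eq₁ : ∀ f b a g q O → f * (b * q) + 2 * O + (a * g * q + 4 * O) ≡ (a * g + b * f) * q + 6 * O
      eq₁ = solve-∀
      eq₂ : ∀ f P M → f * (P + 2 * M) ≡ f * P + 2 * (f * M)
      eq₂ = solve-∀
    search : (∃ λ u → u ≤ h × X ≤ 2 * prefix (w N s′) u × 2 * prefix (w N s′) u ≤ X + 2 * M′) → System (N + N) (a + b) p
    search (uo , uo≤h , lower , upper) = combine-blocks (shadow uo uo≤s′)
      (outer-blocks N s′ h e₀ uo p K halves uo≤h (≤-trans uo≤s′ s′≤K) lower)
      where
      uo≤s′ : uo ≤ s′
      uo≤s′ = ≤-trans uo≤h (half≤ halves)
      combine-blocks : (∃ λ um → uo ≤ um × s + uo ≤ s′ + um × φ * prefix (w N s) um ≤ φ′ * prefix (w N s′) uo + Ω) →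
        (∃ λ (B : Fin p → Block b) → (∀ j α → B j α ≤ s′ × (B j α < uo ⊎ s′ ∸ B j α < uo)) ×
          (∀ i → sum (λ j → occ i (B j)) ≤ w N s′ i) × ∀ j → 2 * sum (B j) ≡ b * s′) →
        System (N + N) (a + b) p
      combine-blocks (um , uo≤um , gap , shadow≤) (Bo , outer , outer-count , outer-sum) =
        use-mid (mid-blocks a s N um p K M shape w≤M K≥ mid-enough)
        where
        -- The budget `6 * Ω` is spent in three equal parts: the shadow error of both tails, the
        -- overshoot of the outer cut, and the central values of the middle size.
        mid-enough : 2 * prefix (w N s) um + a * (p + K) + 2 * M ≤ (N + N) C s
        mid-enough = *-cancelˡ-≤ φ (begin
          φ * (2 * P + a * (p + K) + 2 * M) ≡⟨ eq₁ φ P (a * (p + K)) M ⟩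
          2 * (φ * P) + φ * (a * (p + K)) + 2 * (φ * M) ≤⟨ +-mono-≤ (+-monoˡ-≤ (φ * (a * (p + K))) (*-monoʳ-≤ 2 shadow≤)) (*-monoʳ-≤ 2 φM≤Ω) ⟩
          2 * (φ′ * P′ + Ω) + φ * (a * (p + K)) + 2 * Ω ≡⟨ eq₂ φ′ P′ Ω (φ * (a * (p + K))) ⟩
          φ′ * (2 * P′) + 4 * Ω + φ * (a * (p + K)) ≤⟨ +-monoˡ-≤ (φ * (a * (p + K))) (+-monoˡ-≤ (4 * Ω) (*-monoʳ-≤ φ′ upper)) ⟩
          φ′ * (X + 2 * M′) + 4 * Ω + φ * (a * (p + K)) ≡⟨ eq₃ φ′ b (p + K) M′ Ω φ a ⟩
          (a * φ + b * φ′) * (p + K) + (2 * (φ′ * M′) + 4 * Ω) ≤⟨ +-monoʳ-≤ ((a * φ + b * φ′) * (p + K)) (+-monoˡ-≤ (4 * Ω) (*-monoʳ-≤ 2 φ′M′≤Ω)) ⟩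
          (a * φ + b * φ′) * (p + K) + (2 * Ω + 4 * Ω) ≡⟨ cong ((a * φ + b * φ′) * (p + K) +_) (*-distribʳ-+ Ω 2 4) ⟨
          (a * φ + b * φ′) * (p + K) + 6 * Ω ≤⟨ enough ⟩
          Λ ≡⟨ φT ⟨
          φ * ((N + N) C s) ∎)
          where
          P = prefix (w N s) um
          P′ = prefix (w N s′) uo
          eq₁ : ∀ f P q M → f * (2 * P + q + 2 * M) ≡ 2 * (f * P) + f * q + 2 * (f * M)
          eq₁ = solve-∀
          eq₂ : ∀ f P O q → 2 * (f * P + O) + q + 2 * O ≡ f * (2 * P) + 4 * O + q
          eq₂ = solve-∀
          eq₃ : ∀ f b q M O g a → f * (b * q + 2 * M) + 4 * O + g * (a * q) ≡ (a * g + b * f) * q + (2 * (f * M) + 4 * O)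
          eq₃ = solve-∀
        use-mid : MidBlocks N s um a p → System (N + N) (a + b) p
        use-mid (Bm , mid , mid-count , mid-sum) =
          assemble Bm Bo mid outer mid-count (λ i _ → outer-count i) sums total uo≤um gap s≢s′ s>0 s′>0
          where
          sums : ∀ j → sum (Bm j) + sum (Bo j) ≡ N
          sums j = *-cancelˡ-≡ _ _ 2 (trans (*-distribˡ-+ 2 (sum (Bm j)) (sum (Bo j)))
            (trans (cong₂ _+_ (mid-sum j) (outer-sum j)) (trans total (cong (N +_) (sym (+-identityʳ N))))))

-- Lower bounds

odd≢even : ∀ x y → suc (x + x) ≢ y + y
odd≢even x y eq = even≢odd y x (trans (cong (y +_) (+-identityʳ y)) (trans (sym eq) (cong suc (cong (x +_) (sym (+-identityʳ x))))))

module _ (N c d p Ω : ℕ) (n≡ : N + N ≡ suc (c + d)) (c>0 : 0 < c)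
  (small₀ : ∀ x → x ≤ c → suc d * w N c x ≤ Ω) (small₁ : ∀ x → x ≤ suc c → suc c * w N (suc c) x ≤ Ω)
  where

  private
    n-c : N + N ≡ suc d + c
    n-c = trans n≡ (cong suc (+-comm c d))

    Λ = suc d * ((N + N) C c)

    -- Counts the inclusions of a c-set in a (c + 1)-set from both ends. Hence `suc d` and `suc c`
    -- are the weights that give both levels the mass `Λ`.
    Λ≡ : suc c * ((N + N) C suc c) ≡ Λ
    Λ≡ = +-cancelʳ-≡ (c * ((N + N) C c)) _ _ (trans (ascend (N + N) c)
      (trans (cong (_* ((N + N) C c)) n-c) (*-distribʳ-+ ((N + N) C c) (suc d) c)))

    shadow : ∀ t → t ≤ suc c → suc d * prefix (w N c) t ≡ suc c * prefix (w N (suc c)) t + t * w N (suc c) t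
    shadow t t≤ = +-cancelʳ-≡ (c * prefix (w N c) t) _ _ (trans (sym (*-distribʳ-+ (prefix (w N c) t) (suc d) c))
      (trans (cong (_* prefix (w N c) t) (sym n-c)) (shadow-identity N c t t≤)))

    K≥₀ : suc c * suc c ≤ (c + 2) * (c + 2)
    K≥₀ = *-mono-≤ le le
      where
      le : suc c ≤ c + 2
      le = ≤-trans (n≤1+n (suc c)) (≤-reflexive (+-comm 2 c))

    K≥₁ : suc (suc c) * suc (suc c) ≤ (c + 2) * (c + 2)
    K≥₁ = ≤-reflexive (cong (λ z → z * z) (+-comm 2 c))

    suc-c≤K : suc c ≤ (c + 2) * (c + 2)
    suc-c≤K = ≤-trans (m≤m*n (suc c) (suc c)) K≥₀

  -- An outer set is now one point smaller than a middle set, so the middle has to start at `suc uo`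
  -- to prevent containment; the additional value costs at most `Ω`.
  mid-large : ∀ r e₀ → Shape r (suc c) → r * suc c + (suc e₀ + suc e₀) * c ≡ N + N →
    ((suc e₀ + suc e₀) * suc d + r * suc c) * (p + (c + 2) * (c + 2)) + 6 * Ω ≤ Λ → System (N + N) (r + (suc e₀ + suc e₀)) p
  mid-large r e₀ shape total enough = construct N r e₀ (suc c) c p ((c + 2) * (c + 2)) (suc c) (suc d) Λ Ω
    shape total (λ eq → <-irrefl (sym eq) (n<1+n c)) (s≤s z≤n) c>0 (s≤s z≤n) (s≤s z≤n) Λ≡ refl small₁ small₀
    (λ uo uo≤c → suc uo , n≤1+n uo , ≤-reflexive (sym (+-suc c uo)) , bound uo uo≤c)
    K≥₁ (≤-trans (n≤1+n c) suc-c≤K)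
    (≤-trans (≤-reflexive (cong (λ z → z * (p + (c + 2) * (c + 2)) + 6 * Ω) (+-comm (r * suc c) _))) enough)
    where
    open ≤-Reasoning
    bound : ∀ u → u ≤ c → suc c * (prefix (w N (suc c)) u + w N (suc c) u) ≤ suc d * prefix (w N c) u + Ω
    bound u u≤c = begin
      suc c * (P′ + x) ≡⟨ *-distribˡ-+ (suc c) P′ x ⟩
      suc c * P′ + suc c * x ≤⟨ +-mono-≤ (m≤m+n (suc c * P′) (u * x)) (small₁ u (m≤n⇒m≤1+n u≤c)) ⟩
      suc c * P′ + u * x + Ω ≡⟨ cong (_+ Ω) (shadow u (m≤n⇒m≤1+n u≤c)) ⟨
      suc d * prefix (w N c) u + Ω ∎
      where
      P′ = prefix (w N (suc c)) u
      x = w N (suc c) u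

  -- With the larger size outside, both cuts can coincide. The boundary term of the shadow identity
  -- is then the only error, at most `Ω`.
  mid-small : ∀ a e₀ → Shape a c → a * c + (suc e₀ + suc e₀) * suc c ≡ N + N →
    (a * suc d + (suc e₀ + suc e₀) * suc c) * (p + (c + 2) * (c + 2)) + 6 * Ω ≤ Λ → System (N + N) (a + (suc e₀ + suc e₀)) p
  mid-small a e₀ shape total enough = construct N a e₀ c (suc c) p ((c + 2) * (c + 2)) (suc d) (suc c) Λ Ω
    shape total (λ eq → <-irrefl eq (n<1+n c)) c>0 (s≤s z≤n) (s≤s z≤n) (s≤s z≤n) refl Λ≡ small₀ small₁
    (λ uo uo≤ → uo , ≤-refl , n≤1+n (c + uo) , ≤-trans (≤-reflexive (shadow uo uo≤))
      (+-monoʳ-≤ (suc c * prefix (w N (suc c)) uo) (≤-trans (*-monoˡ-≤ (w N (suc c) uo) uo≤) (small₁ uo uo≤))))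
    K≥₀ suc-c≤K enough

  -- Since n is even, r and k - r are not both odd. The sizes occurring an even number of times
  -- can serve as outer sizes; an odd multiplicity forces the corresponding size to be even.
  even-system : ∀ k r → N + N ≡ c * k + r → 2 ≤ r → r + 2 ≤ k →
    ((k ∸ r) * suc d + r * suc c) * (p + (c + 2) * (c + 2)) + 6 * Ω ≤ Λ → System (N + N) k p
  even-system k r n≡ck+r 2≤r r+2≤k enough = subst (λ z → System (N + N) z p) (m+[n∸m]≡n r≤k) (split (k ∸ r) (parity (k ∸ r)) 2≤k-r k≡ enough)
    where
    r≤k : r ≤ k
    r≤k = ≤-trans (m≤m+n r 2) r+2≤k
    2≤k-r : 2 ≤ k ∸ r
    2≤k-r = m+n≤o⇒m≤o∸n 2 (subst (_≤ k) (+-comm r 2) r+2≤k)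
    k≡ : N + N ≡ c * (r + (k ∸ r)) + r
    k≡ = trans n≡ck+r (cong (λ z → c * z + r) (sym (m+[n∸m]≡n r≤k)))
    split : ∀ m → (∃ λ h → Halves m h) → 2 ≤ m → N + N ≡ c * (r + m) + r →
      (m * suc d + r * suc c) * (p + (c + 2) * (c + 2)) + 6 * Ω ≤ Λ → System (N + N) (r + m) p
    split m (zero , inj₁ refl) () _ _
    split m (suc e₀ , inj₁ refl) _ eq enough = mid-large r e₀ (shape (parity r)) (trans (sym (eq₁ c r (suc e₀))) (sym eq)) enough
      where
      eq₁ : ∀ c r e → c * (r + (e + e)) + r ≡ r * suc c + (e + e) * c
      eq₁ = solve-∀
      shape : (∃ λ h → Halves r h) → Shape r (suc c)
      shape (zero , inj₁ r≡) = contradiction (subst (2 ≤_) r≡ 2≤r) λ ()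
      shape (suc h , inj₁ r≡) = inj₁ (h , r≡)
      shape (zero , inj₂ r≡) = contradiction (subst (2 ≤_) r≡ 2≤r) λ { (s≤s ()) }
      shape (suc h , inj₂ r≡) with parity c
      ... | g , inj₂ c≡ = inj₂ (h , suc g , trans r≡ (cong (2 +_) (+-suc h h)) , trans (cong suc c≡) (cong suc (sym (+-suc g g))))
      -- With `c` even and `r` odd, c k + r would be odd.
      ... | g , inj₁ c≡ = contradiction (trans (sym (eq₂ g (r + (suc e₀ + suc e₀)) (suc h))) (trans (cong₂ (λ x y → x * (r + (suc e₀ + suc e₀)) + y) (sym c≡) (sym r≡)) (sym eq))) (odd≢even (g * (r + (suc e₀ + suc e₀)) + suc h) N)
        where
        eq₂ : ∀ g k h → (g + g) * k + suc (h + h) ≡ suc (g * k + h + (g * k + h))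
        eq₂ = solve-∀
    split m (zero , inj₂ refl) (s≤s ()) _ _
    split m (suc e , inj₂ refl) _ eq enough = outer (parity r)
      where
      outer : (∃ λ h → Halves r h) → System (N + N) (r + suc (suc e + suc e)) p
      -- With `r` and k - r both odd, k is even and c k + r would be odd.
      outer (h , inj₂ r≡) = contradiction (trans (sym (eq₂ c h (suc e))) (trans (cong (λ z → c * (z + suc (suc e + suc e)) + z) (sym r≡)) (sym eq))) (odd≢even (c * suc (h + suc e) + h) N)
        where
        eq₂ : ∀ c h e → c * (suc (h + h) + suc (e + e)) + suc (h + h) ≡ suc (c * suc (h + e) + h + (c * suc (h + e) + h))
        eq₂ = solve-∀
      outer (zero , inj₁ r≡) = contradiction (subst (2 ≤_) r≡ 2≤r) λ ()
      outer (suc h , inj₁ refl) = subst (λ z → System (N + N) z p) (+-comm m′ _)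
        (mid-small m′ h (inj₂ (shape (parity c))) (trans (sym (eq₁ c (suc h + suc h) m′)) (sym eq)) enough)
        where
        m′ = suc (suc e + suc e)
        eq₁ : ∀ c r m → c * (r + m) + r ≡ m * c + r * suc c
        eq₁ = solve-∀
        shape : (∃ λ g → Halves c g) → ∃₂ λ e g → m′ ≡ 3 + (e + e) × c ≡ g + g
        shape (g , inj₁ c≡) = e , g , cong (2 +_) (+-suc e e) , c≡
        -- With `r` even and k - r odd, k is odd, so an odd `c` would make c k + r odd.
        shape (g , inj₂ c≡) = contradiction (trans (sym (eq₃ g (suc h) (suc e))) (trans (cong (λ z → z * (suc h + suc h + m′) + (suc h + suc h)) (sym c≡)) (sym eq))) (odd≢even (g * (suc h + suc h + m′) + suc h + suc e + suc h) N)
          where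
          eq₃ : ∀ g h e → suc (g + g) * (h + h + suc (e + e)) + (h + h) ≡ suc ((g * (h + h + suc (e + e)) + h + e + h) + (g * (h + h + suc (e + e)) + h + e + h))
          eq₃ = solve-∀

-- Near-optimal systems for an even ground set

power≤choose : ∀ c n k → c * k ≤ n → k ^ c ≤ n C c
power≤choose zero n k _ = ≤-reflexive (sym (nC0≡1 n))
power≤choose (suc c) n zero _ = z≤n
power≤choose (suc c) (suc n) (suc k) ck≤n = *-cancelˡ-≤ (suc c) (begin
  suc c * (suc k * suc k ^ c) ≡⟨ *-assoc (suc c) (suc k) (suc k ^ c) ⟨
  suc c * suc k * suc k ^ c ≤⟨ *-mono-≤ ck≤n (power≤choose c n (suc k) (≤-trans (m≤n+m (c * suc k) k) (≤-pred ck≤n))) ⟩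
  suc n * (n C c) ≡⟨ absorption n c ⟨
  suc c * (suc n C suc c) ∎)
  where open ≤-Reasoning

cube≤exponential : ∀ c → (c + 5) * (c + 5) * (c + 5) ≤ 125 * 2 ^ c
cube≤exponential zero = ≤-refl
cube≤exponential (suc c) = begin
  (suc c + 5) * (suc c + 5) * (suc c + 5) ≤⟨ ≤-trans (m≤m+n _ (c * c * c + 12 * (c * c) + 42 * c + 34)) (≤-reflexive (eq c)) ⟩
  2 * ((c + 5) * (c + 5) * (c + 5)) ≤⟨ *-monoʳ-≤ 2 (cube≤exponential c) ⟩
  2 * (125 * 2 ^ c) ≡⟨ eq₂ (2 ^ c) ⟩
  125 * (2 * 2 ^ c) ∎
  where
  open ≤-Reasoning
  eq : ∀ c → (suc c + 5) * (suc c + 5) * (suc c + 5) + (c * c * c + 12 * (c * c) + 42 * c + 34) ≡ 2 * ((c + 5) * (c + 5) * (c + 5))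
  eq = solve-∀
  eq₂ : ∀ x → 2 * (125 * x) ≡ 125 * (2 * x)
  eq₂ = solve-∀

mass : ℕ → ℕ → ℕ
mass n c = (n ∸ c) * (n C c)

cost : ℕ → ℕ → ℕ → ℕ → ℕ
cost n k c r = (k ∸ r) * (n ∸ c) + r * suc c

-- MMS (n, k) is the quotient of mass by cost.
NearOptimal : ℕ → ℕ → ℕ → ℕ → ℕ → Set
NearOptimal q n k c r = ∃ λ p → System n k p × q * mass n c ≤ suc q * (p * cost n k c r)

-- Unfolding the unary constant 36864 in conversion checks is prohibitively expensive.
opaque
  threshold : ℕ → ℕ
  threshold q = 36864 * (suc q * suc q)

  threshold≡ : ∀ q → threshold q ≡ 36864 * (suc q * suc q)
  threshold≡ q = refl

threshold>0 : ∀ q → 0 < threshold q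
threshold>0 q = subst (0 <_) (sym (threshold≡ q)) (≤-trans (m≤m+n 1 36863) (m≤m*n 36864 (suc q * suc q)))

complement-of-sum : ∀ {n c d} → n ≡ suc (c + d) → n ∸ c ≡ suc d
complement-of-sum {n} {c} {d} eq = trans (cong (_∸ c) (trans eq (sym (+-suc c d)))) (m+n∸m≡n c (suc d))

-- The loss permitted is Λ / (q + 1). One half covers the type errors `6 * Ω`, small because single
-- types have small share; the other covers `suc K` further partitions, negligible because `K` is
-- quadratic in `c` and the level exponential.
near-optimal-even : ∀ q N c d k r → N + N ≡ suc (c + d) → N + N ≡ c * k + r → 2 ≤ r → r + 2 ≤ k → threshold q ≤ c →
  NearOptimal q (N + N) k c r
near-optimal-even q N c d k r n≡ n≡ck+r 2≤r r+2≤k q≤c = p ,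
  even-system N c d p Ω n≡ c>0 small₀ small₁ k r n≡ck+r 2≤r r+2≤k enough ,
  subst (λ z → q * (z * T) ≤ suc q * (p * ((k ∸ r) * z + r * suc c))) (sym (complement-of-sum n≡)) near
  where
  open ≤-Reasoning
  -- Then `6 * Ω` is at most Λ / (2 (q + 1)). `small-types` asks for `256 * (Q * Q) ≤ c`, which is
  -- the origin of 36864 = 256 * 144.
  Q = 12 * suc q
  T = (N + N) C c
  Λ = suc d * T
  D = (k ∸ r) * suc d + r * suc c
  K = (c + 2) * (c + 2)
  Ω = Λ / Q
  r≤k : r ≤ k
  r≤k = ≤-trans (m≤m+n r 2) r+2≤k
  4≤k : 4 ≤ k
  4≤k = ≤-trans (+-monoˡ-≤ 2 2≤r) r+2≤k
  q≤c′ : 36864 * (suc q * suc q) ≤ c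
  q≤c′ = subst (_≤ c) (threshold≡ q) q≤c
  2≤c : 2 ≤ c
  2≤c = ≤-trans (≤-trans (m≤m+n 2 36862) (m≤m*n 36864 (suc q * suc q))) q≤c′
  c>0 : 0 < c
  c>0 = ≤-trans (s≤s z≤n) 2≤c
  4c≤n : 4 * c ≤ N + N
  4c≤n = ≤-trans (≤-reflexive (*-comm 4 c)) (≤-trans (*-monoʳ-≤ c 4≤k) (≤-trans (m≤m+n (c * k) r) (≤-reflexive (sym n≡ck+r))))
  2c≤N : 2 * c ≤ N
  2c≤N = *-cancelˡ-≤ 2 (≤-trans (≤-reflexive (sym (*-assoc 2 2 c))) (≤-trans 4c≤n (≤-reflexive (cong (N +_) (sym (+-identityʳ N))))))
  4sc≤3N : 4 * suc c ≤ 3 * N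
  4sc≤3N = begin
    4 * suc c ≡⟨ eq c ⟩
    4 * c + 2 * 2 ≤⟨ +-monoʳ-≤ (4 * c) (*-monoʳ-≤ 2 2≤c) ⟩
    4 * c + 2 * c ≡⟨ eq₂ c ⟩
    3 * (2 * c) ≤⟨ *-monoʳ-≤ 3 2c≤N ⟩
    3 * N ∎
    where
    eq : ∀ c → 4 * suc c ≡ 4 * c + 2 * 2
    eq = solve-∀
    eq₂ : ∀ c → 4 * c + 2 * c ≡ 3 * (2 * c)
    eq₂ = solve-∀
  c≤d : c ≤ d
  c≤d = +-cancelˡ-≤ c _ _ (≤-pred (begin
    suc (c + c) ≤⟨ +-monoˡ-≤ (c + c) c>0 ⟩
    c + (c + c) ≤⟨ m≤m+n (c + (c + c)) c ⟩
    c + (c + c) + c ≡⟨ eq c ⟩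
    4 * c ≤⟨ 4c≤n ⟩
    N + N ≡⟨ n≡ ⟩
    suc (c + d) ∎))
    where
    eq : ∀ c → c + (c + c) + c ≡ 4 * c
    eq = solve-∀
  Q²≤c : 256 * (Q * Q) ≤ c
  Q²≤c = ≤-trans (≤-reflexive (eq (suc q))) q≤c′
    where
    eq : ∀ x → 256 * (12 * x * (12 * x)) ≡ 36864 * (x * x)
    eq = solve-∀
  Λ≡ : suc c * ((N + N) C suc c) ≡ Λ
  Λ≡ = +-cancelʳ-≡ (c * T) _ _ (trans (ascend (N + N) c) (trans (cong (_* T) (trans n≡ (cong suc (+-comm c d)))) (*-distribʳ-+ T (suc d) c)))
  divide : ∀ x → Q * x ≤ Λ → x ≤ Ω
  divide x le = ≤-trans (≤-reflexive (sym (m*n/n≡m x Q))) (/-monoˡ-≤ Q (≤-trans (≤-reflexive (*-comm x Q)) le))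
  small₀ : ∀ x → x ≤ c → suc d * w N c x ≤ Ω
  small₀ x x≤ = divide _ (≤-trans (≤-reflexive (x∙yz≈y∙xz Q (suc d) (w N c x)))
    (*-monoʳ-≤ (suc d) (small-types Q N c x Q²≤c c>0 (≤-trans (*-monoʳ-≤ 4 (n≤1+n c)) 4sc≤3N) x≤)))
  small₁ : ∀ x → x ≤ suc c → suc c * w N (suc c) x ≤ Ω
  small₁ x x≤ = divide _ (≤-trans (≤-reflexive (x∙yz≈y∙xz Q (suc c) (w N (suc c) x)))
    (≤-trans (*-monoʳ-≤ (suc c) (small-types Q N (suc c) x (m≤n⇒m≤1+n Q²≤c) (s≤s z≤n) 4sc≤3N x≤)) (≤-reflexive Λ≡)))
  D≤ : D ≤ k * suc d
  D≤ = ≤-trans (+-monoʳ-≤ ((k ∸ r) * suc d) (*-monoʳ-≤ r (s≤s c≤d)))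
    (≤-reflexive (trans (sym (*-distribʳ-+ (suc d) (k ∸ r) r)) (cong (_* suc d) (m∸n+n≡m r≤k))))
  -- Of the `c` factors in `k ^ c` one is kept, to match the `k` in the bound on `D`, and the others
  -- are bounded below by 2.
  T≥ : 2 * suc q * suc K * k ≤ T
  T≥ = *-cancelˡ-≤ 2 (begin
    2 * (2 * suc q * suc K * k) ≤⟨ *-monoʳ-≤ 2 (*-monoˡ-≤ k (*-monoʳ-≤ (2 * suc q) sucK≤)) ⟩
    2 * (2 * suc q * ((c + 5) * (c + 5)) * k) ≡⟨ eq₁ (suc q) ((c + 5) * (c + 5)) k ⟩
    4 * suc q * ((c + 5) * (c + 5)) * k ≤⟨ *-monoˡ-≤ k (*-cancelˡ-≤ {4 * suc q * ((c + 5) * (c + 5))} {2 ^ c} 125 exponential) ⟩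
    2 ^ c * k ≡⟨ cong (λ z → 2 ^ z * k) c≡ ⟨
    2 * 2 ^ c′ * k ≤⟨ *-monoˡ-≤ k (*-monoʳ-≤ 2 (^-monoˡ-≤ c′ (≤-trans (m≤m+n 2 2) 4≤k))) ⟩
    2 * k ^ c′ * k ≡⟨ eq₂ (k ^ c′) k ⟩
    2 * (k * k ^ c′) ≡⟨ cong (λ z → 2 * k ^ z) c≡ ⟩
    2 * k ^ c ≤⟨ *-monoʳ-≤ 2 (power≤choose c (N + N) k (≤-trans (m≤m+n (c * k) r) (≤-reflexive (sym n≡ck+r)))) ⟩
    2 * T ∎)
    where
    c′ = c ∸ 1
    c≡ : suc c′ ≡ c
    c≡ = m+[n∸m]≡n c>0
    sucK≤ : suc K ≤ (c + 5) * (c + 5)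
    sucK≤ = ≤-trans (m≤m+n (suc K) (6 * c + 20)) (≤-reflexive (eq c))
      where
      eq : ∀ c → suc ((c + 2) * (c + 2)) + (6 * c + 20) ≡ (c + 5) * (c + 5)
      eq = solve-∀
    eq₁ : ∀ x y k → 2 * (2 * x * y * k) ≡ 4 * x * y * k
    eq₁ = solve-∀
    eq₂ : ∀ x k → 2 * x * k ≡ 2 * (k * x)
    eq₂ = solve-∀
    exponential : 125 * (4 * suc q * ((c + 5) * (c + 5))) ≤ 125 * 2 ^ c
    exponential = begin
      125 * (4 * suc q * ((c + 5) * (c + 5))) ≡⟨ eq₃ (suc q) ((c + 5) * (c + 5)) ⟩
      500 * suc q * ((c + 5) * (c + 5)) ≤⟨ *-monoˡ-≤ ((c + 5) * (c + 5)) (≤-trans 500q≤c (m≤m+n c 5)) ⟩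
      (c + 5) * ((c + 5) * (c + 5)) ≡⟨ *-assoc (c + 5) (c + 5) (c + 5) ⟨
      (c + 5) * (c + 5) * (c + 5) ≤⟨ cube≤exponential c ⟩
      125 * 2 ^ c ∎
      where
      eq₃ : ∀ x y → 125 * (4 * x * y) ≡ 500 * x * y
      eq₃ = solve-∀
      500q≤c : 500 * suc q ≤ c
      500q≤c = ≤-trans (*-mono-≤ (m≤m+n 500 36364) (m≤m*n (suc q) (suc q))) q≤c′
  overhead : 2 * suc q * (suc K * D) ≤ Λ
  overhead = begin
    2 * suc q * (suc K * D) ≤⟨ *-monoʳ-≤ (2 * suc q) (*-monoʳ-≤ (suc K) D≤) ⟩
    2 * suc q * (suc K * (k * suc d)) ≡⟨ eq (2 * suc q) (suc K) k (suc d) ⟩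
    suc d * (2 * suc q * suc K * k) ≤⟨ *-monoʳ-≤ (suc d) T≥ ⟩
    Λ ∎
    where
    eq : ∀ x y k d → x * (y * (k * d)) ≡ d * (x * y * k)
    eq = solve-∀
  QΩ≤Λ : Q * Ω ≤ Λ
  QΩ≤Λ = ≤-trans (≤-reflexive (*-comm Q Ω)) (m/n*n≤m Λ Q)
  waste = K * D + 6 * Ω
  -- The summand `D` provides for the floor in the definition of `p`.
  waste-bound : suc q * (waste + D) ≤ Λ
  waste-bound = *-cancelˡ-≤ 2 (begin
    2 * (suc q * (K * D + 6 * Ω + D)) ≡⟨ eq (suc q) K D Ω ⟩
    2 * suc q * (suc K * D) + 12 * suc q * Ω ≤⟨ +-mono-≤ overhead QΩ≤Λ ⟩
    Λ + Λ ≡⟨ cong (Λ +_) (+-identityʳ Λ) ⟨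
    2 * Λ ∎)
    where
    eq : ∀ x K D O → 2 * (x * (K * D + 6 * O + D)) ≡ 2 * x * (suc K * D) + 12 * x * O
    eq = solve-∀
  instance
    D≢0 : NonZero D
    D≢0 = >-nonZero (≤-trans (*-mono-< (≤-trans (s≤s z≤n) 2≤r) (s≤s (z≤n {c}))) (m≤n+m (r * suc c) ((k ∸ r) * suc d)))
  p = (Λ ∸ waste) / D
  waste≤Λ : waste ≤ Λ
  waste≤Λ = ≤-trans (m≤m+n waste D) (≤-trans (m≤n*m (waste + D) (suc q)) waste-bound)
  enough : D * (p + K) + 6 * Ω ≤ Λ
  enough = begin
    D * (p + K) + 6 * Ω ≡⟨ eq D p K (6 * Ω) ⟩
    p * D + waste ≤⟨ +-monoˡ-≤ waste (m/n*n≤m (Λ ∸ waste) D) ⟩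
    Λ ∸ waste + waste ≡⟨ m∸n+n≡m waste≤Λ ⟩
    Λ ∎
    where
    eq : ∀ D p K O → D * (p + K) + O ≡ p * D + (K * D + O)
    eq = solve-∀
  near : q * Λ ≤ suc q * (p * D)
  near = +-cancelʳ-≤ (suc q * (waste + D)) _ _ (begin
    q * Λ + suc q * (waste + D) ≤⟨ +-monoʳ-≤ (q * Λ) waste-bound ⟩
    q * Λ + Λ ≡⟨ +-comm (q * Λ) Λ ⟩
    suc q * Λ ≡⟨ cong (suc q *_) (m∸n+n≡m waste≤Λ) ⟨
    suc q * (Λ ∸ waste + waste) ≤⟨ *-monoʳ-≤ (suc q) (+-monoˡ-≤ waste (<-quotient (Λ ∸ waste) D)) ⟩
    suc q * (D * p + D + waste) ≡⟨ eq (suc q) D p waste ⟩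
    suc q * (p * D) + suc q * (waste + D) ∎)
    where
    eq : ∀ x D p W → x * (D * p + D + W) ≡ x * (p * D) + x * (W + D)
    eq = solve-∀

-- Divisible ground sets, and the effect of adding a point

-- Baranyai's theorem: with an empty second half and one type, `(n C c) * k` equals `suc n C suc c`,
-- so every set of size `suc c` can be used once.
divisible-system : ∀ n c k → suc n ≡ suc c * k → System (suc n) k (n C c)
divisible-system n c k n≡ = subst (λ z → System z k (n C c)) (+-identityʳ (suc n))
  (sperner-from-types (suc n) 0 (λ _ _ → suc c) (λ _ _ → 0)
    (λ _ → trans (sum-const k (suc c)) (trans (*-comm k (suc c)) (sym n≡))) (λ _ → sum-zero {k} λ _ → refl)
    counts (λ _ _ → s≤s z≤n) (λ _ _ _ _ _ _ → refl , refl))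
  where
  open ≤-Reasoning
  whole : (n C c) * k ≡ suc n C suc c
  whole = *-cancelˡ-≡ _ _ (suc c) (trans (eq (suc c) (n C c) k) (trans (cong (_* (n C c)) (sym n≡)) (sym (absorption n c))))
    where
    eq : ∀ c b k → c * (b * k) ≡ c * k * b
    eq = solve-∀
  constant : ∀ v → sum {n C c} (λ j → sum {k} (λ a → v)) ≡ (n C c) * (k * v)
  constant v = trans (sum-cong-≗ {n C c} λ j → sum-const k v) (sum-const (n C c) (k * v))
  counts : ∀ x y → sum {n C c} (λ j → sum {k} (λ a → 𝟙 (suc c ≟ x) * 𝟙 (0 ≟ y))) ≤ (suc n C x) * (0 C y)
  counts x y with suc c ≟ x | 0 ≟ y
  ... | yes refl | yes refl = ≤-reflexive (trans (constant 1) (trans (cong ((n C c) *_) (*-identityʳ k)) (trans whole (sym (*-identityʳ _)))))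
  ... | yes refl | no _ = ≤-trans (≤-reflexive (trans (constant 0) (trans (cong ((n C c) *_) (*-zeroʳ k)) (*-zeroʳ (n C c))))) z≤n
  ... | no _ | _ = ≤-trans (≤-reflexive (trans (constant 0) (trans (cong ((n C c) *_) (*-zeroʳ k)) (*-zeroʳ (n C c))))) z≤n

near-optimal-divisible : ∀ q c k → 0 < c → 0 < k → NearOptimal q (c * k) k c 0
near-optimal-divisible q (suc c) (suc k) _ _ = n C c , divisible-system n c (suc k) refl ,
  ≤-trans (≤-reflexive (cong (q *_) exact)) (*-monoˡ-≤ ((n C c) * cost (suc n) (suc k) (suc c) 0) (n≤1+n q))
  where
  n = k + c * suc k
  exact : mass (suc n) (suc c) ≡ (n C c) * cost (suc n) (suc k) (suc c) 0
  exact = *-cancelˡ-≡ _ _ (suc c) (begin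
    suc c * (δ * (suc n C suc c)) ≡⟨ x∙yz≈y∙xz (suc c) δ (suc n C suc c) ⟩
    δ * (suc c * (suc n C suc c)) ≡⟨ cong (δ *_) (absorption n c) ⟩
    δ * (suc c * suc k * (n C c)) ≡⟨ eq₂ δ (suc c) (suc k) (n C c) ⟩
    suc c * ((n C c) * (suc k * δ + 0)) ∎)
    where
    open ≡-Reasoning
    δ = suc n ∸ suc c
    eq₂ : ∀ d c k b → d * (c * k * b) ≡ c * (b * (k * d + 0))
    eq₂ = solve-∀

-- The new point joins class `zero` of each partition; non-inclusions persist since they are already
-- witnessed by old points.
add-element : ∀ {n k p} → System n (suc k) p → System (suc n) (suc k) p
add-element {n} {k} {p} (P , surj , sperner) = P′ , (λ j a → suc (proj₁ (surj j a)) , proj₂ (surj j a)) ,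
  λ i j i≢j a b sub → sperner i j i≢j a b λ x → sub (suc x)
  where
  P′ : Fin p → Fin (suc n) → Fin (suc k)
  P′ j zero = zero
  P′ j (suc x) = P j x

-- Adding a point raises the mass by a factor at most 1 + 1/Q, because (n + 1) / (n - c) = 1 + (c +
-- 1) / (n - c), and lowers the cost by at most the same factor, as Q ≤ k - r in the notation of the
-- code. With the loss already present this makes (1 + 1/Q)³, and Q = 3q + 2 keeps it within 1 +
-- 1/q.
near-optimal-step : ∀ q n k c r → let Q = 3 * q + 2 in suc r < suc k → Q ≤ suc k ∸ suc r → Q * suc c ≤ n ∸ c → c ≤ n →
  NearOptimal Q n (suc k) c r → NearOptimal q (suc n) (suc k) c (suc r)
near-optimal-step q n k c r r<k Q≤κ Qc≤δ c≤n (p , system , near) = p , add-element system ,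
  *-cancelˡ-≤ (Q * Q * Q) {{m*n≢0 (Q * Q) Q {{m*n≢0 Q Q {{Q≢0}} {{Q≢0}}}} {{Q≢0}}}} (begin
    Q * Q * Q * (q * Λ′) ≡⟨ eq₁ Q q Λ′ ⟩
    q * (Q * Q) * (Q * Λ′) ≤⟨ *-monoʳ-≤ (q * (Q * Q)) mass-step ⟩
    q * (Q * Q) * (suc Q * Λ) ≡⟨ eq₂ q Q Λ (suc Q) ⟩
    q * Q * suc Q * (Q * Λ) ≤⟨ *-monoʳ-≤ (q * Q * suc Q) near ⟩
    q * Q * suc Q * (suc Q * (p * D)) ≡⟨ eq₃ q Q (suc Q) p D ⟩
    q * (suc Q * suc Q) * p * (Q * D) ≤⟨ *-monoʳ-≤ (q * (suc Q * suc Q) * p) cost-step ⟩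
    q * (suc Q * suc Q) * p * (suc Q * D′) ≡⟨ eq₄ q (suc Q) p D′ ⟩
    q * (suc Q * suc Q * suc Q) * (p * D′) ≤⟨ *-monoˡ-≤ (p * D′) (≤-trans (m≤m+n (q * (suc Q * suc Q * suc Q)) (suc q * (9 * q + 8))) (≤-reflexive (eq₅ q))) ⟩
    suc q * (Q * Q * Q) * (p * D′) ≡⟨ eq₆ (suc q) (Q * Q * Q) (p * D′) ⟩
    Q * Q * Q * (suc q * (p * D′)) ∎)
  where
  open ≤-Reasoning
  Q = 3 * q + 2
  Q≢0 : NonZero Q
  Q≢0 = >-nonZero (≤-trans (s≤s z≤n) (m≤n+m 2 (3 * q)))
  δ = n ∸ c
  κ′ = k ∸ r
  Λ = mass n c
  Λ′ = mass (suc n) c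
  D = cost n (suc k) c r
  D′ = cost (suc n) (suc k) c (suc r)
  eq₁ : ∀ Q q L → Q * Q * Q * (q * L) ≡ q * (Q * Q) * (Q * L)
  eq₁ = solve-∀
  eq₂ : ∀ q Q L S → q * (Q * Q) * (S * L) ≡ q * Q * S * (Q * L)
  eq₂ = solve-∀
  eq₃ : ∀ q Q S p D → q * Q * S * (S * (p * D)) ≡ q * (S * S) * p * (Q * D)
  eq₃ = solve-∀
  eq₄ : ∀ q S p D → q * (S * S) * p * (S * D) ≡ q * (S * S * S) * (p * D)
  eq₄ = solve-∀
  eq₅ : ∀ q → q * (suc (3 * q + 2) * suc (3 * q + 2) * suc (3 * q + 2)) + suc q * (9 * q + 8) ≡ suc q * ((3 * q + 2) * (3 * q + 2) * (3 * q + 2))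
  eq₅ = solve-∀
  eq₆ : ∀ x y z → x * y * z ≡ y * (x * z)
  eq₆ = solve-∀
  suc-n∸c : suc n ∸ c ≡ suc δ
  suc-n∸c = +-∸-assoc 1 c≤n
  n≡ : suc n ≡ suc c + δ
  n≡ = cong suc (sym (m+[n∸m]≡n c≤n))
  Λ′≡ : Λ′ ≡ suc n * (n C c)
  Λ′≡ = trans (cong (_* (suc n C c)) suc-n∸c) (+-cancelˡ-≡ (c * (suc n C c)) _ _
    (trans (sym (*-distribʳ-+ (suc n C c) c (suc δ))) (trans (cong (_* (suc n C c)) (trans (+-suc c δ) (sym n≡))) (absorption-complement n c))))
  mass-step : Q * Λ′ ≤ suc Q * Λ
  mass-step = begin
    Q * Λ′ ≡⟨ cong (Q *_) (trans Λ′≡ (cong (_* (n C c)) n≡)) ⟩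
    Q * ((suc c + δ) * (n C c)) ≡⟨ eq Q (suc c) δ (n C c) ⟩
    (Q * suc c + Q * δ) * (n C c) ≤⟨ *-monoˡ-≤ (n C c) (+-monoˡ-≤ (Q * δ) Qc≤δ) ⟩
    (δ + Q * δ) * (n C c) ≡⟨ *-assoc (suc Q) δ (n C c) ⟩
    suc Q * (δ * (n C c)) ∎
    where
    eq : ∀ Q c d b → Q * ((c + d) * b) ≡ (Q * c + Q * d) * b
    eq = solve-∀
  κ≡ : suc k ∸ r ≡ suc κ′
  κ≡ = +-∸-assoc 1 (≤-pred (<⇒≤ r<k))
  D≡ : D ≡ suc κ′ * δ + r * suc c
  D≡ = cong (λ z → z * δ + r * suc c) κ≡
  D′≡ : D′ ≡ κ′ * suc δ + suc r * suc c
  D′≡ = cong (λ z → κ′ * z + suc r * suc c) suc-n∸c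
  cost-step : Q * D ≤ suc Q * D′
  cost-step = begin
    Q * D ≡⟨ trans (cong (Q *_) D≡) (eq Q κ′ δ r c) ⟩
    Q * δ + Q * (κ′ * δ + r * suc c) ≤⟨ +-mono-≤ (*-monoˡ-≤ δ Q≤κ) ≤-refl ⟩
    κ′ * δ + Q * (κ′ * δ + r * suc c) ≤⟨ ≤-trans (m≤m+n _ (κ′ + suc r * suc c + Q * (κ′ + suc c))) (≤-reflexive (eq′ Q κ′ δ r c)) ⟩
    suc Q * (κ′ * suc δ + suc r * suc c) ≡⟨ cong (suc Q *_) D′≡ ⟨
    suc Q * D′ ∎
    where
    eq : ∀ Q K d r c → Q * (suc K * d + r * suc c) ≡ Q * d + Q * (K * d + r * suc c)
    eq = solve-∀
    eq′ : ∀ Q K d r c → K * d + Q * (K * d + r * suc c) + (K + suc r * suc c + Q * (K + suc c)) ≡ suc Q * (K * suc d + suc r * suc c)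
    eq′ = solve-∀

-- Rational arithmetic

-- Exposes the normal form on which rational addition, multiplication and comparison compute.
⟦⟧-mkℚ : ∀ m → ⟦ m ⟧ ≡ mkℚ (ℤ.+ m) 0 (Coprimality.sym (Coprimality.1-coprimeTo m))
⟦⟧-mkℚ m = ℚₚ.normalize-coprime (Coprimality.sym (Coprimality.1-coprimeTo m))

⟦⟧-+ : ∀ m n → ⟦ m + n ⟧ ≡ ⟦ m ⟧ ℚ.+ ⟦ n ⟧
⟦⟧-+ m n = trans (ℚₚ./-cong {q₁ = 1} {q₂ = 1} (sym (cong₂ ℤ._+_ (ℤₚ.*-identityʳ (ℤ.+ m)) (ℤₚ.*-identityʳ (ℤ.+ n)))) refl)
  (sym (cong₂ ℚ._+_ (⟦⟧-mkℚ m) (⟦⟧-mkℚ n)))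

⟦⟧-* : ∀ m n → ⟦ m * n ⟧ ≡ ⟦ m ⟧ ℚ.* ⟦ n ⟧
⟦⟧-* m n = trans (ℚₚ./-cong {q₁ = 1} {q₂ = 1} (ℤₚ.pos-* m n) refl) (sym (cong₂ ℚ._*_ (⟦⟧-mkℚ m) (⟦⟧-mkℚ n)))

⟦⟧-mono-≤ : ∀ {m n} → m ≤ n → ⟦ m ⟧ ℚ.≤ ⟦ n ⟧
⟦⟧-mono-≤ {m} {n} m≤n = subst₂ ℚ._≤_ (sym (⟦⟧-mkℚ m)) (sym (⟦⟧-mkℚ n)) (ℚ.*≤* (ℤₚ.*-monoʳ-≤-nonNeg (ℤ.+ 1) (ℤ.+≤+ m≤n)))

⟦⟧-cancel-< : ∀ {m n} → ⟦ m ⟧ ℚ.< ⟦ n ⟧ → m < n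
⟦⟧-cancel-< {m} {n} lt = ≰⇒> λ n≤m → ℚₚ.<-irrefl refl (ℚₚ.<-≤-trans lt (⟦⟧-mono-≤ n≤m))

⟦⟧-positive : ∀ {m} → 0 < m → ℚ.Positive ⟦ m ⟧
⟦⟧-positive {suc m} _ = ℚₚ.normalize-pos (suc m) 1

positive≢0 : ∀ {x} → ℚ.Positive x → x ≢ 0ℚ
positive≢0 {x} pos x≡0 = ℚₚ.<⇒≢ (ℚₚ.positive⁻¹ x {{pos}}) (sym x≡0)

÷′-* : ∀ x y → y ≢ 0ℚ → (x ÷' y) ℚ.* y ≡ x
÷′-* x y y≢0 with y ℚₚ.≟ 0ℚ
... | yes y≡0 = contradiction y≡0 y≢0
... | no y≢0′ = begin
  x ℚ.* (ℚ.1/ y) ℚ.* y ≡⟨ ℚₚ.*-assoc x (ℚ.1/ y) y ⟩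
  x ℚ.* ((ℚ.1/ y) ℚ.* y) ≡⟨ cong (x ℚ.*_) (ℚₚ.*-inverseˡ y) ⟩
  x ℚ.* 1ℚ ≡⟨ ℚₚ.*-identityʳ x ⟩
  x ∎
  where
  open ≡-Reasoning
  instance
    y-nonZero : ℚ.NonZero y
    y-nonZero = ≢-nonZero y≢0′

archimedean : ∀ ε → ℚ.Positive ε → ∃ λ q → 1ℚ ℚ.< ⟦ suc q ⟧ ℚ.* ε
-- For ε = (a + 1) / (d + 1) the multiplier d + 2 already exceeds the denominator.
archimedean ε@(mkℚ (ℤ.+ suc a) d _) _ = suc d , ℚₚ.toℚᵘ-cancel-< (ℚᵘₚ.<-respʳ-≃ (ℚᵘₚ.≃-sym (ℚₚ.toℚᵘ-homo-* ⟦ suc (suc d) ⟧ ε))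
  (subst (λ z → ℚᵘ.mkℚᵘ (ℤ.+ 1) 0 ℚᵘ.< ℚ.toℚᵘ z ℚᵘ.* ℚ.toℚᵘ ε) (sym (⟦⟧-mkℚ (suc (suc d))))
    (ℚᵘ.*<* (subst₂ ℤ._<_ (sym (ℤₚ.*-identityˡ (ℤ.+ suc (d + 0)))) (sym (ℤₚ.*-identityʳ (ℤ.+ (suc (suc d) * suc a))))
      (ℤ.+<+ (≤-trans (≤-reflexive (cong (2 +_) (+-identityʳ d))) (m≤m*n (suc (suc d)) (suc a))))))))

reciprocal : ∀ m → ∃ λ ε → ℚ.Positive ε × ⟦ suc m ⟧ ℚ.* ε ≡ 1ℚ
reciprocal m = ℚ.1/ ⟦ suc m ⟧ , ℚₚ.1/pos⇒pos ⟦ suc m ⟧ , ℚₚ.*-inverseʳ ⟦ suc m ⟧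
  where
  instance
    pos : ℚ.Positive ⟦ suc m ⟧
    pos = ⟦⟧-positive {suc m} (s≤s z≤n)
    nonZero′ : ℚ.NonZero ⟦ suc m ⟧
    nonZero′ = ℚₚ.pos⇒nonZero ⟦ suc m ⟧

-- Here x = A / B satisfies q / (q + 1) ≤ x ≤ 1, so it differs from 1 by at most 1 / (q + 1) < ε.
near-one : ∀ x ε q A B → 0 < B → x ℚ.* ⟦ B ⟧ ≡ ⟦ A ⟧ → A ≤ B → q * B ≤ suc q * A → 1ℚ ℚ.< ⟦ suc q ⟧ ℚ.* ε →
  ℚ.∣ x ℚ.- 1ℚ ∣ ℚ.< ε
near-one x ε q A B B>0 xB≡A A≤B near 1<qε = subst (ℚ._< ε) (sym abs) close
  where
  open +-*-Solver using (solve; con; _:*_; _:+_; _:-_; :-_; _:=_)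
  instance
    posB : ℚ.Positive ⟦ B ⟧
    posB = ⟦⟧-positive B>0
    posqB : ℚ.Positive ⟦ suc q * B ⟧
    posqB = ⟦⟧-positive (*-mono-< {0} {suc q} (s≤s z≤n) B>0)
    nonNegqB : ℚ.NonNegative ⟦ suc q * B ⟧
    nonNegqB = ℚₚ.pos⇒nonNeg ⟦ suc q * B ⟧
  x≤1 : x ℚ.≤ 1ℚ
  x≤1 = ℚₚ.*-cancelʳ-≤-pos ⟦ B ⟧ (subst₂ ℚ._≤_ (sym xB≡A) (sym (ℚₚ.*-identityˡ ⟦ B ⟧)) (⟦⟧-mono-≤ A≤B))
  1<x+ε : 1ℚ ℚ.< x ℚ.+ ε
  1<x+ε = ℚₚ.*-cancelˡ-<-nonNeg ⟦ suc q * B ⟧ (begin-strict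
    ⟦ suc q * B ⟧ ℚ.* 1ℚ ≡⟨ ℚₚ.*-identityʳ ⟦ suc q * B ⟧ ⟩
    ⟦ suc q * B ⟧ ≤⟨ ⟦⟧-mono-≤ (≤-trans (+-monoʳ-≤ B near) (≤-reflexive (+-comm B (suc q * A)))) ⟩
    ⟦ suc q * A + B ⟧ ≡⟨ trans (⟦⟧-+ (suc q * A) B) (cong (ℚ._+ ⟦ B ⟧) (⟦⟧-* (suc q) A)) ⟩
    ⟦ suc q ⟧ ℚ.* ⟦ A ⟧ ℚ.+ ⟦ B ⟧ ≡⟨ cong₂ (λ y z → ⟦ suc q ⟧ ℚ.* y ℚ.+ z) (sym xB≡A) (sym (ℚₚ.*-identityʳ ⟦ B ⟧)) ⟩
    ⟦ suc q ⟧ ℚ.* (x ℚ.* ⟦ B ⟧) ℚ.+ ⟦ B ⟧ ℚ.* 1ℚ <⟨ ℚₚ.+-monoʳ-< (⟦ suc q ⟧ ℚ.* (x ℚ.* ⟦ B ⟧)) (ℚₚ.*-monoʳ-<-pos ⟦ B ⟧ 1<qε) ⟩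
    ⟦ suc q ⟧ ℚ.* (x ℚ.* ⟦ B ⟧) ℚ.+ ⟦ B ⟧ ℚ.* (⟦ suc q ⟧ ℚ.* ε) ≡⟨ solve 4 (λ Q x B e → Q :* (x :* B) :+ B :* (Q :* e) := Q :* B :* (x :+ e)) refl ⟦ suc q ⟧ x ⟦ B ⟧ ε ⟩
    ⟦ suc q ⟧ ℚ.* ⟦ B ⟧ ℚ.* (x ℚ.+ ε) ≡⟨ cong (ℚ._* (x ℚ.+ ε)) (⟦⟧-* (suc q) B) ⟨
    ⟦ suc q * B ⟧ ℚ.* (x ℚ.+ ε) ∎)
    where open ℚₚ.≤-Reasoning
  cancel : ∀ x ε → x ℚ.+ ε ℚ.- x ≡ ε
  cancel = solve 2 (λ x e → x :+ e :- x := e) refl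
  close : 1ℚ ℚ.- x ℚ.< ε
  close = subst (1ℚ ℚ.- x ℚ.<_) (cancel x ε) (ℚₚ.+-monoˡ-< (ℚ.- x) 1<x+ε)
  0≤1-x : 0ℚ ℚ.≤ 1ℚ ℚ.- x
  0≤1-x = subst (ℚ._≤ 1ℚ ℚ.- x) (ℚₚ.+-inverseʳ x) (ℚₚ.+-monoˡ-≤ (ℚ.- x) x≤1)
  abs : ℚ.∣ x ℚ.- 1ℚ ∣ ≡ 1ℚ ℚ.- x
  abs = trans (cong ℚ.∣_∣ (solve 1 (λ x → x :- con 1ℚ := :- (con 1ℚ :- x)) refl x))
    (trans (ℚₚ.∣-p∣≡∣p∣ (1ℚ ℚ.- x)) (ℚₚ.0≤p⇒∣p∣≡p 0≤1-x))

-- ⟦ s ⟧ ÷' MMS is s D / Λ, where D is the cost and Λ the mass.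
ratio : ∀ s κ R δ T → 0 < κ → 0 < δ → 0 < T →
  (⟦ s ⟧ ÷' (⟦ T ⟧ ÷' (⟦ κ ⟧ ℚ.+ ⟦ R ⟧ ÷' ⟦ δ ⟧))) ℚ.* ⟦ δ * T ⟧ ≡ ⟦ s * (κ * δ + R) ⟧
ratio s κ R δ T κ>0 δ>0 T>0 = begin
  x ℚ.* ⟦ δ * T ⟧ ≡⟨ cong (x ℚ.*_) (⟦⟧-* δ T) ⟩
  x ℚ.* (⟦ δ ⟧ ℚ.* ⟦ T ⟧) ≡⟨ cong (λ z → x ℚ.* (⟦ δ ⟧ ℚ.* z)) m*y ⟨
  x ℚ.* (⟦ δ ⟧ ℚ.* (m ℚ.* y)) ≡⟨ solve 4 (λ x d m y → x :* (d :* (m :* y)) := x :* m :* (y :* d)) refl x ⟦ δ ⟧ m y ⟩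
  x ℚ.* m ℚ.* (y ℚ.* ⟦ δ ⟧) ≡⟨ cong₂ ℚ._*_ (÷′-* ⟦ s ⟧ m m≢0) yδ ⟩
  ⟦ s ⟧ ℚ.* ⟦ κ * δ + R ⟧ ≡⟨ ⟦⟧-* s (κ * δ + R) ⟨
  ⟦ s * (κ * δ + R) ⟧ ∎
  where
  open ≡-Reasoning
  open +-*-Solver using (solve; con; _:*_; _:+_; _:-_; :-_; _:=_)
  z = ⟦ R ⟧ ÷' ⟦ δ ⟧
  y = ⟦ κ ⟧ ℚ.+ z
  m = ⟦ T ⟧ ÷' y
  x = ⟦ s ⟧ ÷' m
  yδ : y ℚ.* ⟦ δ ⟧ ≡ ⟦ κ * δ + R ⟧
  yδ = trans (ℚₚ.*-distribʳ-+ ⟦ δ ⟧ ⟦ κ ⟧ z) (trans (cong₂ ℚ._+_ (sym (⟦⟧-* κ δ)) (÷′-* ⟦ R ⟧ ⟦ δ ⟧ (positive≢0 (⟦⟧-positive δ>0)))) (sym (⟦⟧-+ (κ * δ) R)))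
  y≢0 : y ≢ 0ℚ
  y≢0 y≡0 = positive≢0 (⟦⟧-positive {κ * δ + R} (≤-trans (*-mono-< κ>0 δ>0) (m≤m+n (κ * δ) R)))
    (trans (sym yδ) (trans (cong (ℚ._* ⟦ δ ⟧) y≡0) (ℚₚ.*-zeroˡ ⟦ δ ⟧)))
  m*y : m ℚ.* y ≡ ⟦ T ⟧
  m*y = ÷′-* ⟦ T ⟧ y y≢0
  m≢0 : m ≢ 0ℚ
  m≢0 m≡0 = positive≢0 (⟦⟧-positive T>0) (trans (sym m*y) (trans (cong (ℚ._* y) m≡0) (ℚₚ.*-zeroˡ y)))

quotient-large : ∀ C k n → 0 < n → ∀ ε → ⟦ suc C ⟧ ℚ.* ε ≡ 1ℚ → ℚ.∣ ⟦ k ⟧ ÷' ⟦ n ⟧ ℚ.- 0ℚ ∣ ℚ.< ε → C * k < n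
quotient-large C k n n>0 ε Cε≡1 small = ≤-<-trans (*-monoˡ-≤ k (n≤1+n C)) (⟦⟧-cancel-< (begin-strict
  ⟦ suc C * k ⟧ ≡⟨ ⟦⟧-* (suc C) k ⟩
  ⟦ suc C ⟧ ℚ.* ⟦ k ⟧ ≡⟨ cong (⟦ suc C ⟧ ℚ.*_) (÷′-* ⟦ k ⟧ ⟦ n ⟧ (positive≢0 (⟦⟧-positive n>0))) ⟨
  ⟦ suc C ⟧ ℚ.* (x ℚ.* ⟦ n ⟧) <⟨ ℚₚ.*-monoʳ-<-pos ⟦ suc C ⟧ (ℚₚ.*-monoˡ-<-pos ⟦ n ⟧ x<ε) ⟩
  ⟦ suc C ⟧ ℚ.* (ε ℚ.* ⟦ n ⟧) ≡⟨ ℚₚ.*-assoc ⟦ suc C ⟧ ε ⟦ n ⟧ ⟨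
  ⟦ suc C ⟧ ℚ.* ε ℚ.* ⟦ n ⟧ ≡⟨ cong (ℚ._* ⟦ n ⟧) Cε≡1 ⟩
  1ℚ ℚ.* ⟦ n ⟧ ≡⟨ ℚₚ.*-identityˡ ⟦ n ⟧ ⟩
  ⟦ n ⟧ ∎))
  where
  open ℚₚ.≤-Reasoning
  x = ⟦ k ⟧ ÷' ⟦ n ⟧
  instance
    posn : ℚ.Positive ⟦ n ⟧
    posn = ⟦⟧-positive n>0
    posC : ℚ.Positive ⟦ suc C ⟧
    posC = ⟦⟧-positive {suc C} (s≤s z≤n)
  p≤∣p∣ : ∀ p → p ℚ.≤ ℚ.∣ p ∣
  p≤∣p∣ (mkℚ (ℤ.+ _) _ _) = ℚₚ.≤-refl
  p≤∣p∣ (mkℚ ℤ.-[1+ _ ] _ _) = ℚₚ.≤-trans (ℚₚ.nonPositive⁻¹ _) (ℚₚ.nonNegative⁻¹ _)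
  x<ε : x ℚ.< ε
  x<ε = ℚₚ.≤-<-trans (p≤∣p∣ x) (subst (λ z → ℚ.∣ z ∣ ℚ.< ε) (ℚₚ.+-identityʳ x) small)

-- Near-optimal systems under either hypothesis, and the limit

near-optimal-base : ∀ q c k r → 0 < k → threshold q ≤ c →
  r ≡ 0 ⊎ (∃ λ N → c * k + r ≡ N + N) × 2 ≤ r × r + 2 ≤ k → NearOptimal q (c * k + r) k c r
near-optimal-base q c k r k>0 q≤c (inj₁ refl) = subst (λ n → NearOptimal q n k c 0) (sym (+-identityʳ (c * k)))
  (near-optimal-divisible q c k (≤-trans (threshold>0 q) q≤c) k>0)
near-optimal-base q c k r k>0 q≤c (inj₂ ((N , n≡) , 2≤r , r+2≤k)) = subst (λ n → NearOptimal q n k c r) (sym n≡)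
  (near-optimal-even q N c (N + N ∸ suc c) k r (sym (m+[n∸m]≡n c<n)) (sym n≡) 2≤r r+2≤k q≤c)
  where
  c<n : c < N + N
  c<n = begin-strict
    c ≤⟨ m≤m*n c k {{>-nonZero k>0}} ⟩
    c * k <⟨ m<m+n (c * k) (≤-trans (s≤s z≤n) 2≤r) ⟩
    c * k + r ≡⟨ n≡ ⟩
    N + N ∎
    where open ≤-Reasoning

refine : ℕ → ℕ
refine q = 3 * q + 2

-- Lowering n and r together, at most twice, reaches r = 0 or an even n with 2 ≤ r ≤ k - 2.
near-optimal-spread : ∀ q c k r → threshold q + (threshold (refine q) + threshold (refine (refine q))) ≤ c →
  2 * refine (refine q) + 3 + r ≤ suc k → NearOptimal q (c * suc k + r) (suc k) c r
near-optimal-spread q c k r q≤c room = cases r room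
  where
  open ≤-Reasoning
  Q = refine q
  -- Each added point weakens the accuracy from `refine q` to `q`; two of them require a system of
  -- accuracy `refine (refine q)`.
  Q′ = refine Q
  q≤c₀ : threshold q ≤ c
  q≤c₀ = m+n≤o⇒m≤o (threshold q) q≤c
  q≤c₁ : threshold Q ≤ c
  q≤c₁ = m+n≤o⇒m≤o (threshold Q) (m+n≤o⇒n≤o (threshold q) q≤c)
  q≤c₂ : threshold Q′ ≤ c
  q≤c₂ = m+n≤o⇒n≤o (threshold Q) (m+n≤o⇒n≤o (threshold q) q≤c)
  c>0 : 0 < c
  c>0 = ≤-trans (threshold>0 q) q≤c₀
  Q≤Q′ : Q ≤ Q′
  Q≤Q′ = ≤-trans (m≤n*m Q 3) (m≤m+n (3 * Q) 2)
  step : ∀ q r → refine q ≤ Q′ → 2 * Q′ + 3 + suc r ≤ suc k → NearOptimal (refine q) (c * suc k + r) (suc k) c r →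
    NearOptimal q (c * suc k + suc r) (suc k) c (suc r)
  step q r Q≤ room near = subst (λ n → NearOptimal q n (suc k) c (suc r)) (sym (+-suc (c * suc k) r))
    (near-optimal-step q (c * suc k + r) k c r r<k κ-large gap c≤n near)
    where
    r<k : suc r < suc k
    r<k = ≤-trans (≤-trans (s≤s (≤-trans (n≤1+n (suc r)) (n≤1+n (suc (suc r))))) (+-monoˡ-≤ (suc r) (m≤n+m 3 (2 * Q′)))) room
    κ-large : refine q ≤ suc k ∸ suc r
    κ-large = m+n≤o⇒m≤o∸n (refine q) (≤-trans (+-monoˡ-≤ (suc r) (≤-trans Q≤ (≤-trans (m≤m+n Q′ (Q′ + 0)) (m≤m+n (2 * Q′) 3)))) room)
    c≤n : c ≤ c * suc k + r
    c≤n = ≤-trans (m≤m*n c (suc k)) (m≤m+n (c * suc k) r)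
    gap : refine q * suc c ≤ c * suc k + r ∸ c
    -- As c ≥ 1, Q′ (c + 1) + c is at most c (2 Q′ + 1); this explains the multiple `2 * Q′` in
    -- `room`.
    gap = m+n≤o⇒m≤o∸n (refine q * suc c) (begin
      refine q * suc c + c ≤⟨ +-monoˡ-≤ c (*-monoˡ-≤ (suc c) Q≤) ⟩
      Q′ * suc c + c ≡⟨ eq Q′ c ⟩
      c * Q′ + Q′ * 1 + c ≤⟨ +-monoˡ-≤ c (+-monoʳ-≤ (c * Q′) (*-monoʳ-≤ Q′ c>0)) ⟩
      c * Q′ + Q′ * c + c ≡⟨ eq′ Q′ c ⟩
      c * (2 * Q′ + 1) ≤⟨ *-monoʳ-≤ c (≤-trans (≤-trans (+-monoʳ-≤ (2 * Q′) (m≤m+n 1 2)) (m≤m+n (2 * Q′ + 3) (suc r))) room) ⟩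
      c * suc k ≤⟨ m≤m+n (c * suc k) r ⟩
      c * suc k + r ∎)
      where
      eq : ∀ Q c → Q * suc c + c ≡ c * Q + Q * 1 + c
      eq = solve-∀
      eq′ : ∀ Q c → c * Q + Q * c + c ≡ c * (2 * Q + 1)
      eq′ = solve-∀
  lower : ∀ r → 2 * Q′ + 3 + suc r ≤ suc k → 2 * Q′ + 3 + r ≤ suc k
  lower r room = ≤-trans (+-monoʳ-≤ (2 * Q′ + 3) (n≤1+n r)) room
  r+2≤k : ∀ r → 2 * Q′ + 3 + r ≤ suc k → r + 2 ≤ suc k
  r+2≤k r room = ≤-trans (≤-reflexive (+-comm r 2)) (≤-trans (+-monoˡ-≤ r (≤-trans (m≤m+n 2 1) (m≤n+m 3 (2 * Q′)))) room)
  one : ∀ q → refine q ≤ Q′ → threshold (refine q) ≤ c → 2 * Q′ + 3 + 1 ≤ suc k → NearOptimal q (c * suc k + 1) (suc k) c 1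
  one q Q≤ q≤ room = step q 0 Q≤ room (near-optimal-base (refine q) c (suc k) 0 (s≤s z≤n) q≤ (inj₁ refl))
  cases : ∀ r → 2 * Q′ + 3 + r ≤ suc k → NearOptimal q (c * suc k + r) (suc k) c r
  cases zero room = near-optimal-base q c (suc k) 0 (s≤s z≤n) q≤c₀ (inj₁ refl)
  cases (suc zero) room = one q Q≤Q′ q≤c₁ room
  cases (suc (suc r)) room with parity (c * suc k + suc (suc r))
  ... | N , inj₁ even = near-optimal-base q c (suc k) (suc (suc r)) (s≤s z≤n) q≤c₀
    (inj₂ ((N , even) , s≤s (s≤s z≤n) , r+2≤k (suc (suc r)) room))
  -- One point fewer makes n even. If the remainder has then dropped to 1, a second removal reaches
  -- the divisible case.
  ... | N , inj₂ odd = step q (suc r) Q≤Q′ room (previous r (lower (suc r) room) (suc-injective (trans (sym (+-suc (c * suc k) (suc r))) odd)))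
    where
    previous : ∀ r → 2 * Q′ + 3 + suc r ≤ suc k → c * suc k + suc r ≡ N + N → NearOptimal Q (c * suc k + suc r) (suc k) c (suc r)
    previous zero room _ = one Q ≤-refl q≤c₂ room
    previous (suc r) room even = near-optimal-base Q c (suc k) (suc (suc r)) (s≤s z≤n) q≤c₁
      (inj₂ ((N , even) , s≤s (s≤s z≤n) , r+2≤k (suc (suc r)) room))

-- `sperner-upper`, applied to the extremal system, bounds the ratio by 1; maximality against the
-- near-optimal system bounds it below by q / (q + 1).
ratio-near-one : ∀ q ε c k r s → 0 < c → 2 ≤ k → r < k → IsSP (c * k + r) k s → NearOptimal q (c * k + r) k c r →
  1ℚ ℚ.< ⟦ suc q ⟧ ℚ.* ε →
  ℚ.∣ ⟦ s ⟧ ÷' (⟦ (c * k + r) C c ⟧ ÷' (⟦ k ∸ r ⟧ ℚ.+ ⟦ r * (c + 1) ⟧ ÷' ⟦ c * k + r ∸ c ⟧)) ℚ.- 1ℚ ∣ ℚ.< ε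
ratio-near-one q ε c k r s c>0 2≤k r<k ((P , system) , maximal) (p , (P′ , system′) , near) 1<qε =
  near-one (⟦ s ⟧ ÷' (⟦ n C c ⟧ ÷' (⟦ k ∸ r ⟧ ℚ.+ ⟦ r * (c + 1) ⟧ ÷' ⟦ δ ⟧))) ε q (s * ((k ∸ r) * δ + r * (c + 1))) (δ * (n C c)) (*-mono-< δ>0 T>0)
    (ratio s (k ∸ r) (r * (c + 1)) δ (n C c) (m<n⇒0<n∸m r<k) δ>0 T>0)
    (subst (λ z → s * ((k ∸ r) * δ + r * z) ≤ δ * (n C c)) (+-comm 1 c) upper)
    (subst (λ z → q * (δ * (n C c)) ≤ suc q * (s * ((k ∸ r) * δ + r * z))) (+-comm 1 c)
      (≤-trans near (*-monoʳ-≤ (suc q) (*-monoˡ-≤ (cost n k c r) (maximal p P′ system′)))))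
    1<qε
  where
  n = c * k + r
  δ = n ∸ c
  ck≤n : c * k ≤ n
  ck≤n = m≤m+n (c * k) r
  c<n : c < n
  c<n = <-≤-trans (≤-trans (m<m+n c c>0) (≤-trans (≤-reflexive (cong (c +_) (sym (+-identityʳ c)))) (≤-trans (≤-reflexive (*-comm 2 c)) (*-monoʳ-≤ c 2≤k)))) ck≤n
  δ>0 : 0 < δ
  δ>0 = m<n⇒0<n∸m c<n
  T>0 : 0 < n C c
  T>0 = ≤-trans (≤-trans (m≤n⇒m≤n^ c) (^-monoˡ-≤ c (≤-trans (s≤s z≤n) 2≤k))) (power≤choose c n k ck≤n)
    where
    m≤n⇒m≤n^ : ∀ c → 1 ≤ 1 ^ c
    m≤n⇒m≤n^ c = ≤-reflexive (sym (^-zeroˡ c))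
  d = n ∸ suc c
  n≡ : n ≡ suc (c + d)
  n≡ = sym (m+[n∸m]≡n c<n)
  -- The size is generalised to a variable `m`, so that matching on its equation with `suc (c + d)`
  -- is possible.
  bound : ∀ m (Q : Fin s → Fin m → Fin k) → IsSpernerSystem m k s Q → m ≡ suc (c + d) → m ≡ c * k + r →
    s * ((k ∸ r) * suc d + r * suc c) ≤ (m C c) * suc d
  bound _ Q sys refl m≡ = sperner-upper c r d Q sys m≡ (<⇒≤ r<k)
  upper : s * ((k ∸ r) * δ + r * suc c) ≤ δ * (n C c)
  upper = subst (λ z → s * ((k ∸ r) * z + r * suc c) ≤ z * (n C c)) (sym (complement-of-sum n≡))
    (≤-trans (bound n P system n≡ refl) (≤-reflexive (*-comm (n C c) (suc d))))

theorem1 : (n k sp : ℕ → ℕ)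
    → ((j : ℕ) → 3 ≤ k j × k j ≤ n j)
    → TendsToInfty n
    → TendsTo (λ j → ⟦ k j ⟧ ÷' ⟦ n j ⟧) 0ℚ
    → (((j : ℕ) → (2 ∣ n j) × rem (n j) (k j) ≢ 1 × rem (n j) (k j) ≢ k j ∸ 1)
    ⊎ TendsToInfty (λ j → k j ∸ rem (n j) (k j)))
    → ((j : ℕ) → IsSP (n j) (k j) (sp j))
    → TendsTo (λ j → ⟦ sp j ⟧ ÷' MMS (n j) (k j)) 1ℚ
theorem1 n k sp bounds _ k/n→0 hypothesis sp-max ε ε>0 = conclude hypothesis
  where
  q = proj₁ (archimedean ε ε>0)

  division : ∀ N K → 0 < K → N ≡ quot N K * K + rem N K × rem N K < K
  division N (suc K) _ = trans (m≡m%n+[m/n]*n N (suc K)) (+-comm (rem N (suc K)) _) , m%n<n N (suc K)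

  at-least : ∀ X N K ε → ⟦ suc X ⟧ ℚ.* ε ≡ 1ℚ → 3 ≤ K × K ≤ N → ℚ.∣ ⟦ K ⟧ ÷' ⟦ N ⟧ ℚ.- 0ℚ ∣ ℚ.< ε → X ≤ quot N K
  at-least X N (suc K) ε Xε≡1 (3≤K , K≤N) small = ≤-trans (≤-reflexive (sym (m*n/n≡m X (suc K))))
    (/-monoˡ-≤ (suc K) (<⇒≤ (quotient-large X (suc K) N (≤-trans (s≤s z≤n) K≤N) ε Xε≡1 small)))

  -- This is the use of k/n → 0: k/n < 1 / (X + 1) gives X k < n, so the class size exceeds every
  -- bound.
  large-quotient : ∀ X → ∃ λ J → ∀ j → J ≤ j → X ≤ quot (n j) (k j)
  large-quotient X = proj₁ limit , λ j J≤j → at-least X (n j) (k j) δ (proj₂ (proj₂ (reciprocal X))) (bounds j) (proj₂ limit j J≤j)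
    where
    δ = proj₁ (reciprocal X)
    limit = k/n→0 δ (proj₁ (proj₂ (reciprocal X)))

  close-at : ∀ N K s → 3 ≤ K → 0 < quot N K → IsSP N K s →
    (0 < K → rem N K < K → N ≡ quot N K * K + rem N K →
      NearOptimal q (quot N K * K + rem N K) K (quot N K) (rem N K)) →
    ℚ.∣ ⟦ s ⟧ ÷' MMS N K ℚ.- 1ℚ ∣ ℚ.< ε
  close-at N K s 3≤K c>0 isSP near =
    subst (λ m → ℚ.∣ ⟦ s ⟧ ÷' (⟦ m C c ⟧ ÷' (⟦ K ∸ r ⟧ ℚ.+ ⟦ r * (c + 1) ⟧ ÷' ⟦ m ∸ c ⟧)) ℚ.- 1ℚ ∣ ℚ.< ε) (sym N≡)
      (ratio-near-one q ε c K r s c>0 (≤-trans (n≤1+n 2) 3≤K) r<K (subst (λ m → IsSP m K s) N≡ isSP)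
        (near K>0 r<K N≡) (proj₂ (archimedean ε ε>0)))
    where
    c = quot N K
    r = rem N K
    K>0 : 0 < K
    K>0 = ≤-trans (s≤s z≤n) 3≤K
    N≡ : N ≡ c * K + r
    N≡ = proj₁ (division N K K>0)
    r<K : r < K
    r<K = proj₂ (division N K K>0)

  conclude : (((j : ℕ) → (2 ∣ n j) × rem (n j) (k j) ≢ 1 × rem (n j) (k j) ≢ k j ∸ 1)
      ⊎ TendsToInfty (λ j → k j ∸ rem (n j) (k j))) →
    ∃ λ J → (j : ℕ) → J ≤ j → ℚ.∣ ⟦ sp j ⟧ ÷' MMS (n j) (k j) ℚ.- 1ℚ ∣ ℚ.< ε
  conclude (inj₁ even) = proj₁ start , close
    where
    start = large-quotient (threshold q)
    shape : ∀ N K r c → 2 ∣ N × r ≢ 1 × r ≢ K ∸ 1 → r < K → N ≡ c * K + r →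
      r ≡ 0 ⊎ (∃ λ H → c * K + r ≡ H + H) × 2 ≤ r × r + 2 ≤ K
    shape N K zero c _ _ _ = inj₁ refl
    shape N K (suc zero) c (_ , r≢1 , _) _ _ = contradiction refl r≢1
    shape N (suc K) (suc (suc r)) c (divides h N≡ , _ , r≢) r<K n≡ = inj₂ ((h , trans (sym n≡) (trans N≡ (trans (*-comm h 2) (cong (h +_) (+-identityʳ h))))) ,
      s≤s (s≤s z≤n) , ≤-trans (≤-reflexive (+-comm (suc (suc r)) 2)) (s≤s (≤∧≢⇒< (≤-pred r<K) r≢)))
    close : ∀ j → proj₁ start ≤ j → ℚ.∣ ⟦ sp j ⟧ ÷' MMS (n j) (k j) ℚ.- 1ℚ ∣ ℚ.< ε
    close j J≤j = close-at (n j) (k j) (sp j) (proj₁ (bounds j)) (≤-trans (threshold>0 q) q≤c) (sp-max j)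
      λ k>0 r<k n≡ → near-optimal-base q c (k j) r k>0 q≤c (shape (n j) (k j) r c (even j) r<k n≡)
      where
      c = quot (n j) (k j)
      r = rem (n j) (k j)
      q≤c : threshold q ≤ c
      q≤c = proj₂ start j J≤j
  conclude (inj₂ spread) = proj₁ start + proj₁ wide , close
    where
    bound : ℕ
    bound = threshold q + (threshold (refine q) + threshold (refine (refine q)))
    start = large-quotient bound
    wide = spread (2 * refine (refine q) + 3)
    spread-at : ∀ K r c → 0 < K → r < K → bound ≤ c → 2 * refine (refine q) + 3 ≤ K ∸ r → NearOptimal q (c * K + r) K c r
    spread-at (suc K) r c _ r<K large gap = near-optimal-spread q c K r large (m≤o∸n⇒m+n≤o (2 * refine (refine q) + 3) (<⇒≤ r<K) gap)
    close : ∀ j → proj₁ start + proj₁ wide ≤ j → ℚ.∣ ⟦ sp j ⟧ ÷' MMS (n j) (k j) ℚ.- 1ℚ ∣ ℚ.< ε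
    close j J≤j = close-at (n j) (k j) (sp j) (proj₁ (bounds j)) (≤-trans (threshold>0 q) (m+n≤o⇒m≤o (threshold q) large)) (sp-max j)
      λ k>0 r<k _ → spread-at (k j) (rem (n j) (k j)) (quot (n j) (k j)) k>0 r<k large (proj₂ wide j (m+n≤o⇒n≤o (proj₁ start) J≤j))
      where
      large : bound ≤ quot (n j) (k j)
      large = proj₂ start j (m+n≤o⇒m≤o (proj₁ start) J≤j)
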